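{- Let $q$ be an odd prime power and let $L$ be a line of $\mathrm{PG}(5,q)$ in the $K$-orbit $o_{13,2}$. Then the hyperplane-orbit distribution of $L$ is $OD_4(L)=\left[1,\,\frac{q^2+3q}{2},\,\frac{q^2+q}{2},\,q^3-q\right]$.
   Context: A point $(y_0,\dots,y_5)$ of $\mathrm{PG}(5,q)$ is identified with the nonzero symmetric matrix $\begin{bmatrix} y_0&y_1&y_2\\ y_1&y_3&y_4\\ y_2&y_4&y_5\end{bmatrix}$ up to scalar. $K\cong\mathrm{PGL}(3,q)$ acts by $M\mapsto AMA^T$, $A\in\mathrm{GL}(3,q)$. The orbit $o_{13,2}$ (defined only for $q$ odd) is the $K$-orbit of the line $\left\{\begin{bmatrix} 0&x&0\\ x&y&0\\ 0&0&-\delta y\end{bmatrix}:(x,y)\in\mathrm{PG}(1,q)\right\}$, where $\delta$ is a non-square in $\mathbb F_q$. Hyperplanes correspond to conics of $\mathrm{PG}(2,q)$ (nonzero quadratic forms up to scalar): $\sum_{0\le i\le j\le2}a_{ij}X_iX_j$ corresponds to $a_{00}Y_0+a_{01}Y_1+a_{02}Y_2+a_{11}Y_3+a_{12}Y_4+a_{22}Y_5=0$. $\mathcal H_1,\mathcal H_{2,r},\mathcal H_{2,i},\mathcal H_3$ are the sets of hyperplanes corresponding respectively to double lines (scalar multiples of squares of linear forms), pairs of distinct real lines (products of two non-proportional linear forms over $\mathbb F_q$), pairs of conjugate imaginary lines (scalar multiples of products of two non-proportional linear forms conjugate over $\mathbb F_{q^2}$), and non-singular conics (those with $4a_{00}a_{11}a_{22}+a_{01}a_{02}a_{12}-a_{00}a_{12}^2-a_{11}a_{02}^2-a_{22}a_{01}^2\ne0$).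 $OD_4(L)=[h_1,h_{2,r},h_{2,i},h_3]$ lists the numbers of hyperplanes in $\mathcal H_1,\mathcal H_{2,r},\mathcal H_{2,i},\mathcal H_3$ containing $L$. -}

module Defs where

open import Algebra.Bundles using (CommutativeRing)
open import Algebra.Morphism.Structures using (module RingMorphisms)
open import Data.Bool.Base using (if_then_else_)
open import Data.Fin.Base using (Fin)
open import Data.Fin.Patterns using (0F; 1F; 2F; 3F; 4F; 5F)
open import Data.Fin.Properties using (_≟_)
open import Data.Nat.Base as ℕ using (ℕ; suc)
open import Data.Nat.Divisibility using (_∣_)
open import Data.Nat.Primality using (Prime)
open import Data.Product.Base using (Σ; ∃; ∃₂; _×_; _,_; proj₁)
open import Data.Vec.Functional using (Vector; []; _∷_; map; zipWith; replicate)
open import Function.Base using (_∘_; _on_)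
open import Function.Bundles using (Inverse; _⇔_)
open import Level using (Level; _⊔_) renaming (suc to lsuc)
open import Relation.Binary.Bundles using (Setoid)
import Relation.Binary.Construct.On as On
import Relation.Binary.Reasoning.Setoid as ≈-Reasoning
open import Relation.Binary.PropositionalEquality using (_≡_) renaming (setoid to ≡-setoid)
open import Relation.Nullary using (¬_; does)

IsOddPrimePower : ℕ → Set
IsOddPrimePower q = (∃₂ λ p k → Prime p × q ≡ p ℕ.^ suc k) × ¬ (2 ∣ q)

HasCardinality : ∀ {a ℓ} → Setoid a ℓ → ℕ → Set (a ⊔ ℓ)
HasCardinality S n = Inverse S (≡-setoid (Fin n))

-- Elements are counted modulo the ring's own equality _≈_.
record FiniteField (c ℓ : Level) (q : ℕ) : Set (lsuc (c ⊔ ℓ)) where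
  field
    commutativeRing : CommutativeRing c ℓ
  open CommutativeRing commutativeRing public
  field
    0≉1         : ¬ (0# ≈ 1#)
    invertible  : ∀ x → ¬ (x ≈ 0#) → ∃ λ y → x * y ≈ 1#
    cardinality : HasCardinality setoid q

-- A field with q² elements containing F, together with its conjugation over F,
-- i.e. the nontrivial element of Gal(F_{q²} / F_q).
record QuadraticExtension {c ℓ q} (F : FiniteField c ℓ q) (c′ ℓ′ : Level)
    : Set (c ⊔ ℓ ⊔ lsuc (c′ ⊔ ℓ′)) where
  field
    E : FiniteField c′ ℓ′ (q ℕ.^ 2)
  private
    module F = FiniteField F
    module E = FiniteField E
  field
    ι      : F.Carrier → E.Carrier
    ι-mono : RingMorphisms.IsRingMonomorphism F.rawRing E.rawRing ι
    σ            : E.Carrier → E.Carrier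
    σ-iso        : RingMorphisms.IsRingIsomorphism E.rawRing E.rawRing σ
    σ-fixes      : ∀ x → σ (ι x) E.≈ ι x
    σ-nontrivial : ∃ λ x → ¬ (σ x E.≈ x)

module Projective {c ℓ} (R : CommutativeRing c ℓ) where
  open CommutativeRing R
  open import Data.Vec.Functional.Relation.Binary.Equality.Setoid setoid public
    using (_≋_)

  infix 4 _∼_

  _∼_ : ∀ {n} → Vector Carrier n → Vector Carrier n → Set (c ⊔ ℓ)
  v ∼ w = ∃ λ k → ¬ (k ≈ 0#) × v ≋ map (k *_) w

  -- Homogeneous coordinates of a point of PG(n, R), for R a field; two
  -- representatives denote the same point when their coordinates are related
  -- by _∼_.
  record Point (n : ℕ) : Set (c ⊔ ℓ) where
    field
      coords  : Vector Carrier (suc n)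
      nonzero : ¬ (coords ≋ replicate (suc n) 0#)
  open Point public

  -- A ternary quadratic form Σ_{i≤j} aᵢⱼ XᵢXⱼ is its vector of coefficients in
  -- the order (a₀₀, a₀₁, a₀₂, a₁₁, a₁₂, a₂₂).
  _·ₗ_ : Vector Carrier 3 → Vector Carrier 3 → Vector Carrier 6
  l ·ₗ m = l 0F * m 0F
         ∷ l 0F * m 1F + l 1F * m 0F
         ∷ l 0F * m 2F + l 2F * m 0F
         ∷ l 1F * m 1F
         ∷ l 1F * m 2F + l 2F * m 1F
         ∷ l 2F * m 2F
         ∷ []

module Geometry {c ℓ q} (F : FiniteField c ℓ q) where
  open FiniteField F
  open Projective commutativeRing public
  open import Algebra.Properties.Semiring.Sum semiring using (sum)
  open import Algebra.Definitions.RawMonoid +-rawMonoid using ()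
    renaming (_×_ to _·_)

  NonSquare : Carrier → Set (c ⊔ ℓ)
  NonSquare δ = ¬ (∃ λ x → x * x ≈ δ)

  ∼-refl : ∀ {n} {v : Vector Carrier n} → v ∼ v
  ∼-refl = 1# , 0≉1 ∘ sym , λ i → sym (*-identityˡ _)

  ∼-sym : ∀ {n} {v w : Vector Carrier n} → v ∼ w → w ∼ v
  ∼-sym {v = v} {w} (k , k≉0 , v≋kw) with invertible k k≉0
  ... | k⁻¹ , kk⁻¹≈1 = k⁻¹ , k⁻¹≉0 , λ i → begin
      w i               ≈⟨ *-identityˡ (w i) ⟨
      1# * w i          ≈⟨ *-congʳ kk⁻¹≈1 ⟨
      (k * k⁻¹) * w i   ≈⟨ *-congʳ (*-comm k k⁻¹) ⟩
      (k⁻¹ * k) * w i   ≈⟨ *-assoc k⁻¹ k (w i) ⟩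
      k⁻¹ * (k * w i)   ≈⟨ *-congˡ (v≋kw i) ⟨
      k⁻¹ * v i         ∎
    where
    open ≈-Reasoning setoid
    k⁻¹≉0 : ¬ (k⁻¹ ≈ 0#)
    k⁻¹≉0 k⁻¹≈0 = 0≉1 (trans (sym (zeroʳ k)) (trans (*-congˡ (sym k⁻¹≈0)) kk⁻¹≈1))

  ∼-trans : ∀ {n} {u v w : Vector Carrier n} → u ∼ v → v ∼ w → u ∼ w
  ∼-trans {w = w} (k , k≉0 , u≋kv) (m , m≉0 , v≋mw) =
    k * m , km≉0 , λ i → trans (u≋kv i) (trans (*-congˡ (v≋mw i)) (sym (*-assoc k m (w i))))
    where
    open ≈-Reasoning setoid
    km≉0 : ¬ (k * m ≈ 0#)
    km≉0 km≈0 with invertible m m≉0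
    ... | m⁻¹ , mm⁻¹≈1 = k≉0 (begin
      k               ≈⟨ *-identityʳ k ⟨
      k * 1#          ≈⟨ *-congˡ mm⁻¹≈1 ⟨
      k * (m * m⁻¹)   ≈⟨ *-assoc k m m⁻¹ ⟨
      (k * m) * m⁻¹   ≈⟨ *-congʳ km≈0 ⟩
      0# * m⁻¹        ≈⟨ zeroˡ m⁻¹ ⟩
      0#              ∎)

  pointSetoid : ℕ → Setoid (c ⊔ ℓ) (c ⊔ ℓ)
  pointSetoid n = record
    { Carrier       = Point n
    ; _≈_           = _∼_ on coords
    ; isEquivalence = record { refl = ∼-refl ; sym = ∼-sym ; trans = ∼-trans }
    }

  Matrix : Set c
  Matrix = Fin 3 → Fin 3 → Carrier

  infix 4 _≈ₘ_
  infixl 7 _*ₘ_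

  _≈ₘ_ : Matrix → Matrix → Set ℓ
  A ≈ₘ B = ∀ i j → A i j ≈ B i j

  _*ₘ_ : Matrix → Matrix → Matrix
  (A *ₘ B) i j = sum λ k → A i k * B k j

  _ᵀ : Matrix → Matrix
  (A ᵀ) i j = A j i

  1ₘ : Matrix
  1ₘ i j = if does (i ≟ j) then 1# else 0#

  IsInvertible : Matrix → Set (c ⊔ ℓ)
  IsInvertible A = ∃ λ B → A *ₘ B ≈ₘ 1ₘ × B *ₘ A ≈ₘ 1ₘ

  symMatrix : Vector Carrier 6 → Matrix
  symMatrix y = (y 0F ∷ y 1F ∷ y 2F ∷ [])
              ∷ (y 1F ∷ y 3F ∷ y 4F ∷ [])
              ∷ (y 2F ∷ y 4F ∷ y 5F ∷ [])
              ∷ []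

  -- MapsTo A P Q: the collineation M ↦ A M Aᵀ sends the point P to the point Q.
  MapsTo : Matrix → Point 5 → Point 5 → Set (c ⊔ ℓ)
  MapsTo A P Q = ∃ λ k → ¬ (k ≈ 0#) ×
    (∀ i j → symMatrix (coords Q) i j ≈ k * (A *ₘ symMatrix (coords P) *ₘ A ᵀ) i j)

  -- The line joining two distinct points of PG(5, q).
  record Line : Set (c ⊔ ℓ) where
    field
      P₁ P₂    : Point 5
      distinct : ¬ (coords P₁ ∼ coords P₂)

  _∈ₗ_ : Point 5 → Line → Set (c ⊔ ℓ)
  P ∈ₗ L = ∃₂ λ a b →
    coords P ≋ zipWith _+_ (map (a *_) (coords P₁)) (map (b *_) (coords P₂))
    where open Line L

  _∈ℓ₁₃,₂[_] : Point 5 → Carrier → Set (c ⊔ ℓ)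
  P ∈ℓ₁₃,₂[ δ ] = Σ (Point 1) λ t → let x = coords t 0F; y = coords t 1F in
    coords P ∼ (0# ∷ x ∷ 0# ∷ y ∷ 0# ∷ - (δ * y) ∷ [])

  -- The point set of L is the image, under some element of K, of the
  -- representative line with parameter δ.
  _∈o₁₃,₂[_] : Line → Carrier → Set (c ⊔ ℓ)
  L ∈o₁₃,₂[ δ ] = ∃ λ A → IsInvertible A ×
    (∀ Q → Q ∈ₗ L ⇔ (∃ λ P → P ∈ℓ₁₃,₂[ δ ] × MapsTo A P Q))

  -- A hyperplane is given by its dual coordinates, which are also the
  -- coefficients of the corresponding conic.
  Hyperplane : Set (c ⊔ ℓ)
  Hyperplane = Point 5

  _∈ₕ_ : Point 5 → Hyperplane → Set ℓ
  P ∈ₕ H = sum (zipWith _*_ (coords H) (coords P)) ≈ 0#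

  _⊆ₕ_ : Line → Hyperplane → Set (c ⊔ ℓ)
  L ⊆ₕ H = ∀ P → P ∈ₗ L → P ∈ₕ H

  𝓗₁ : Hyperplane → Set (c ⊔ ℓ)
  𝓗₁ H = Σ (Point 2) λ l → coords H ∼ (coords l ·ₗ coords l)

  𝓗₂,ᵣ : Hyperplane → Set (c ⊔ ℓ)
  𝓗₂,ᵣ H = Σ (Point 2) λ l → Σ (Point 2) λ m →
    ¬ (coords l ∼ coords m) × coords H ∼ (coords l ·ₗ coords m)

  -- The scalar hidden in E.∼ is taken in F_{q²}; both l·l̄ and H have
  -- coefficients in F_q, so it necessarily lies in F_q.
  𝓗₂,ᵢ : ∀ {c′ ℓ′} → QuadraticExtension F c′ ℓ′ → Hyperplane → Set (c′ ⊔ ℓ′)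
  𝓗₂,ᵢ X H = Σ (E.Point 2) λ l → let l̄ = map σ (E.coords l) in
    ¬ (E.coords l E.∼ l̄) × map ι (coords H) E.∼ (E.coords l E.·ₗ l̄)
    where
    open QuadraticExtension X
    module E = Projective (FiniteField.commutativeRing E)

  disc : Vector Carrier 6 → Carrier
  disc a = 4 · (a₀₀ * a₁₁ * a₂₂) + a₀₁ * a₀₂ * a₁₂
         - a₀₀ * (a₁₂ * a₁₂) - a₁₁ * (a₀₂ * a₀₂) - a₂₂ * (a₀₁ * a₀₁)
    where
    a₀₀ = a 0F
    a₀₁ = a 1F
    a₀₂ = a 2F
    a₁₁ = a 3F
    a₁₂ = a 4F
    a₂₂ = a 5F

  𝓗₃ : Hyperplane → Set ℓ
  𝓗₃ H = ¬ (disc (coords H) ≈ 0#)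

  hyperplanesThrough : ∀ {p} → Line → (Hyperplane → Set p) → Setoid (c ⊔ ℓ ⊔ p) (c ⊔ ℓ)
  hyperplanesThrough L 𝓗 =
    On.setoid {B = Σ Hyperplane λ H → 𝓗 H × L ⊆ₕ H} (pointSetoid 5) proj₁

  OD₄[_,_]≡[_,_,_,_] : ∀ {c′ ℓ′} → QuadraticExtension F c′ ℓ′ → Line →
    ℕ → ℕ → ℕ → ℕ → Set (c ⊔ ℓ ⊔ c′ ⊔ ℓ′)
  OD₄[ X , L ]≡[ h₁ , h₂,ᵣ , h₂,ᵢ , h₃ ] =
    HasCardinality (hyperplanesThrough L 𝓗₁)       h₁   ×
    HasCardinality (hyperplanesThrough L 𝓗₂,ᵣ)     h₂,ᵣ ×
    HasCardinality (hyperplanesThrough L (𝓗₂,ᵢ X)) h₂,ᵢ ×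
    HasCardinality (hyperplanesThrough L 𝓗₃)       h₃

{-# OPTIONS --safe #-}

-- A collineation M ↦ A M Aᵀ acts on conics by f ↦ f ∘ A, which preserves each
-- of the four types (the discriminant is multiplied by det(A)²), so L may be
-- taken to be the standard line.  The conics of the hyperplanes through it are
--   a X₀² + b X₀X₂ + c (δ X₁² + X₂²) + d X₁X₂,
-- with discriminant a (4δc² − d²) − δcb², where 4δ − d² never vanishes because
-- δ is a nonsquare.  For c = 0 a singular conic is X₀², X₀ (a X₀ + X₂) or
-- X₂ (b X₀ + X₁).  For c = 1 it is determined by b and d, and it is the product
--   (u t X₀ + u X₁ + X₂) (− v t X₀ + v X₁ + X₂)   with u v = δ, u + v = d,
-- real if u, v lie in F and imaginary if they are conjugate over F.  The
-- fixed-point-free involution u ↦ δ/u shows that q − 1 is twice the number of d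
-- of the first kind.

module Submission where

open import Algebra.Bundles using (CommutativeRing)
open import Algebra.Morphism.Structures using (module RingMorphisms)
open import Algebra.Solver.Ring.AlmostCommutativeRing using (fromCommutativeRing; _-Raw-AlmostCommutative⟶_)
open import Data.Bool.Base using (true; false; if_then_else_)
open import Data.Fin.Base as Fin using (Fin; zero; suc; toℕ; combine; remQuot; join; splitAt)
open import Data.Fin.Patterns using (0F; 1F; 2F; 3F; 4F; 5F)
import Data.Fin.Permutation as Permutation
import Data.Fin.Properties as Fin
open import Data.Integer.Base as ℤ using (ℤ; +_; -[1+_])
import Data.Integer.Properties as ℤ
open import Data.Maybe.Base using (Maybe; just; nothing)
open import Data.Nat.Base as ℕ using (ℕ; zero; suc)
open import Data.Nat.Divisibility using (_∣_; divides)
import Data.Nat.DivMod as ℕ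
import Data.Nat.Properties as ℕ
open import Data.Nat.Tactic.RingSolver using (solve-∀)
open import Data.Product.Base using (Σ; ∃; ∃₂; _×_; _,_; proj₁; proj₂; uncurry)
open import Data.Product.Function.NonDependent.Setoid using (_×-inverse_)
open import Data.Product.Relation.Binary.Pointwise.NonDependent using (_×ₛ_; ≡×≡⇒≡; ≡⇒≡×≡)
open import Data.Sum.Base using (_⊎_; inj₁; inj₂; [_,_]′)
open import Data.Sum.Function.Setoid using (_⊎-inverse_)
open import Data.Sum.Relation.Binary.Pointwise using (_⊎ₛ_; inj₁; inj₂; Pointwise-≡⇒≡; ≡⇒Pointwise-≡)
import Data.Vec.Base as Vec
open import Data.Vec.Functional using (Vector; []; _∷_; map; zipWith; replicate)
open import Function.Base using (_∘_; id)
open import Function.Bundles using (Inverse; Equivalence)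
import Function.Construct.Composition as Composition
import Function.Construct.Identity as Identity
import Function.Construct.Symmetry as Symmetry
open import Level using (Level; _⊔_)
open import Relation.Binary.Bundles using (Setoid)
import Relation.Binary.Construct.On as On
open import Relation.Binary.Definitions using (Tri; tri<; tri≈; tri>)
open import Relation.Binary.PropositionalEquality as ≡ using (_≡_)
import Relation.Binary.Reasoning.Setoid as ≈-Reasoning
open import Relation.Nullary using (¬_; Dec; yes; no; contradiction; does)
open import Relation.Unary using (Pred; Decidable)

open import Defs

-- Cardinalities are bijections with `Fin n`, so an unordered pair of lines needs a canonical order.
-- In the real case the enumeration of the units supplies it: u is required to come before δ/u. With
-- q = 2k + 1 this leaves k values of u and all q values of t, hence 2q + kq real pairs. In the
-- imaginary case no choice is made: a pair is recorded by the coefficients d and b in F, and a is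
-- forced by singularity. The k + 1 values of d for which X² - dX + δ has no root in F give (k + 1)
-- q pairs. The harder half there is existence: for each such d a root must be found in the given
-- field of q² elements, of which only the size and a nontrivial automorphism σ fixing F are known.
-- Counting shows that 1 and any θ moved by σ span it over F. Then Θ = θ - σ θ is negated by σ and
-- its square is a nonsquare of F. Any two nonsquares of F differ by a square factor, so d² - 4δ
-- acquires a square root negated by σ, and the two roots of X² - dX + δ are conjugate.

-- Ring identities with integer coefficients

module IntegerSolver {c ℓ} (R : CommutativeRing c ℓ) where
  open CommutativeRing R
  open import Algebra.Properties.Ring ring using (-0#≈0#; -‿distribˡ-*; -‿distribʳ-*; -‿involutive; -‿+-comm)
  open import Algebra.Properties.Semiring.Mult.TCOptimised semiring using (×-homo-+; ×1-homo-*; 1+×) renaming (_×_ to _·_)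
  open ≈-Reasoning setoid

  -- The optimised multiple makes `con (+ 0)` and `con (+ 1)` evaluate to `0#` and `1#`
  -- definitionally, so solved identities fit the goals as written.
  ⟦_⟧ℤ : ℤ → Carrier
  ⟦ + n      ⟧ℤ = n · 1#
  ⟦ -[1+ n ] ⟧ℤ = - (suc n · 1#)

  private
    cancel-1+ : ∀ x y → x - y ≈ (1# + x) - (1# + y)
    cancel-1+ x y = begin
      x - y                      ≈⟨ +-identityˡ (x - y) ⟨
      0# + (x - y)               ≈⟨ +-congʳ (-‿inverseʳ 1#) ⟨
      (1# - 1#) + (x - y)        ≈⟨ +-assoc 1# (- 1#) (x - y) ⟩
      1# + (- 1# + (x - y))      ≈⟨ +-congˡ (+-assoc (- 1#) x (- y)) ⟨
      1# + ((- 1# + x) - y)      ≈⟨ +-congˡ (+-congʳ (+-comm (- 1#) x)) ⟩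
      1# + ((x - 1#) - y)        ≈⟨ +-congˡ (+-assoc x (- 1#) (- y)) ⟩
      1# + (x + (- 1# - y))      ≈⟨ +-assoc 1# x (- 1# - y) ⟨
      (1# + x) + (- 1# - y)      ≈⟨ +-congˡ (-‿+-comm 1# y) ⟩
      (1# + x) - (1# + y)        ∎

    ⊖-homo : ∀ m n → ⟦ m ℤ.⊖ n ⟧ℤ ≈ m · 1# - n · 1#
    ⊖-homo zero    zero    = sym (-‿inverseʳ 0#)
    ⊖-homo zero    (suc n) = sym (+-identityˡ _)
    ⊖-homo (suc m) zero    = sym (trans (+-congˡ -0#≈0#) (+-identityʳ _))
    ⊖-homo (suc m) (suc n) = begin
      ⟦ suc m ℤ.⊖ suc n ⟧ℤ             ≡⟨ ≡.cong ⟦_⟧ℤ (ℤ.[1+m]⊖[1+n]≡m⊖n m n) ⟩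
      ⟦ m ℤ.⊖ n ⟧ℤ                     ≈⟨ ⊖-homo m n ⟩
      m · 1# - n · 1#                  ≈⟨ cancel-1+ _ _ ⟩
      (1# + m · 1#) - (1# + n · 1#)    ≈⟨ +-cong (1+× m 1#) (-‿cong (1+× n 1#)) ⟨
      suc m · 1# - suc n · 1#          ∎

    ⟦⟧-+-homo : ∀ i j → ⟦ i ℤ.+ j ⟧ℤ ≈ ⟦ i ⟧ℤ + ⟦ j ⟧ℤ
    ⟦⟧-+-homo (+ m)      (+ n)      = ×-homo-+ 1# m n
    ⟦⟧-+-homo (+ m)      -[1+ n ]   = ⊖-homo m (suc n)
    ⟦⟧-+-homo -[1+ m ]   (+ n)      = trans (⊖-homo n (suc m)) (+-comm _ _)
    ⟦⟧-+-homo -[1+ m ]   -[1+ n ]   = begin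
      - (suc (suc (m ℕ.+ n)) · 1#)      ≡⟨ ≡.cong (λ k → - (k · 1#)) (≡.sym (≡.cong suc (ℕ.+-suc m n))) ⟩
      - ((suc m ℕ.+ suc n) · 1#)        ≈⟨ -‿cong (×-homo-+ 1# (suc m) (suc n)) ⟩
      - (suc m · 1# + suc n · 1#)       ≈⟨ -‿+-comm _ _ ⟨
      - (suc m · 1#) - (suc n · 1#)     ∎

    ⟦⟧-neg-homo : ∀ i → ⟦ ℤ.- i ⟧ℤ ≈ - ⟦ i ⟧ℤ
    ⟦⟧-neg-homo (+ zero)    = sym -0#≈0#
    ⟦⟧-neg-homo (+ suc n)   = refl
    ⟦⟧-neg-homo -[1+ n ]    = sym (-‿involutive _)

    ⟦⟧-*⁺-homo : ∀ m j → ⟦ + m ℤ.* j ⟧ℤ ≈ m · 1# * ⟦ j ⟧ℤ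
    ⟦⟧-*⁺-homo m (+ n)    = trans (reflexive (≡.cong ⟦_⟧ℤ (≡.sym (ℤ.pos-* m n)))) (×1-homo-* m n)
    ⟦⟧-*⁺-homo m -[1+ n ] = begin
      ⟦ + m ℤ.* -[1+ n ] ⟧ℤ            ≡⟨ ≡.cong ⟦_⟧ℤ (ℤ.neg-distribʳ-* (+ m) (+ suc n)) ⟨
      ⟦ ℤ.- (+ m ℤ.* + suc n) ⟧ℤ       ≈⟨ ⟦⟧-neg-homo (+ m ℤ.* + suc n) ⟩
      - ⟦ + m ℤ.* + suc n ⟧ℤ           ≈⟨ -‿cong (⟦⟧-*⁺-homo m (+ suc n)) ⟩
      - (m · 1# * suc n · 1#)          ≈⟨ -‿distribʳ-* _ _ ⟩
      m · 1# * - (suc n · 1#)          ∎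

    ⟦⟧-*-homo : ∀ i j → ⟦ i ℤ.* j ⟧ℤ ≈ ⟦ i ⟧ℤ * ⟦ j ⟧ℤ
    ⟦⟧-*-homo (+ m)    j = ⟦⟧-*⁺-homo m j
    ⟦⟧-*-homo -[1+ m ] j = begin
      ⟦ -[1+ m ] ℤ.* j ⟧ℤ              ≡⟨ ≡.cong ⟦_⟧ℤ (ℤ.neg-distribˡ-* (+ suc m) j) ⟨
      ⟦ ℤ.- (+ suc m ℤ.* j) ⟧ℤ         ≈⟨ ⟦⟧-neg-homo (+ suc m ℤ.* j) ⟩
      - ⟦ + suc m ℤ.* j ⟧ℤ             ≈⟨ -‿cong (⟦⟧-*⁺-homo (suc m) j) ⟩
      - (suc m · 1# * ⟦ j ⟧ℤ)          ≈⟨ -‿distribˡ-* _ _ ⟩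
      - (suc m · 1#) * ⟦ j ⟧ℤ          ∎

    homomorphism : ℤ.+-*-rawRing -Raw-AlmostCommutative⟶ fromCommutativeRing R
    homomorphism = record
      { ⟦_⟧    = ⟦_⟧ℤ
      ; +-homo = ⟦⟧-+-homo
      ; *-homo = ⟦⟧-*-homo
      ; -‿homo = ⟦⟧-neg-homo
      ; 0-homo = refl
      ; 1-homo = refl
      }

    -- Coefficients are compared in ℤ, so the solver proves only identities valid in every
    -- commutative ring; facts special to a field enter as hypotheses of `lc₁`, `lc₂` and `lc₃`.
    _≟ℤ_ : ∀ i j → Maybe (⟦ i ⟧ℤ ≈ ⟦ j ⟧ℤ)
    i ≟ℤ j with i ℤ.≟ j
    ... | yes ≡.refl = just refl
    ... | no  _      = nothing

  open import Algebra.Solver.Ring ℤ.+-*-rawRing (fromCommutativeRing R) homomorphism _≟ℤ_ public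
    using (solve; _:=_; _:+_; _:*_; _:-_; :-_; con; var; prove; Polynomial)

-- Cardinalities of finite setoids

module Cardinality where

  private
    variable
      c₁ c₂ ℓ₁ ℓ₂ ℓ₃ : Level
      m n : ℕ

  -- Equality ignores the proof component, so an element counts once however many witnesses of `P`
  -- it has.
  Sub : (S : Setoid c₁ ℓ₁) → Pred (Setoid.Carrier S) ℓ₃ → Setoid (c₁ ⊔ ℓ₃) ℓ₁
  Sub S P = On.setoid {B = Σ (Setoid.Carrier S) P} S proj₁

  FinSetoid : ℕ → Setoid _ _
  FinSetoid n = ≡.setoid (Fin n)

  module _ {S : Setoid c₁ ℓ₁} {T : Setoid c₂ ℓ₂} where
    private
      module S = Setoid S
      module T = Setoid T

    -- The preimages picked by surjectivity respect equality because `f` reflects it.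
    card-bijection : HasCardinality S n → (f : S.Carrier → T.Carrier) →
      (∀ {x y} → x S.≈ y → f x T.≈ f y) →
      (∀ {x y} → f x T.≈ f y → x S.≈ y) →
      (∀ y → ∃ λ x → f x T.≈ y) →
      HasCardinality T n
    card-bijection I f f-cong f-inj f-surj = record
      { to        = to ∘ g
      ; from      = f ∘ from
      ; to-cong   = to-cong ∘ g-cong
      ; from-cong = f-cong ∘ from-cong
      ; inverse   = (λ y≈ → inverseˡ (f-inj (T.trans (proj₂ (f-surj _)) y≈)))
                  , (λ i≡ → T.trans (f-cong (inverseʳ i≡)) (proj₂ (f-surj _)))
      }
      where
      open Inverse I
      g : T.Carrier → S.Carrier
      g y = proj₁ (f-surj y)
      g-cong : ∀ {x y} → x T.≈ y → g x S.≈ g y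
      g-cong x≈y = f-inj (T.trans (proj₂ (f-surj _)) (T.trans x≈y (T.sym (proj₂ (f-surj _)))))

    card-× : HasCardinality S m → HasCardinality T n → HasCardinality (S ×ₛ T) (m ℕ.* n)
    card-× {m} {n} I J = Composition.inverse (I ×-inverse J) (record
      { to        = uncurry combine
      ; from      = remQuot {m} n
      ; to-cong   = λ x≈y → ≡.cong (uncurry combine) (≡×≡⇒≡ x≈y)
      ; from-cong = λ i≡j → ≡⇒≡×≡ (≡.cong (remQuot {m} n) i≡j)
      ; inverse   = (λ {i} y≈ → ≡.trans (≡.cong (uncurry combine) (≡×≡⇒≡ y≈)) (Fin.combine-remQuot {m} n i))
                  , (λ { {i , j} ≡.refl → ≡⇒≡×≡ (Fin.remQuot-combine i j) })
      })

    card-⊎ : HasCardinality S m → HasCardinality T n → HasCardinality (S ⊎ₛ T) (m ℕ.+ n)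
    card-⊎ {m} {n} I J = Composition.inverse (I ⊎-inverse J) (record
      { to        = join m n
      ; from      = splitAt m
      ; to-cong   = λ x≈y → ≡.cong (join m n) (Pointwise-≡⇒≡ x≈y)
      ; from-cong = λ i≡j → ≡⇒Pointwise-≡ (≡.cong (splitAt m) i≡j)
      ; inverse   = (λ {i} y≈ → ≡.trans (≡.cong (join m n) (Pointwise-≡⇒≡ y≈)) (Fin.join-splitAt m n i))
                  , (λ { {x} ≡.refl → ≡⇒Pointwise-≡ (Fin.splitAt-join m n x) })
      })

  card-Fin : ∀ n → HasCardinality (FinSetoid n) n
  card-Fin n = Identity.inverse (FinSetoid n)

  module _ {S : Setoid c₁ ℓ₁} where
    private module S = Setoid S

    card-unique : HasCardinality S m → HasCardinality S n → m ≡ n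
    card-unique I J = Permutation.↔⇒≡ (Composition.inverse (Symmetry.inverse I) J)

    module _ (I : HasCardinality S n) where
      open Inverse I

      to-injective : ∀ {x y} → to x ≡ to y → x S.≈ y
      to-injective tx≡ty = S.trans (S.sym (inverseʳ ≡.refl)) (inverseʳ tx≡ty)

      card⇒≟ : ∀ x y → Dec (x S.≈ y)
      card⇒≟ x y with to x Fin.≟ to y
      ... | yes tx≡ty = yes (to-injective tx≡ty)
      ... | no  tx≢ty = no (tx≢ty ∘ to-cong)

      card⇒any? : {P : Pred S.Carrier ℓ₃} → (∀ {x y} → x S.≈ y → P x → P y) → Decidable P → Dec (∃ P)
      card⇒any? P-resp P? with Fin.any? (P? ∘ from)
      ... | yes (i , pi) = yes (from i , pi)
      ... | no  ¬∃       = no λ { (x , px) → ¬∃ (to x , P-resp (S.sym (inverseʳ ≡.refl)) px) }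

      -- Pigeonhole: a missed value `y`, added to the n values of `f`, would give an injection from
      -- n + 1 indices into n.
      injective⇒surjective : {T : Setoid c₂ ℓ₂} → HasCardinality T n → (f : Setoid.Carrier T → S.Carrier) →
        (∀ {x y} → f x S.≈ f y → Setoid._≈_ T x y) → ∀ y → ∃ λ x → f x S.≈ y
      injective⇒surjective {T = T} J f f-inj y with Fin.any? (λ i → to (f (J.from i)) Fin.≟ to y)
        where module J = Inverse J
      ... | yes (i , eq) = Inverse.from J i , to-injective eq
      ... | no  ¬∃ = contradiction (Fin.injective⇒≤ {f = g} g-inj) ℕ.1+n≰n
        where
        module J = Inverse J
        g : Fin (suc n) → Fin n
        g zero    = to y
        g (suc i) = to (f (J.from i))
        g-inj : ∀ {i j} → g i ≡ g j → i ≡ j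
        g-inj {zero}  {zero}  eq = ≡.refl
        g-inj {zero}  {suc j} eq = contradiction (j , ≡.sym eq) ¬∃
        g-inj {suc i} {zero}  eq = contradiction (i , eq) ¬∃
        g-inj {suc i} {suc j} eq = ≡.cong suc
          (≡.trans (≡.sym (J.inverseˡ (Setoid.refl T)))
            (J.inverseˡ (f-inj (to-injective eq))))

  private
    card-suc : {P : Pred (Fin (suc n)) ℓ₃} → P zero →
      HasCardinality (Sub (FinSetoid n) (P ∘ suc)) m → HasCardinality (Sub (FinSetoid (suc n)) P) (suc m)
    card-suc {m = m} {P = P} p0 I = card-bijection (card-Fin (suc m)) f (λ { ≡.refl → ≡.refl }) f-inj f-surj
      where
      open Inverse I
      f : Fin (suc m) → ∃ P
      f zero    = zero , p0
      f (suc i) = suc (proj₁ (from i)) , proj₂ (from i)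
      f-inj : ∀ {i j} → proj₁ (f i) ≡ proj₁ (f j) → i ≡ j
      f-inj {zero}  {zero}  eq = ≡.refl
      f-inj {suc i} {suc j} eq = ≡.cong suc (≡.trans (≡.sym (strictlyInverseˡ i)) (inverseˡ (Fin.suc-injective eq)))
      f-surj : ∀ y → ∃ λ i → proj₁ (f i) ≡ proj₁ y
      f-surj (zero  , _)  = zero , ≡.refl
      f-surj (suc j , pj) = suc (to (j , pj)) , ≡.cong suc (inverseʳ ≡.refl)

    card-skip : {P : Pred (Fin (suc n)) ℓ₃} → ¬ P zero →
      HasCardinality (Sub (FinSetoid n) (P ∘ suc)) m → HasCardinality (Sub (FinSetoid (suc n)) P) m
    card-skip ¬p0 I = card-bijection I (λ { (i , pi) → suc i , pi }) (≡.cong suc) Fin.suc-injective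
      λ { (zero , p0) → contradiction p0 ¬p0 ; (suc i , pi) → (i , pi) , ≡.refl }

    card-split-Fin : ∀ n {P : Pred (Fin n) ℓ₃} → Decidable P → ∃₂ λ i j → i ℕ.+ j ≡ n ×
      HasCardinality (Sub (FinSetoid n) P) i × HasCardinality (Sub (FinSetoid n) (¬_ ∘ P)) j
    card-split-Fin zero P? = 0 , 0 , ≡.refl , empty , empty
      where
      empty : ∀ {p} {P : Pred (Fin 0) p} → HasCardinality (Sub (FinSetoid 0) P) 0
      empty = card-bijection (card-Fin 0) (λ ()) (λ { {()} }) (λ { {()} }) (λ { (() , _) })
    card-split-Fin (suc n) P? with card-split-Fin n (P? ∘ suc) | P? zero
    ... | i , j , i+j≡n , I , J | yes p0 = suc i , j , ≡.cong suc i+j≡n , card-suc p0 I , card-skip (λ ¬p0 → ¬p0 p0) J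
    ... | i , j , i+j≡n , I , J | no ¬p0 = i , suc j , ≡.trans (ℕ.+-suc i j) (≡.cong suc i+j≡n) , card-skip ¬p0 I , card-suc ¬p0 J

  module _ {S : Setoid c₁ ℓ₁} (I : HasCardinality S n) where
    private module S = Setoid S
    open Inverse I

    private
      card-Sub : {P : Pred S.Carrier ℓ₃} → (∀ {x y} → x S.≈ y → P x → P y) →
        HasCardinality (Sub (FinSetoid n) (P ∘ from)) m → HasCardinality (Sub S P) m
      card-Sub P-resp J = card-bijection J (λ { (i , pi) → from i , pi }) from-cong
        (λ eq → ≡.trans (≡.sym (inverseˡ S.refl)) (inverseˡ eq))
        λ { (x , px) → (to x , P-resp (S.sym (inverseʳ ≡.refl)) px) , inverseʳ ≡.refl }

    card-split : {P : Pred S.Carrier ℓ₃} → (∀ {x y} → x S.≈ y → P x → P y) → Decidable P →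
      ∃₂ λ i j → i ℕ.+ j ≡ n × HasCardinality (Sub S P) i × HasCardinality (Sub S (¬_ ∘ P)) j
    card-split P-resp P? with card-split-Fin n (P? ∘ from)
    ... | i , j , i+j≡n , J , K = i , j , i+j≡n , card-Sub P-resp J , card-Sub (λ x≈y ¬px py → ¬px (P-resp (S.sym x≈y) py)) K

    -- Each orbit of τ is represented by its element of smaller index.
    card-involution : (τ : S.Carrier → S.Carrier) → (∀ {x y} → x S.≈ y → τ x S.≈ τ y) →
      (∀ x → τ (τ x) S.≈ x) → (∀ x → ¬ (τ x S.≈ x)) →
      ∃ λ k → n ≡ k ℕ.+ k × HasCardinality (Sub S (λ x → to x Fin.< to (τ x))) k
    card-involution τ τ-cong ττ≈id τ-free with card-split <-resp (λ x → to x Fin.<? to (τ x))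
      where
      <-resp : ∀ {x y} → x S.≈ y → to x Fin.< to (τ x) → to y Fin.< to (τ y)
      <-resp x≈y = ≡.subst₂ Fin._<_ (to-cong x≈y) (to-cong (τ-cong x≈y))
    ... | i , j , i+j≡n , J , K = i , ≡.trans (≡.sym i+j≡n) (≡.cong (i ℕ.+_) (card-unique K swapped)) , J
      where
      -- `τ` itself carries the elements that precede their image onto the others; being free of
      -- fixed points, it leaves no ties.
      swapped : HasCardinality (Sub S (λ x → ¬ (to x Fin.< to (τ x)))) i
      swapped = card-bijection J
        (λ { (x , x<τx) → τ x , λ τx<ττx → ℕ.<-asym x<τx (≡.subst (to (τ x) Fin.<_) (to-cong (ττ≈id x)) τx<ττx) })
        τ-cong
        (λ {x} {y} τx≈τy → S.trans (S.sym (ττ≈id _)) (S.trans (τ-cong τx≈τy) (ττ≈id _)))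
        λ { (y , y≮τy) → (τ y , ≡.subst (to (τ y) Fin.<_) (≡.sym (to-cong (ττ≈id y)))
              (ℕ.≤∧≢⇒< (ℕ.≮⇒≥ y≮τy) (λ eq → τ-free y (to-injective I (Fin.toℕ-injective eq)))) ) , ττ≈id y }

open Cardinality

-- Ternary quadratic forms and substitution

module QuadraticForms {c ℓ} (R : CommutativeRing c ℓ) where
  open CommutativeRing R
  open Projective R
  open IntegerSolver R
  open import Algebra.Properties.Semiring.Sum semiring using (sum)
  open import Algebra.Definitions.RawMonoid +-rawMonoid using ()
    renaming (_×_ to _·_)
  open import Algebra.Properties.Monoid.Mult +-monoid using (×-congʳ)

  Matrix : Set c
  Matrix = Fin 3 → Fin 3 → Carrier

  infix 4 _≈ₘ_
  infixl 7 _*ₘ_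

  _≈ₘ_ : Matrix → Matrix → Set ℓ
  A ≈ₘ B = ∀ i j → A i j ≈ B i j

  _*ₘ_ : Matrix → Matrix → Matrix
  (A *ₘ B) i j = sum λ k → A i k * B k j

  1ₘ : Matrix
  1ₘ i j = if does (i Fin.≟ j) then 1# else 0#

  infixr 7 _*ᵥ_
  infixl 7 _ᵥ*_

  _*ᵥ_ : Matrix → Vector Carrier 3 → Vector Carrier 3
  (A *ᵥ v) i = sum λ k → A i k * v k

  _ᵥ*_ : Vector Carrier 3 → Matrix → Vector Carrier 3
  (l ᵥ* A) j = sum λ k → l k * A k j

  col : Matrix → Fin 3 → Vector Carrier 3
  col A j i = A i j

  ⟨_,_⟩ : Vector Carrier 6 → Vector Carrier 6 → Carrier
  ⟨ a , y ⟩ = sum (zipWith _*_ a y)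

  quad : Vector Carrier 6 → Vector Carrier 3 → Carrier
  quad a v = a 0F * (v 0F * v 0F) + a 1F * (v 0F * v 1F) + a 2F * (v 0F * v 2F)
           + a 3F * (v 1F * v 1F) + a 4F * (v 1F * v 2F) + a 5F * (v 2F * v 2F)

  -- The polarisation `quad a (v + w) − quad a v − quad a w`, expanded so that no division by 2
  -- occurs.
  polar : Vector Carrier 6 → Vector Carrier 3 → Vector Carrier 3 → Carrier
  polar a v w = a 0F * (v 0F * w 0F + v 0F * w 0F) + a 1F * (v 0F * w 1F + v 1F * w 0F)
              + a 2F * (v 0F * w 2F + v 2F * w 0F) + a 3F * (v 1F * w 1F + v 1F * w 1F)
              + a 4F * (v 1F * w 2F + v 2F * w 1F) + a 5F * (v 2F * w 2F + v 2F * w 2F)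

  -- The coefficients of X ↦ quad a (A X).
  pull : Matrix → Vector Carrier 6 → Vector Carrier 6
  pull A a = quad a (col A 0F)
           ∷ polar a (col A 0F) (col A 1F)
           ∷ polar a (col A 0F) (col A 2F)
           ∷ quad a (col A 1F)
           ∷ polar a (col A 1F) (col A 2F)
           ∷ quad a (col A 2F)
           ∷ []

  det : Matrix → Carrier
  det A = A 0F 0F * (A 1F 1F * A 2F 2F - A 1F 2F * A 2F 1F)
        - A 0F 1F * (A 1F 0F * A 2F 2F - A 1F 2F * A 2F 0F)
        + A 0F 2F * (A 1F 0F * A 2F 1F - A 1F 1F * A 2F 0F)

  discriminant : Vector Carrier 6 → Carrier
  discriminant a = 4 · (a 0F * a 3F * a 5F) + a 1F * a 2F * a 4F
         - a 0F * (a 4F * a 4F) - a 3F * (a 2F * a 2F) - a 5F * (a 1F * a 1F)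

  -- The matrix A M Aᵀ, with M the symmetric matrix of `y`, unfolded to agree definitionally with
  -- the product in `MapsTo`.
  transform : Matrix → Vector Carrier 6 → Matrix
  transform A y i j = sum λ l → (sum λ k → A i k * symMatrix k l) * A j l
    where
    symMatrix : Matrix
    symMatrix = (y 0F ∷ y 1F ∷ y 2F ∷ [])
              ∷ (y 1F ∷ y 3F ∷ y 4F ∷ [])
              ∷ (y 2F ∷ y 4F ∷ y 5F ∷ [])
              ∷ []

  upperTriangle : Matrix → Vector Carrier 6
  upperTriangle M = M 0F 0F ∷ M 0F 1F ∷ M 0F 2F ∷ M 1F 1F ∷ M 1F 2F ∷ M 2F 2F ∷ []

  private
    PolyMatrix : ℕ → Set
    PolyMatrix n = Fin 3 → Fin 3 → Polynomial n

    -- The symbolic counterparts mirror the definitions above literally, down to the final zero of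
    -- `sum`, so that they evaluate to the goals.
    sumP : ∀ {n} → Vector (Polynomial n) 3 → Polynomial n
    sumP v = v 0F :+ (v 1F :+ (v 2F :+ con (+ 0)))

    quadP : ∀ {n} → Vector (Polynomial n) 6 → Vector (Polynomial n) 3 → Polynomial n
    quadP a v = a 0F :* (v 0F :* v 0F) :+ a 1F :* (v 0F :* v 1F) :+ a 2F :* (v 0F :* v 2F)
             :+ a 3F :* (v 1F :* v 1F) :+ a 4F :* (v 1F :* v 2F) :+ a 5F :* (v 2F :* v 2F)

    polarP : ∀ {n} → Vector (Polynomial n) 6 → Vector (Polynomial n) 3 → Vector (Polynomial n) 3 → Polynomial n
    polarP a v w = a 0F :* (v 0F :* w 0F :+ v 0F :* w 0F) :+ a 1F :* (v 0F :* w 1F :+ v 1F :* w 0F)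
                :+ a 2F :* (v 0F :* w 2F :+ v 2F :* w 0F) :+ a 3F :* (v 1F :* w 1F :+ v 1F :* w 1F)
                :+ a 4F :* (v 1F :* w 2F :+ v 2F :* w 1F) :+ a 5F :* (v 2F :* w 2F :+ v 2F :* w 2F)

    pullP : ∀ {n} → PolyMatrix n → Vector (Polynomial n) 6 → Vector (Polynomial n) 6
    pullP A a = quadP a (colP 0F) ∷ polarP a (colP 0F) (colP 1F) ∷ polarP a (colP 0F) (colP 2F)
              ∷ quadP a (colP 1F) ∷ polarP a (colP 1F) (colP 2F) ∷ quadP a (colP 2F) ∷ []
      where colP = λ j i → A i j

    mulP : ∀ {n} → PolyMatrix n → Vector (Polynomial n) 3 → Vector (Polynomial n) 3
    mulP A v i = sumP λ k → A i k :* v k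

    detP : ∀ {n} → PolyMatrix n → Polynomial n
    detP A = A 0F 0F :* (A 1F 1F :* A 2F 2F :- A 1F 2F :* A 2F 1F)
          :- A 0F 1F :* (A 1F 0F :* A 2F 2F :- A 1F 2F :* A 2F 0F)
          :+ A 0F 2F :* (A 1F 0F :* A 2F 1F :- A 1F 1F :* A 2F 0F)

    discriminantP : ∀ {n} → Vector (Polynomial n) 6 → Polynomial n
    -- `4 · x` is an iterated sum ending in `0#`, hence the nested terms and the last zero.
    discriminantP a = (e :+ (e :+ (e :+ (e :+ con (+ 0))))) :+ a 1F :* a 2F :* a 4F
           :- a 0F :* (a 4F :* a 4F) :- a 3F :* (a 2F :* a 2F) :- a 5F :* (a 1F :* a 1F)
      where e = a 0F :* a 3F :* a 5F

    transformP : ∀ {n} → PolyMatrix n → Vector (Polynomial n) 6 → PolyMatrix n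
    transformP A y i j = sumP λ l → (sumP λ k → A i k :* symMatrix k l) :* A j l
      where
      symMatrix : PolyMatrix _
      symMatrix = (y 0F ∷ y 1F ∷ y 2F ∷ []) ∷ (y 1F ∷ y 3F ∷ y 4F ∷ []) ∷ (y 2F ∷ y 4F ∷ y 5F ∷ []) ∷ []

    matP : ∀ {n} (a b c d e f g h i : Polynomial n) → PolyMatrix n
    matP a b c d e f g h i = (a ∷ b ∷ c ∷ []) ∷ (d ∷ e ∷ f ∷ []) ∷ (g ∷ h ∷ i ∷ []) ∷ []

    lineProductP : ∀ {n} → Vector (Polynomial n) 3 → Vector (Polynomial n) 3 → Vector (Polynomial n) 6
    lineProductP l m = l 0F :* m 0F ∷ l 0F :* m 1F :+ l 1F :* m 0F ∷ l 0F :* m 2F :+ l 2F :* m 0F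
                     ∷ l 1F :* m 1F ∷ l 1F :* m 2F :+ l 2F :* m 1F ∷ l 2F :* m 2F ∷ []

  quad-cong : ∀ {a b v w} → a ≋ b → v ≋ w → quad a v ≈ quad b w
  quad-cong a≋b v≋w = +-cong (+-cong (+-cong (+-cong (+-cong (term 0F 0F 0F) (term 1F 0F 1F)) (term 2F 0F 2F))
    (term 3F 1F 1F)) (term 4F 1F 2F)) (term 5F 2F 2F)
    where term = λ i j k → *-cong (a≋b i) (*-cong (v≋w j) (v≋w k))

  polar-cong : ∀ {a b v w v′ w′} → a ≋ b → v ≋ w → v′ ≋ w′ → polar a v v′ ≈ polar b w w′
  polar-cong a≋b v≋w v′≋w′ = +-cong (+-cong (+-cong (+-cong (+-cong (term 0F 0F 0F) (term 1F 0F 1F)) (term 2F 0F 2F))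
    (term 3F 1F 1F)) (term 4F 1F 2F)) (term 5F 2F 2F)
    where term = λ i j k → *-cong (a≋b i) (+-cong (*-cong (v≋w j) (v′≋w′ k)) (*-cong (v≋w k) (v′≋w′ j)))

  quad-scale : ∀ k a v → quad (map (k *_) a) v ≈ k * quad a v
  quad-scale k a v = solve 10 (λ k a₀ a₁ a₂ a₃ a₄ a₅ x y z →
      quadP (k :* a₀ ∷ k :* a₁ ∷ k :* a₂ ∷ k :* a₃ ∷ k :* a₄ ∷ k :* a₅ ∷ []) (x ∷ y ∷ z ∷ [])
      := k :* quadP (a₀ ∷ a₁ ∷ a₂ ∷ a₃ ∷ a₄ ∷ a₅ ∷ []) (x ∷ y ∷ z ∷ [])) refl
    k (a 0F) (a 1F) (a 2F) (a 3F) (a 4F) (a 5F) (v 0F) (v 1F) (v 2F)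

  polar-scale : ∀ k a v w → polar (map (k *_) a) v w ≈ k * polar a v w
  polar-scale k a v w = solve 13 (λ k a₀ a₁ a₂ a₃ a₄ a₅ x y z x′ y′ z′ →
      polarP (k :* a₀ ∷ k :* a₁ ∷ k :* a₂ ∷ k :* a₃ ∷ k :* a₄ ∷ k :* a₅ ∷ []) (x ∷ y ∷ z ∷ []) (x′ ∷ y′ ∷ z′ ∷ [])
      := k :* polarP (a₀ ∷ a₁ ∷ a₂ ∷ a₃ ∷ a₄ ∷ a₅ ∷ []) (x ∷ y ∷ z ∷ []) (x′ ∷ y′ ∷ z′ ∷ [])) refl
    k (a 0F) (a 1F) (a 2F) (a 3F) (a 4F) (a 5F) (v 0F) (v 1F) (v 2F) (w 0F) (w 1F) (w 2F)

  quad-pull : ∀ A a v → quad (pull A a) v ≈ quad a (A *ᵥ v)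
  quad-pull A a v = solve 18 (λ p q r s t u w x y a₀ a₁ a₂ a₃ a₄ a₅ v₀ v₁ v₂ →
      let A = matP p q r s t u w x y; a = a₀ ∷ a₁ ∷ a₂ ∷ a₃ ∷ a₄ ∷ a₅ ∷ []; v = v₀ ∷ v₁ ∷ v₂ ∷ [] in
      quadP (pullP A a) v := quadP a (mulP A v)) refl
    (A 0F 0F) (A 0F 1F) (A 0F 2F) (A 1F 0F) (A 1F 1F) (A 1F 2F) (A 2F 0F) (A 2F 1F) (A 2F 2F)
    (a 0F) (a 1F) (a 2F) (a 3F) (a 4F) (a 5F) (v 0F) (v 1F) (v 2F)

  polar-pull : ∀ A a v w → polar (pull A a) v w ≈ polar a (A *ᵥ v) (A *ᵥ w)
  polar-pull A a v w = solve 21 (λ p q r s t u o x y a₀ a₁ a₂ a₃ a₄ a₅ v₀ v₁ v₂ w₀ w₁ w₂ →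
      let A = matP p q r s t u o x y; a = a₀ ∷ a₁ ∷ a₂ ∷ a₃ ∷ a₄ ∷ a₅ ∷ []
          v = v₀ ∷ v₁ ∷ v₂ ∷ []; w = w₀ ∷ w₁ ∷ w₂ ∷ [] in
      polarP (pullP A a) v w := polarP a (mulP A v) (mulP A w)) refl
    (A 0F 0F) (A 0F 1F) (A 0F 2F) (A 1F 0F) (A 1F 1F) (A 1F 2F) (A 2F 0F) (A 2F 1F) (A 2F 2F)
    (a 0F) (a 1F) (a 2F) (a 3F) (a 4F) (a 5F) (v 0F) (v 1F) (v 2F) (w 0F) (w 1F) (w 2F)

  -- As a function, `l ·ₗ m` is the product of two linear forms, and `(l ᵥ* A) i` is the value of
  -- `l` on column `i`.
  quad-·ₗ : ∀ l m A i → quad (l ·ₗ m) (col A i) ≈ (l ᵥ* A) i * (m ᵥ* A) i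
  quad-·ₗ l m A i = solve 9 (λ l₀ l₁ l₂ m₀ m₁ m₂ v₀ v₁ v₂ →
      let l = l₀ ∷ l₁ ∷ l₂ ∷ []; m = m₀ ∷ m₁ ∷ m₂ ∷ []; v = v₀ ∷ v₁ ∷ v₂ ∷ [] in
      quadP (lineProductP l m) v := sumP (zipWith _:*_ l v) :* sumP (zipWith _:*_ m v)) refl
    (l 0F) (l 1F) (l 2F) (m 0F) (m 1F) (m 2F) (A 0F i) (A 1F i) (A 2F i)

  polar-·ₗ : ∀ l m A i j → polar (l ·ₗ m) (col A i) (col A j) ≈ (l ᵥ* A) i * (m ᵥ* A) j + (l ᵥ* A) j * (m ᵥ* A) i
  polar-·ₗ l m A i j = solve 12 (λ l₀ l₁ l₂ m₀ m₁ m₂ v₀ v₁ v₂ w₀ w₁ w₂ →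
      let l = l₀ ∷ l₁ ∷ l₂ ∷ []; m = m₀ ∷ m₁ ∷ m₂ ∷ []; v = v₀ ∷ v₁ ∷ v₂ ∷ []; w = w₀ ∷ w₁ ∷ w₂ ∷ [] in
      polarP (lineProductP l m) v w := sumP (zipWith _:*_ l v) :* sumP (zipWith _:*_ m w)
                                    :+ sumP (zipWith _:*_ l w) :* sumP (zipWith _:*_ m v)) refl
    (l 0F) (l 1F) (l 2F) (m 0F) (m 1F) (m 2F) (A 0F i) (A 1F i) (A 2F i) (A 0F j) (A 1F j) (A 2F j)

  ≋6 : {u v : Vector Carrier 6} → u 0F ≈ v 0F → u 1F ≈ v 1F → u 2F ≈ v 2F →
       u 3F ≈ v 3F → u 4F ≈ v 4F → u 5F ≈ v 5F → u ≋ v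
  ≋6 e₀ e₁ e₂ e₃ e₄ e₅ 0F = e₀
  ≋6 e₀ e₁ e₂ e₃ e₄ e₅ 1F = e₁
  ≋6 e₀ e₁ e₂ e₃ e₄ e₅ 2F = e₂
  ≋6 e₀ e₁ e₂ e₃ e₄ e₅ 3F = e₃
  ≋6 e₀ e₁ e₂ e₃ e₄ e₅ 4F = e₄
  ≋6 e₀ e₁ e₂ e₃ e₄ e₅ 5F = e₅

  ≋3 : {u v : Vector Carrier 3} → u 0F ≈ v 0F → u 1F ≈ v 1F → u 2F ≈ v 2F → u ≋ v
  ≋3 e₀ e₁ e₂ 0F = e₀
  ≋3 e₀ e₁ e₂ 1F = e₁
  ≋3 e₀ e₁ e₂ 2F = e₂

  pull-cong : ∀ {A B a b} → A ≈ₘ B → a ≋ b → pull A a ≋ pull B b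
  pull-cong {A} {B} A≈B a≋b = ≋6 (q 0F) (p 0F 1F) (p 0F 2F) (q 1F) (p 1F 2F) (q 2F)
    where
    q = λ i → quad-cong {v = col A i} {col B i} a≋b (λ k → A≈B k i)
    p = λ i j → polar-cong {v = col A i} {col B i} {col A j} {col B j} a≋b (λ k → A≈B k i) (λ k → A≈B k j)

  pull-scale : ∀ A k a → pull A (map (k *_) a) ≋ map (k *_) (pull A a)
  pull-scale A k a = ≋6 (q 0F) (p 0F 1F) (p 0F 2F) (q 1F) (p 1F 2F) (q 2F)
    where
    q = λ i → quad-scale k a (col A i)
    p = λ i j → polar-scale k a (col A i) (col A j)

  -- Coefficients of a pulled-back form are values on columns, and the columns of `A *ₘ B` are the
  -- images under `A` of those of `B`.
  pull-∘ : ∀ A B a → pull B (pull A a) ≋ pull (A *ₘ B) a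
  pull-∘ A B a = ≋6 (q 0F) (p 0F 1F) (p 0F 2F) (q 1F) (p 1F 2F) (q 2F)
    where
    q = λ i → quad-pull A a (col B i)
    p = λ i j → polar-pull A a (col B i) (col B j)

  pull-·ₗ : ∀ A l m → pull A (l ·ₗ m) ≋ ((l ᵥ* A) ·ₗ (m ᵥ* A))
  pull-·ₗ A l m = ≋6 (q 0F) (p 0F 1F) (p 0F 2F) (q 1F) (p 1F 2F) (q 2F)
    where
    q = quad-·ₗ l m A
    p = polar-·ₗ l m A

  pull-1 : ∀ a → pull 1ₘ a ≋ a
  pull-1 a = ≋6 (prove ρ (p 0F) (var 0F) refl) (prove ρ (p 1F) (var 1F) refl) (prove ρ (p 2F) (var 2F) refl)
                (prove ρ (p 3F) (var 3F) refl) (prove ρ (p 4F) (var 4F) refl) (prove ρ (p 5F) (var 5F) refl)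
    where
    ρ = Vec.tabulate a
    I O : Polynomial 6
    I = con (+ 1)
    O = con (+ 0)
    p = pullP (matP I O O O I O O O I) var

  -- Twice the discriminant is the determinant of the Gram matrix G of `polar a`, and substitution
  -- turns G into Aᵀ G A. The identity itself is checked as one between integer polynomials.
  discriminant-pull : ∀ A a → discriminant (pull A a) ≈ (det A * det A) * discriminant a
  discriminant-pull A a = solve 15 (λ p q r s t u w x y a₀ a₁ a₂ a₃ a₄ a₅ →
      let A = matP p q r s t u w x y; a = a₀ ∷ a₁ ∷ a₂ ∷ a₃ ∷ a₄ ∷ a₅ ∷ [] in
      discriminantP (pullP A a) := (detP A :* detP A) :* discriminantP a) refl
    (A 0F 0F) (A 0F 1F) (A 0F 2F) (A 1F 0F) (A 1F 1F) (A 1F 2F) (A 2F 0F) (A 2F 1F) (A 2F 2F)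
    (a 0F) (a 1F) (a 2F) (a 3F) (a 4F) (a 5F)

  discriminant-cong : ∀ {a b} → a ≋ b → discriminant a ≈ discriminant b
  discriminant-cong a≋b = +-cong (+-cong (+-cong (+-cong
    (×-congʳ 4 (term 0F 3F 5F)) (term 1F 2F 4F))
    (-‿cong (*-cong (a≋b 0F) (*-cong (a≋b 4F) (a≋b 4F)))))
    (-‿cong (*-cong (a≋b 3F) (*-cong (a≋b 2F) (a≋b 2F)))))
    (-‿cong (*-cong (a≋b 5F) (*-cong (a≋b 1F) (a≋b 1F))))
    where term = λ i j k → *-cong (*-cong (a≋b i) (a≋b j)) (a≋b k)

  discriminant-scale : ∀ k a → discriminant (map (k *_) a) ≈ (k * k * k) * discriminant a
  discriminant-scale k a = solve 7 (λ k a₀ a₁ a₂ a₃ a₄ a₅ →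
      discriminantP (k :* a₀ ∷ k :* a₁ ∷ k :* a₂ ∷ k :* a₃ ∷ k :* a₄ ∷ k :* a₅ ∷ [])
      := (k :* k :* k) :* discriminantP (a₀ ∷ a₁ ∷ a₂ ∷ a₃ ∷ a₄ ∷ a₅ ∷ [])) refl
    k (a 0F) (a 1F) (a 2F) (a 3F) (a 4F) (a 5F)

  -- Substitution is adjoint to the collineation: `a` pairs with M = v vᵀ to `quad a v`, and A M Aᵀ
  -- = (A v)(A v)ᵀ.
  ⟨⟩-transform : ∀ A a k y → ⟨ a , map (k *_) (upperTriangle (transform A y)) ⟩ ≈ k * ⟨ pull A a , y ⟩
  ⟨⟩-transform A a k y = solve 22 (λ p q r s t u w x z a₀ a₁ a₂ a₃ a₄ a₅ k y₀ y₁ y₂ y₃ y₄ y₅ →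
      let A = matP p q r s t u w x z; a = a₀ ∷ a₁ ∷ a₂ ∷ a₃ ∷ a₄ ∷ a₅ ∷ []; y = y₀ ∷ y₁ ∷ y₂ ∷ y₃ ∷ y₄ ∷ y₅ ∷ []
          b = pullP A a; M = transformP A y; O = con (+ 0) in
      a₀ :* (k :* M 0F 0F) :+ (a₁ :* (k :* M 0F 1F) :+ (a₂ :* (k :* M 0F 2F) :+
        (a₃ :* (k :* M 1F 1F) :+ (a₄ :* (k :* M 1F 2F) :+ (a₅ :* (k :* M 2F 2F) :+ O)))))
      := k :* (b 0F :* y₀ :+ (b 1F :* y₁ :+ (b 2F :* y₂ :+ (b 3F :* y₃ :+ (b 4F :* y₄ :+ (b 5F :* y₅ :+ O))))))) refl
    (A 0F 0F) (A 0F 1F) (A 0F 2F) (A 1F 0F) (A 1F 1F) (A 1F 2F) (A 2F 0F) (A 2F 1F) (A 2F 2F)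
    (a 0F) (a 1F) (a 2F) (a 3F) (a 4F) (a 5F) k (y 0F) (y 1F) (y 2F) (y 3F) (y 4F) (y 5F)

  transform-symmetric : ∀ A y i j → transform A y i j ≈ transform A y j i
  transform-symmetric A y i j = solve 12 (λ p q r s t u y₀ y₁ y₂ y₃ y₄ y₅ →
      -- Only rows `i` and `j` matter; they are placed first and second, so one identity covers
      -- every pair of indices. The third row is filler.
      let A = (p ∷ q ∷ r ∷ []) ∷ (s ∷ t ∷ u ∷ []) ∷ (s ∷ t ∷ u ∷ []) ∷ []; y = y₀ ∷ y₁ ∷ y₂ ∷ y₃ ∷ y₄ ∷ y₅ ∷ []
          M = transformP A y in M 0F 1F := M 1F 0F) refl
    (A i 0F) (A i 1F) (A i 2F) (A j 0F) (A j 1F) (A j 2F) (y 0F) (y 1F) (y 2F) (y 3F) (y 4F) (y 5F)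

  ᵥ*-cong : ∀ {l m A B} → l ≋ m → A ≈ₘ B → (l ᵥ* A) ≋ (m ᵥ* B)
  ᵥ*-cong l≋m A≈B j = +-cong (term 0F) (+-cong (term 1F) (+-congʳ (term 2F)))
    where term = λ k → *-cong (l≋m k) (A≈B k j)

  ᵥ*-scale : ∀ k l A → (map (k *_) l ᵥ* A) ≋ map (k *_) (l ᵥ* A)
  ᵥ*-scale k l A j = solve 7 (λ k l₀ l₁ l₂ v₀ v₁ v₂ →
      sumP (k :* l₀ :* v₀ ∷ k :* l₁ :* v₁ ∷ k :* l₂ :* v₂ ∷ []) := k :* sumP (l₀ :* v₀ ∷ l₁ :* v₁ ∷ l₂ :* v₂ ∷ [])) refl
    k (l 0F) (l 1F) (l 2F) (A 0F j) (A 1F j) (A 2F j)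

  ᵥ*-∘ : ∀ l A B → (l ᵥ* A ᵥ* B) ≋ (l ᵥ* (A *ₘ B))
  ᵥ*-∘ l A B j = solve 15 (λ p q r s t u w x y l₀ l₁ l₂ v₀ v₁ v₂ →
      let A = matP p q r s t u w x y; l = l₀ ∷ l₁ ∷ l₂ ∷ []; v = v₀ ∷ v₁ ∷ v₂ ∷ [] in
      sumP (λ i → sumP (λ k → l k :* A k i) :* v i) := sumP (λ i → l i :* mulP A v i)) refl
    (A 0F 0F) (A 0F 1F) (A 0F 2F) (A 1F 0F) (A 1F 1F) (A 1F 2F) (A 2F 0F) (A 2F 1F) (A 2F 2F)
    (l 0F) (l 1F) (l 2F) (B 0F j) (B 1F j) (B 2F j)

  ᵥ*-1 : ∀ l → (l ᵥ* 1ₘ) ≋ l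
  ᵥ*-1 l = ≋3
    (solve 3 (λ x y z → sumP (x :* I ∷ y :* O ∷ z :* O ∷ []) := x) refl _ _ _)
    (solve 3 (λ x y z → sumP (x :* O ∷ y :* I ∷ z :* O ∷ []) := y) refl _ _ _)
    (solve 3 (λ x y z → sumP (x :* O ∷ y :* O ∷ z :* I ∷ []) := z) refl _ _ _)
    where
    I O : ∀ {n} → Polynomial n
    I = con (+ 1)
    O = con (+ 0)

  pull-inverse : ∀ {A B} → A *ₘ B ≈ₘ 1ₘ → ∀ a → pull B (pull A a) ≋ a
  pull-inverse {A} {B} AB≈1 a i = trans (pull-∘ A B a i) (trans (pull-cong {a = a} AB≈1 (λ _ → refl) i) (pull-1 a i))

  ᵥ*-inverse : ∀ {A B} → A *ₘ B ≈ₘ 1ₘ → ∀ l → (l ᵥ* A ᵥ* B) ≋ l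
  ᵥ*-inverse {A} {B} AB≈1 l i =
    trans (ᵥ*-∘ l A B i) (trans (ᵥ*-cong {l = l} (λ _ → refl) AB≈1 i) (ᵥ*-1 l i))

  pull-≋0 : ∀ A {a} → a ≋ replicate 6 0# → pull A a ≋ replicate 6 0#
  pull-≋0 A {a} a≋0 i = trans (pull-cong {A} {A} {a} {map (0# *_) a} (λ _ _ → refl) (λ j → trans (a≋0 j) (sym (zeroˡ (a j)))) i)
    (trans (pull-scale A 0# a i) (zeroˡ (pull A a i)))

  ᵥ*-≋0 : ∀ A {l} → l ≋ replicate 3 0# → (l ᵥ* A) ≋ replicate 3 0#
  ᵥ*-≋0 A {l} l≋0 j = trans (ᵥ*-cong {l} {map (0# *_) l} {A} {A} (λ k → trans (l≋0 k) (sym (zeroˡ (l k)))) (λ _ _ → refl) j)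
    (trans (ᵥ*-scale 0# l A j) (zeroˡ ((l ᵥ* A) j)))

  pull-reflects-≋0 : ∀ {A B} → A *ₘ B ≈ₘ 1ₘ → ∀ {a} → pull A a ≋ replicate 6 0# → a ≋ replicate 6 0#
  pull-reflects-≋0 {A} {B} AB≈1 {a} pull≋0 i = trans (sym (pull-inverse {A} {B} AB≈1 a i)) (pull-≋0 B {pull A a} pull≋0 i)

  ᵥ*-reflects-≋0 : ∀ {A B} → A *ₘ B ≈ₘ 1ₘ → ∀ {l} → (l ᵥ* A) ≋ replicate 3 0# → l ≋ replicate 3 0#
  ᵥ*-reflects-≋0 {A} {B} AB≈1 {l} lA≋0 i = trans (sym (ᵥ*-inverse {A} {B} AB≈1 l i)) (ᵥ*-≋0 B {l ᵥ* A} lA≋0 i)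

  ·ₗ-congˡ : ∀ l {m m′} → m ≋ m′ → (l ·ₗ m) ≋ (l ·ₗ m′)
  ·ₗ-congˡ l {m} {m′} m≋ = ≋6 (s 0F) (t 0F 1F) (t 0F 2F) (s 1F) (t 1F 2F) (s 2F)
    where
    s = λ i → *-congˡ {l i} (m≋ i)
    t = λ i j → +-cong (*-congˡ {l i} (m≋ j)) (*-congˡ {l j} (m≋ i))

  ⟨⟩-cong : ∀ a {y z} → y ≋ z → ⟨ a , y ⟩ ≈ ⟨ a , z ⟩
  ⟨⟩-cong a {y} {z} y≋z = +-cong (s 0F) (+-cong (s 1F) (+-cong (s 2F) (+-cong (s 3F) (+-cong (s 4F) (+-congʳ (s 5F))))))
    where s = λ i → *-congˡ {a i} (y≋z i)

  ⟨⟩-congʳ : ∀ {a b} y → a ≋ b → ⟨ a , y ⟩ ≈ ⟨ b , y ⟩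
  ⟨⟩-congʳ {a} {b} y a≋b = +-cong (s 0F) (+-cong (s 1F) (+-cong (s 2F) (+-cong (s 3F) (+-cong (s 4F) (+-congʳ (s 5F))))))
    where s = λ i → *-congʳ {y i} (a≋b i)

  ⟨⟩-scale : ∀ a k y → ⟨ a , map (k *_) y ⟩ ≈ k * ⟨ a , y ⟩
  ⟨⟩-scale a k y = solve 13 (λ k a₀ a₁ a₂ a₃ a₄ a₅ y₀ y₁ y₂ y₃ y₄ y₅ → let O = con (+ 0) in
      a₀ :* (k :* y₀) :+ (a₁ :* (k :* y₁) :+ (a₂ :* (k :* y₂) :+ (a₃ :* (k :* y₃) :+ (a₄ :* (k :* y₄) :+ (a₅ :* (k :* y₅) :+ O)))))
      := k :* (a₀ :* y₀ :+ (a₁ :* y₁ :+ (a₂ :* y₂ :+ (a₃ :* y₃ :+ (a₄ :* y₄ :+ (a₅ :* y₅ :+ O))))))) refl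
    k (a 0F) (a 1F) (a 2F) (a 3F) (a 4F) (a 5F) (y 0F) (y 1F) (y 2F) (y 3F) (y 4F) (y 5F)

  ⟨⟩-nondegenerate : ∀ {y} → (∀ a → ⟨ a , y ⟩ ≈ 0#) → y ≋ replicate 6 0#
  ⟨⟩-nondegenerate {y} ⟨-,y⟩≈0 = ≋6
    (trans (sym (prove ρ (p 0F) (var 0F) refl)) (⟨-,y⟩≈0 (unit 0F)))
    (trans (sym (prove ρ (p 1F) (var 1F) refl)) (⟨-,y⟩≈0 (unit 1F)))
    (trans (sym (prove ρ (p 2F) (var 2F) refl)) (⟨-,y⟩≈0 (unit 2F)))
    (trans (sym (prove ρ (p 3F) (var 3F) refl)) (⟨-,y⟩≈0 (unit 3F)))
    (trans (sym (prove ρ (p 4F) (var 4F) refl)) (⟨-,y⟩≈0 (unit 4F)))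
    (trans (sym (prove ρ (p 5F) (var 5F) refl)) (⟨-,y⟩≈0 (unit 5F)))
    where
    ρ = Vec.tabulate y
    unit : Fin 6 → Vector Carrier 6
    unit i j = if does (i Fin.≟ j) then 1# else 0#
    unitP : Fin 6 → Vector (Polynomial 6) 6
    unitP i j = if does (i Fin.≟ j) then con (+ 1) else con (+ 0)
    p : Fin 6 → Polynomial 6
    p i = u 0F :* var 0F :+ (u 1F :* var 1F :+ (u 2F :* var 2F :+ (u 3F :* var 3F :+ (u 4F :* var 4F :+ (u 5F :* var 5F :+ con (+ 0))))))
      where u = unitP i

-- Equations as linear combinations of hypotheses

module LinearCombination {c ℓ} (R : CommutativeRing c ℓ) where
  open CommutativeRing R
  open import Algebra.Properties.Ring ring using (x∙y⁻¹≈ε⇒x≈y)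

  x-y≈0⇒x≈y : ∀ {x y} → x - y ≈ 0# → x ≈ y
  x-y≈0⇒x≈y = x∙y⁻¹≈ε⇒x≈y _ _

  x≈y⇒x-y≈0 : ∀ {x y} → x ≈ y → x - y ≈ 0#
  x≈y⇒x-y≈0 {y = y} x≈y = trans (+-congʳ x≈y) (-‿inverseʳ y)

  private
    vanish : ∀ {p q} k → p ≈ q → k * (p - q) ≈ 0#
    vanish k p≈q = trans (*-congˡ (x≈y⇒x-y≈0 p≈q)) (zeroʳ k)

  -- lcₙ proves l ≈ r by exhibiting l − r as a linear combination of n
  -- hypotheses p ≈ q.
  lc₁ : ∀ {l r p q} k → p ≈ q → l - r ≈ k * (p - q) → l ≈ r
  lc₁ k p≈q eq = x-y≈0⇒x≈y (trans eq (vanish k p≈q))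

  lc₂ : ∀ {l r p q p′ q′} k k′ → p ≈ q → p′ ≈ q′ → l - r ≈ k * (p - q) + k′ * (p′ - q′) → l ≈ r
  lc₂ k k′ p≈q p′≈q′ eq =
    x-y≈0⇒x≈y (trans eq (trans (+-cong (vanish k p≈q) (vanish k′ p′≈q′)) (+-identityʳ 0#)))

  lc₃ : ∀ {l r p q p′ q′ p″ q″} k k′ k″ → p ≈ q → p′ ≈ q′ → p″ ≈ q″ →
    l - r ≈ k * (p - q) + k′ * (p′ - q′) + k″ * (p″ - q″) → l ≈ r
  lc₃ k k′ k″ p≈q p′≈q′ p″≈q″ eq =
    x-y≈0⇒x≈y (trans eq (trans (+-cong (trans (+-cong (vanish k p≈q) (vanish k′ p′≈q′)) (+-identityʳ 0#)) (vanish k″ p″≈q″)) (+-identityʳ 0#)))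

-- Arithmetic in finite fields

module FieldProperties {c ℓ q} (F : FiniteField c ℓ q) where
  open FiniteField F
  open IntegerSolver commutativeRing
  open LinearCombination commutativeRing

  infix 4 _≟_
  _≟_ : ∀ x y → Dec (x ≈ y)
  _≟_ = card⇒≟ cardinality

  -- Made total by the default 0 at 0, so that formulas with inverses need not carry proofs that the
  -- denominators are nonzero.
  inv : Carrier → Carrier
  inv x with x ≟ 0#
  ... | yes _   = 0#
  ... | no  x≉0 = proj₁ (invertible x x≉0)

  *-inv : ∀ {x} → ¬ (x ≈ 0#) → x * inv x ≈ 1#
  *-inv {x} x≉0 with x ≟ 0#
  ... | yes x≈0 = contradiction x≈0 x≉0
  ... | no  x≉0 = proj₂ (invertible x x≉0)

  *-cancelˡ : ∀ {x y z} → ¬ (x ≈ 0#) → x * y ≈ x * z → y ≈ z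
  *-cancelˡ {x} {y} {z} x≉0 xy≈xz = lc₂ (z - y) (inv x) (*-inv x≉0) xy≈xz
    (solve 4 (λ x y z i → y :- z := (z :- y) :* (x :* i :- con (+ 1)) :+ i :* (x :* y :- x :* z)) refl x y z (inv x))

  x*y≈0⇒y≈0 : ∀ {x y} → ¬ (x ≈ 0#) → x * y ≈ 0# → y ≈ 0#
  x*y≈0⇒y≈0 x≉0 xy≈0 = *-cancelˡ x≉0 (trans xy≈0 (sym (zeroʳ _)))

  x*y≈0⇒x≈0 : ∀ {x y} → ¬ (y ≈ 0#) → x * y ≈ 0# → x ≈ 0#
  x*y≈0⇒x≈0 y≉0 xy≈0 = x*y≈0⇒y≈0 y≉0 (trans (*-comm _ _) xy≈0)

  *-≉0 : ∀ {x y} → ¬ (x ≈ 0#) → ¬ (y ≈ 0#) → ¬ (x * y ≈ 0#)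
  *-≉0 x≉0 y≉0 xy≈0 = y≉0 (x*y≈0⇒y≈0 x≉0 xy≈0)

  inv-≉0 : ∀ {x} → ¬ (x ≈ 0#) → ¬ (inv x ≈ 0#)
  inv-≉0 {x} x≉0 ix≈0 = 0≉1 (trans (sym (zeroʳ x)) (trans (*-congˡ (sym ix≈0)) (*-inv x≉0)))

  inv-unique : ∀ {x y} → x * y ≈ 1# → y ≈ inv x
  inv-unique {x} {y} xy≈1 = *-cancelˡ x≉0 (trans xy≈1 (sym (*-inv x≉0)))
    where
    x≉0 : ¬ (x ≈ 0#)
    x≉0 x≈0 = 0≉1 (trans (sym (zeroˡ y)) (trans (*-congʳ (sym x≈0)) xy≈1))

  inv-cong : ∀ {x y} → x ≈ y → inv x ≈ inv y
  inv-cong {x} {y} x≈y with y ≟ 0#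
  ... | no  y≉0 = trans (inv-unique (trans (*-congʳ (sym x≈y)) (*-inv (y≉0 ∘ trans (sym x≈y)))))
                        (sym (inv-unique (proj₂ (invertible y y≉0))))
  ... | yes y≈0 with x ≟ 0#
  ...   | yes _   = refl
  ...   | no  x≉0 = contradiction (trans x≈y y≈0) x≉0

  x*x≈y*y⇒x≈±y : ∀ {x y} → x * x ≈ y * y → x ≈ y ⊎ x ≈ - y
  x*x≈y*y⇒x≈±y {x} {y} xx≈yy with x ≟ y
  ... | yes x≈y = inj₁ x≈y
  ... | no  x≉y = inj₂ (lc₁ 1# (x*y≈0⇒y≈0 (x≉y ∘ x-y≈0⇒x≈y)
    (lc₁ 1# xx≈yy (solve 2 (λ x y → (x :- y) :* (x :+ y) :- con (+ 0) := con (+ 1) :* (x :* x :- y :* y)) refl x y)))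
    (solve 2 (λ x y → x :- :- y := con (+ 1) :* (x :+ y :- con (+ 0))) refl x y))

  x*x≈0⇒x≈0 : ∀ {x} → x * x ≈ 0# → x ≈ 0#
  x*x≈0⇒x≈0 {x} xx≈0 with x ≟ 0#
  ... | yes x≈0 = x≈0
  ... | no  x≉0 = x*y≈0⇒y≈0 x≉0 xx≈0

  -- Otherwise x/y is a square root of `Δ`.
  x*x≈Δ*y*y⇒y≈0 : ∀ {Δ x y} → ¬ (∃ λ z → z * z ≈ Δ) → x * x ≈ Δ * (y * y) → y ≈ 0#
  x*x≈Δ*y*y⇒y≈0 {Δ} {x} {y} Δ-nonsquare eq with y ≟ 0#
  ... | yes y≈0 = y≈0
  ... | no  y≉0 = contradiction
    (x * inv y , lc₂ (inv y * inv y) (Δ * (y * inv y + 1#)) eq (*-inv y≉0)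
      (solve 4 (λ Δ x y i → x :* i :* (x :* i) :- Δ := i :* i :* (x :* x :- Δ :* (y :* y))
        :+ Δ :* (y :* i :+ con (+ 1)) :* (y :* i :- con (+ 1))) refl Δ x y (inv y)))
    Δ-nonsquare

  Units : Setoid (c ⊔ ℓ) ℓ
  Units = Sub setoid (λ x → ¬ (x ≈ 0#))

  abstract
    card-Units : ∃ λ n → suc n ≡ q × HasCardinality Units n
    card-Units with card-split cardinality (λ x≈y x≈0 → trans (sym x≈y) x≈0) (_≟ 0#)
    ... | i , n , i+n≡q , I , N = n , ≡.subst (λ i → i ℕ.+ n ≡ q) (card-unique I zeros) i+n≡q , N
      where
      zeros : HasCardinality (Sub setoid (_≈ 0#)) 1
      zeros = card-bijection (card-Fin 1) (λ _ → 0# , refl) (λ _ → refl)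
        (λ { {0F} {0F} _ → ≡.refl }) (λ { (x , x≈0) → 0F , sym x≈0 })

  -- If 2 = 0, then x ↦ x + 1 is an involution without fixed points, and q is even.
  1+1≉0 : ¬ (2 ∣ q) → ¬ (1# + 1# ≈ 0#)
  1+1≉0 2∤q 1+1≈0 with card-involution cardinality (_+ 1#) +-congʳ
      (λ x → trans (+-assoc x 1# 1#) (trans (+-congˡ 1+1≈0) (+-identityʳ x)))
      (λ x x+1≈x → 0≉1 (sym (lc₁ 1# x+1≈x
        (solve 1 (λ x → con (+ 1) :- con (+ 0) := con (+ 1) :* (x :+ con (+ 1) :- x)) refl x))))
  ... | k , q≡k+k , _ = 2∤q (divides k (≡.trans q≡k+k k+k≡k*2))
    where
    k+k≡k*2 : k ℕ.+ k ≡ k ℕ.* 2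
    k+k≡k*2 = ≡.trans (≡.cong (k ℕ.+_) (≡.sym (ℕ.+-identityʳ k))) (ℕ.*-comm 2 k)

  -- x ↦ x² or Δ x², according to whether x or − x comes first in the
  -- enumeration, is injective, hence surjective: every element is a square or
  -- Δ times a square.
  nonSquare*nonSquare : ¬ (1# + 1# ≈ 0#) → ∀ Δ ν → ¬ (∃ λ x → x * x ≈ Δ) → ¬ (∃ λ x → x * x ≈ ν) →
    ∃ λ x → Δ * (x * x) ≈ ν
  nonSquare*nonSquare 2≉0 Δ ν Δ-nonsquare ν-nonsquare with injective⇒surjective cardinality cardinality f f-inj ν
    where
    open Inverse cardinality using (to; to-cong)
    f : Carrier → Carrier
    f x with to x Fin.<? to (- x)
    ... | yes _ = x * x
    ... | no  _ = Δ * (x * x)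

    Δ≉0 : ¬ (Δ ≈ 0#)
    Δ≉0 Δ≈0 = Δ-nonsquare (0# , trans (zeroˡ 0#) (sym Δ≈0))

    -- A collision between the two branches forces x = y = 0, but 0 = - 0 cannot come strictly
    -- before itself.
    mixed : ∀ {x y} → to x Fin.< to (- x) → ¬ (x * x ≈ Δ * (y * y))
    mixed {x} {y} x<-x eq = ℕ.<⇒≢ x<-x (≡.cong toℕ (to-cong (trans x≈0 (sym -x≈0))))
      where
      y≈0 : y ≈ 0#
      y≈0 = x*x≈Δ*y*y⇒y≈0 Δ-nonsquare eq
      x≈0 : x ≈ 0#
      x≈0 = x*x≈0⇒x≈0 (trans eq (trans (*-congˡ (trans (*-congʳ y≈0) (zeroˡ y))) (zeroʳ Δ)))
      -x≈0 : - x ≈ 0#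
      -x≈0 = lc₁ (- 1#) x≈0 (solve 1 (λ x → :- x :- con (+ 0) := :- con (+ 1) :* (x :- con (+ 0))) refl x)

    -cancel : ∀ {x y} → x ≈ - y → - x ≈ y
    -cancel {x} {y} x≈-y = lc₁ (- 1#) x≈-y (solve 2 (λ x y → :- x :- y := :- con (+ 1) :* (x :- :- y)) refl x y)

    f-inj : ∀ {x y} → f x ≈ f y → x ≈ y
    f-inj {x} {y} eq with to x Fin.<? to (- x) | to y Fin.<? to (- y)
    ... | yes x<-x | no  _    = contradiction eq (mixed x<-x)
    ... | no  _    | yes y<-y = contradiction (sym eq) (mixed y<-y)
    ... | yes x<-x | yes y<-y with x*x≈y*y⇒x≈±y eq
    ...   | inj₁ x≈y  = x≈y
    ...   | inj₂ x≈-y = contradiction y<-y (ℕ.<-asym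
              (≡.subst₂ Fin._<_ (to-cong x≈-y) (to-cong (-cancel x≈-y)) x<-x))
    f-inj {x} {y} eq | no x≮-x | no y≮-y with x*x≈y*y⇒x≈±y (*-cancelˡ Δ≉0 eq)
    ...   | inj₁ x≈y  = x≈y
    -- Here y = - x and neither of them comes before the other, so their indices agree.
    ...   | inj₂ x≈-y = trans x≈-y (to-injective cardinality (Fin.toℕ-injective (ℕ.≤-antisym
              (ℕ.≮⇒≥ y≮-y) (≡.subst₂ Fin._≤_ (to-cong (-cancel x≈-y)) (to-cong x≈-y) (ℕ.≮⇒≥ x≮-x)))))
  ... | x , fx≈ν with Inverse.to cardinality x Fin.<? Inverse.to cardinality (- x)
  ...   | yes _ = contradiction (x , fx≈ν) ν-nonsquare
  ...   | no  _ = x , fx≈ν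

-- Conics through the standard line

module StandardForms {c ℓ q} (F : FiniteField c ℓ q) (δ : FiniteField.Carrier F) where

  open FiniteField F
  open Geometry F
  open QuadraticForms commutativeRing using (≋6; ≋3)
  open IntegerSolver commutativeRing
  open LinearCombination commutativeRing
  open FieldProperties F

  -- The conics a X₀² + b X₀X₂ + c (δ X₁² + X₂²) + d X₁X₂ are those whose
  -- hyperplane contains the standard line.
  form : (a b c d : Carrier) → Vector Carrier 6
  form a b c d = a ∷ 0# ∷ b ∷ δ * c ∷ d ∷ c ∷ []

  IsStandard : Vector Carrier 6 → Set ℓ
  IsStandard v = v 1F ≈ 0# × v 3F ≈ δ * v 5F

  form-standard : ∀ a b c d → IsStandard (form a b c d)
  form-standard a b c d = refl , refl

  standard⇒form : ∀ {v} → IsStandard v → v ≋ form (v 0F) (v 2F) (v 5F) (v 4F)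
  standard⇒form (v₁≈0 , v₃≈δv₅) = ≋6 refl v₁≈0 refl v₃≈δv₅ refl refl

  form-cong : ∀ {a a′ b b′ c c′ d d′} → a ≈ a′ → b ≈ b′ → c ≈ c′ → d ≈ d′ → form a b c d ≋ form a′ b′ c′ d′
  form-cong a≈ b≈ c≈ d≈ = ≋6 a≈ refl b≈ (*-congˡ c≈) d≈ c≈

  form-scale : ∀ k a b c d → map (k *_) (form a b c d) ≋ form (k * a) (k * b) (k * c) (k * d)
  form-scale k a b c d = ≋6 refl (zeroʳ k) refl (solve 3 (λ k δ c → k :* (δ :* c) := δ :* (k :* c)) refl k δ c) refl refl

  ≋⇒∼ : ∀ {n} {v w : Vector Carrier n} → v ≋ w → v ∼ w
  ≋⇒∼ v≋w = 1# , 0≉1 ∘ sym , λ i → trans (v≋w i) (sym (*-identityˡ _))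

  scale-∼ : ∀ {n k} {v w : Vector Carrier n} → ¬ (k ≈ 0#) → v ≋ map (k *_) w → v ∼ w
  scale-∼ k≉0 v≋kw = _ , k≉0 , v≋kw

  -- A shared coordinate normalised to 1 forces the scalar to be 1.
  ∼⇒≋ : ∀ {n} {v w : Vector Carrier n} i → v ∼ w → v i ≈ 1# → w i ≈ 1# → v ≋ w
  ∼⇒≋ i (k , _ , v≋kw) vi≈1 wi≈1 j = trans (v≋kw j) (trans (*-congʳ k≈1) (*-identityˡ _))
    where
    k≈1 : k ≈ 1#
    k≈1 = trans (sym (*-identityʳ k)) (trans (*-congˡ (sym wi≈1)) (trans (sym (v≋kw i)) vi≈1))

  ≈1⇒≉0 : ∀ {x} → x ≈ 1# → ¬ (x ≈ 0#)
  ≈1⇒≉0 x≈1 x≈0 = 0≉1 (trans (sym x≈0) x≈1)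

  ∼-≈0 : ∀ {n} {v w : Vector Carrier n} i → v ∼ w → w i ≈ 0# → v i ≈ 0#
  ∼-≈0 i (k , _ , v≋kw) wi≈0 = trans (v≋kw i) (trans (*-congˡ wi≈0) (zeroʳ k))

  standard-resp-∼ : ∀ {v w} → v ∼ w → IsStandard v → IsStandard w
  standard-resp-∼ {v} {w} (k , k≉0 , v≋kw) (v₁≈0 , v₃≈δv₅) =
      x*y≈0⇒y≈0 k≉0 (trans (sym (v≋kw 1F)) v₁≈0)
    , *-cancelˡ k≉0 (trans (sym (v≋kw 3F)) (trans v₃≈δv₅ (trans (*-congˡ (v≋kw 5F))
        (solve 3 (λ δ k w → δ :* (k :* w) := k :* (δ :* w)) refl δ k (w 5F)))))

  nonzero-at : ∀ {n} {v : Vector Carrier n} i → ¬ (v i ≈ 0#) → ¬ (v ≋ replicate n 0#)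
  nonzero-at i vi≉0 v≋0 = vi≉0 (v≋0 i)

  StandardHyperplanes : ∀ {p} → (Hyperplane → Set p) → Setoid (c ⊔ ℓ ⊔ p) (c ⊔ ℓ)
  StandardHyperplanes 𝓗 = Sub (pointSetoid 5) (λ H → 𝓗 H × IsStandard (coords H))

  -- For u v = δ this is the product of the lines with coordinates (u t, u, 1)
  -- and (− v t, v, 1).
  splitForm : (u v t : Carrier) → Vector Carrier 6
  splitForm u v t = form (- (δ * (t * t))) ((u - v) * t) 1# (u + v)

  splitForm-cong : ∀ {u u′ v v′ t t′} → u ≈ u′ → v ≈ v′ → t ≈ t′ → splitForm u v t ≋ splitForm u′ v′ t′
  splitForm-cong u≈ v≈ t≈ = form-cong (-‿cong (*-congˡ (*-cong t≈ t≈))) (*-cong (+-cong u≈ (-‿cong v≈)) t≈) refl (+-cong u≈ v≈)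

  -- Exchanging the two lines exchanges u and v and negates t, so one of u and v can be chosen as
  -- representative.
  splitForm-swap : ∀ u v t → splitForm u v t ≋ splitForm v u (- t)
  splitForm-swap u v t = form-cong
    (solve 2 (λ δ t → :- (δ :* (t :* t)) := :- (δ :* (:- t :* :- t))) refl δ t)
    (solve 3 (λ u v t → (u :- v) :* t := (v :- u) :* :- t) refl u v t) refl (+-comm u v)

  lines⇒splitForm : ∀ {l m : Vector Carrier 3} {x y u v t} → u * v ≈ δ →
    l ≋ (x * (u * t) ∷ x * u ∷ x ∷ []) → m ≋ (- (y * (v * t)) ∷ y * v ∷ y ∷ []) →
    (l ·ₗ m) ≋ map (x * y *_) (splitForm u v t)
  lines⇒splitForm {l} {m} {x} {y} {u} {v} {t} uv≈δ l≋ m≋ = ≋6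
    (trans (*-cong (l≋ 0F) (m≋ 0F)) (lc₁ (- (x * y * (t * t))) uv≈δ
      (solve 6 (λ x y u v t δ → x :* (u :* t) :* :- (y :* (v :* t)) :- x :* y :* :- (δ :* (t :* t))
        := :- (x :* y :* (t :* t)) :* (u :* v :- δ)) refl x y u v t δ)))
    (trans (+-cong (*-cong (l≋ 0F) (m≋ 1F)) (*-cong (l≋ 1F) (m≋ 0F)))
      (solve 5 (λ x y u v t → x :* (u :* t) :* (y :* v) :+ x :* u :* :- (y :* (v :* t)) := x :* y :* con (+ 0)) refl x y u v t))
    (trans (+-cong (*-cong (l≋ 0F) (m≋ 2F)) (*-cong (l≋ 2F) (m≋ 0F)))
      (solve 5 (λ x y u v t → x :* (u :* t) :* y :+ x :* :- (y :* (v :* t)) := x :* y :* ((u :- v) :* t)) refl x y u v t))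
    (trans (*-cong (l≋ 1F) (m≋ 1F)) (lc₁ (x * y) uv≈δ
      (solve 5 (λ x y u v δ → x :* u :* (y :* v) :- x :* y :* (δ :* con (+ 1)) := x :* y :* (u :* v :- δ)) refl x y u v δ)))
    (trans (+-cong (*-cong (l≋ 1F) (m≋ 2F)) (*-cong (l≋ 2F) (m≋ 1F)))
      (solve 4 (λ x y u v → x :* u :* y :+ x :* (y :* v) := x :* y :* (u :+ v)) refl x y u v))
    (trans (*-cong (l≋ 2F) (m≋ 2F)) (sym (*-identityʳ _)))

  -- Scale both lines to last coordinate 1. The X₁² coefficient gives u v = δ, so u is nonzero and
  -- the first coordinate of `l` is u t for some t. The missing X₀X₁ term then makes the first
  -- coordinate of `m` equal to - v t.
  factor : ¬ (δ ≈ 0#) → ∀ l m → IsStandard (l ·ₗ m) → ¬ (l 2F ≈ 0#) → ¬ (m 2F ≈ 0#) →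
    let u = l 1F * inv (l 2F); v = m 1F * inv (m 2F) in
    ∃ λ t → u * v ≈ δ × (l ·ₗ m) ∼ splitForm u v t
  factor δ≉0 l m (e₁ , e₃) x≉0 y≉0 =
    t , uv≈δ , scale-∼ (*-≉0 x≉0 y≉0) (lines⇒splitForm {l} {m} uv≈δ (≋3 l₀≈ l₁≈ refl) (≋3 m₀≈ m₁≈ refl))
    where
    x = l 2F
    y = m 2F
    u = l 1F * inv x
    v = m 1F * inv y
    l₁≈ : l 1F ≈ x * u
    l₁≈ = lc₁ (- l 1F) (*-inv x≉0) (solve 3 (λ a x i → a :- x :* (a :* i) := :- a :* (x :* i :- con (+ 1))) refl (l 1F) x (inv x))
    m₁≈ : m 1F ≈ y * v
    m₁≈ = lc₁ (- m 1F) (*-inv y≉0) (solve 3 (λ a x i → a :- x :* (a :* i) := :- a :* (x :* i :- con (+ 1))) refl (m 1F) y (inv y))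
    uv≈δ : u * v ≈ δ
    uv≈δ = *-cancelˡ (*-≉0 x≉0 y≉0) (trans
      (solve 4 (λ x y u v → x :* y :* (u :* v) := x :* u :* (y :* v)) refl x y u v)
      (trans (*-cong (sym l₁≈) (sym m₁≈)) (trans e₃ (*-comm _ _))))
    u≉0 : ¬ (u ≈ 0#)
    u≉0 u≈0 = δ≉0 (trans (sym uv≈δ) (trans (*-congʳ u≈0) (zeroˡ v)))
    t = l 0F * inv (x * u)
    l₀≈ : l 0F ≈ x * (u * t)
    l₀≈ = lc₁ (- l 0F) (*-inv (*-≉0 x≉0 u≉0))
      (solve 4 (λ a x u i → a :- x :* (u :* (a :* i)) := :- a :* (x :* u :* i :- con (+ 1))) refl (l 0F) x u (inv (x * u)))
    m₀≈ : m 0F ≈ - (y * (v * t))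
    m₀≈ = *-cancelˡ (*-≉0 x≉0 u≉0) (lc₁ 1# (trans (sym (+-cong (*-cong l₀≈ m₁≈) (*-congʳ l₁≈))) e₁)
      (solve 6 (λ x y u v t n → x :* u :* n :- x :* u :* :- (y :* (v :* t))
        := con (+ 1) :* (x :* (u :* t) :* (y :* v) :+ x :* u :* n :- con (+ 0))) refl x y u v t (m 0F)))

-- Splitting values of d, double lines and nonsingular conics

module StandardLine {c ℓ q} (F : FiniteField c ℓ q) (2∤q : ¬ (2 ∣ q))
  (δ : FiniteField.Carrier F) (δ-nonsquare : Geometry.NonSquare F δ) where

  open FiniteField F
  open Geometry F
  open QuadraticForms commutativeRing using (≋6; ≋3; discriminant-cong; discriminant-scale)
  open IntegerSolver commutativeRing
  open LinearCombination commutativeRing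
  open FieldProperties F
  open StandardForms F δ public

  2≉0 : ¬ (1# + 1# ≈ 0#)
  2≉0 = 1+1≉0 2∤q

  δ≉0 : ¬ (δ ≈ 0#)
  δ≉0 δ≈0 = δ-nonsquare (0# , trans (zeroˡ 0#) (sym δ≈0))

  -- The negated discriminant of X² - dX + δ, and also the coefficient of a in the discriminant of
  -- `form a b 1# d`.
  Δ : Carrier → Carrier
  Δ d = (1# + 1#) * (1# + 1#) * δ - d * d

  -- If 4δ = d², then d/2 is a square root of δ.
  Δ≉0 : ∀ d → ¬ (Δ d ≈ 0#)
  Δ≉0 d Δ≈0 = δ-nonsquare (d * ½ , lc₂ (- (½ * ½)) (δ * ((1# + 1#) * ½ + 1#)) Δ≈0 (*-inv 2≉0)
    (solve 3 (λ d h δ → let I = con (+ 1); two = I :+ I in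
      d :* h :* (d :* h) :- δ := :- (h :* h) :* (two :* two :* δ :- d :* d :- con (+ 0))
        :+ δ :* (two :* h :+ I) :* (two :* h :- I)) refl d ½ δ))
    where ½ = inv (1# + 1#)

  mate : Carrier → Carrier
  mate u = δ * inv u

  *-mate : ∀ {u} → ¬ (u ≈ 0#) → u * mate u ≈ δ
  *-mate {u} u≉0 = lc₁ δ (*-inv u≉0)
    (solve 3 (λ u i δ → u :* (δ :* i) :- δ := δ :* (u :* i :- con (+ 1))) refl u (inv u) δ)

  u*v≈δ⇒u≉0 : ∀ {u v} → u * v ≈ δ → ¬ (u ≈ 0#)
  u*v≈δ⇒u≉0 {u} {v} uv≈δ u≈0 = δ≉0 (trans (sym uv≈δ) (trans (*-congʳ u≈0) (zeroˡ v)))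

  mate-unique : ∀ {u v} → u * v ≈ δ → v ≈ mate u
  mate-unique uv≈δ = *-cancelˡ u≉0 (trans uv≈δ (sym (*-mate u≉0)))
    where u≉0 = u*v≈δ⇒u≉0 uv≈δ

  mateᵤ : Setoid.Carrier Units → Setoid.Carrier Units
  mateᵤ (u , u≉0) = mate u , *-≉0 δ≉0 (inv-≉0 u≉0)

  mate-cong : ∀ {u v} → u ≈ v → mate u ≈ mate v
  mate-cong u≈v = *-congˡ (inv-cong u≈v)

  mate-involutive : ∀ {u} → ¬ (u ≈ 0#) → mate (mate u) ≈ u
  mate-involutive u≉0 = sym (mate-unique (trans (*-comm _ _) (*-mate u≉0)))

  -- A fixed point of u ↦ δ/u is a square root of δ.
  mate-≉ : ∀ {u} → ¬ (u ≈ 0#) → ¬ (mate u ≈ u)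
  mate-≉ {u} u≉0 mu≈u = δ-nonsquare (u , trans (*-congˡ (sym mu≈u)) (*-mate u≉0))

  abstract
    index : Setoid.Carrier Units → ℕ
    index = toℕ ∘ Inverse.to (proj₂ (proj₂ card-Units))

    index-cong : ∀ {u v} → proj₁ u ≈ proj₁ v → index u ≡ index v
    index-cong {u} {v} u≈v = ≡.cong toℕ (Inverse.to-cong (proj₂ (proj₂ card-Units)) {u} {v} u≈v)

    index-injective : ∀ {u v} → index u ≡ index v → proj₁ u ≈ proj₁ v
    index-injective {u} {v} eq = to-injective (proj₂ (proj₂ card-Units)) {u} {v} (Fin.toℕ-injective eq)

  -- One element of each pair {u, δ/u}.
  HalfUnits : Setoid (c ⊔ ℓ) ℓ
  HalfUnits = Sub Units (λ u → index u ℕ.< index (mateᵤ u))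

  abstract
    -- Inside the abstract block `index` unfolds to the enumeration by which `card-involution` picks
    -- from each orbit, so the set counted there is `HalfUnits`.
    card-HalfUnits : ∃ λ k → q ≡ suc (k ℕ.+ k) × HasCardinality HalfUnits k
    card-HalfUnits =
      let n , 1+n≡q , U = card-Units
          k , n≡k+k , H = card-involution U mateᵤ mate-cong
            (λ { (u , u≉0) → mate-involutive u≉0 }) (λ { (u , u≉0) → mate-≉ u≉0 })
      in k , ≡.trans (≡.sym 1+n≡q) (≡.cong suc n≡k+k) , H

  half : Setoid.Carrier HalfUnits → Carrier
  half ((u , _) , _) = u

  half≉0 : ∀ h → ¬ (half h ≈ 0#)
  half≉0 ((u , u≉0) , _) = u≉0

  -- Comparing indices tells which of u and v = δ/u is the representative; a tie would make u a
  -- fixed point.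
  halve : ∀ {u v} → u * v ≈ δ → ∃ λ h → (u ≈ half h × v ≈ mate (half h)) ⊎ (v ≈ half h × u ≈ mate (half h))
  halve {u} {v} uv≈δ = compare (ℕ.<-cmp (index ū) (index (mateᵤ ū)))
    where
    u≉0 = u*v≈δ⇒u≉0 uv≈δ
    ū : Setoid.Carrier Units
    ū = u , u≉0
    compare : Tri (index ū ℕ.< index (mateᵤ ū)) (index ū ≡ index (mateᵤ ū)) (index (mateᵤ ū) ℕ.< index ū) →
      ∃ λ h → (u ≈ half h × v ≈ mate (half h)) ⊎ (v ≈ half h × u ≈ mate (half h))
    compare (tri< u<mu _ _) = (ū , u<mu) , inj₁ (refl , mate-unique uv≈δ)
    compare (tri≈ _ eq _)   = contradiction (sym (index-injective {ū} {mateᵤ ū} eq)) (mate-≉ u≉0)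
    compare (tri> _ _ mu<u) = (mateᵤ ū , ≡.subst (index (mateᵤ ū) ℕ.<_)
      (index-cong {ū} {mateᵤ (mateᵤ ū)} (sym (mate-involutive u≉0))) mu<u)
      , inj₂ (mate-unique uv≈δ , sym (mate-involutive u≉0))

  -- u and δ/u are the roots of a monic quadratic with constant term δ, so the sum determines the
  -- pair: (u - v)(u - δ/v) = 0.
  +mate-injective : ∀ {u v} → ¬ (u ≈ 0#) → ¬ (v ≈ 0#) → u + mate u ≈ v + mate v → u ≈ v ⊎ u ≈ mate v
  +mate-injective {u} {v} u≉0 v≉0 eq with u ≟ v
  ... | yes u≈v = inj₁ u≈v
  ... | no  u≉v = inj₂ (x-y≈0⇒x≈y (x*y≈0⇒y≈0 (u≉v ∘ x-y≈0⇒x≈y) (lc₃ u (- 1#) 1# eq (*-mate u≉0) (*-mate v≉0)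
      (solve 5 (λ u v u′ v′ δ → (u :- v) :* (u :- v′) :- con (+ 0) :=
        u :* (u :+ u′ :- (v :+ v′)) :+ :- con (+ 1) :* (u :* u′ :- δ) :+ con (+ 1) :* (v :* v′ :- δ))
        refl u v (mate u) (mate v) δ))))

  -- The alternative u = δ/v is excluded, since each of u and v precedes its own mate.
  half+mate-injective : ∀ g h → half g + mate (half g) ≈ half h + mate (half h) → half g ≈ half h
  half+mate-injective (ū@(u , u≉0) , u<mu) (v̄@(v , v≉0) , v<mv) eq =
    [ id , (λ u≈mv → contradiction
        (ℕ.<-trans
          (≡.subst (index ū ℕ.<_) (index-cong {mateᵤ ū} {v̄} (trans (mate-cong u≈mv) (mate-involutive v≉0))) u<mu)
          (≡.subst (index v̄ ℕ.<_) (index-cong {mateᵤ v̄} {ū} (sym u≈mv)) v<mv))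
        (ℕ.<-irrefl ≡.refl))
    ]′ (+mate-injective u≉0 v≉0 eq)

  -- X² − dX + δ has a root.
  Splits : Pred Carrier (c ⊔ ℓ)
  Splits d = ∃ λ u → u * (d - u) ≈ δ

  Splits-resp : ∀ {d e} → d ≈ e → Splits d → Splits e
  Splits-resp d≈e (u , eq) = u , trans (*-congˡ (+-congʳ (sym d≈e))) eq

  splits? : Decidable Splits
  splits? d = card⇒any? cardinality
    (λ u≈v eq → trans (*-cong (sym u≈v) (+-congˡ (-‿cong (sym u≈v)))) eq) (λ u → u * (d - u) ≟ δ)

  -- The bijection is u ↦ u + δ/u: a splitting d is the sum of its two roots, whose product is δ.
  card-Splits : ∀ {k} → HasCardinality HalfUnits k → HasCardinality (Sub setoid Splits) k
  card-Splits H = card-bijection H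
    (λ h → half h + mate (half h) , half h ,
      trans (*-congˡ (solve 2 (λ u v → u :+ v :- u := v) refl _ _)) (*-mate (half≉0 h)))
    (λ u≈v → +-cong u≈v (mate-cong u≈v))
    (λ {g} {h} → half+mate-injective g h)
    λ { (d , u , eq) → let h , cases = halve eq in h ,
      [ (λ { (u≈h , v≈mh) → trans (+-cong (sym u≈h) (sym v≈mh)) (solve 2 (λ u d → u :+ (d :- u) := d) refl u d) })
      , (λ { (v≈h , u≈mh) → trans (+-cong (sym v≈h) (sym u≈mh)) (solve 2 (λ u d → d :- u :+ u := d) refl u d) })
      ]′ cases }

  -- Of the 2k + 1 values of d, exactly k split; the one extra value becomes the difference between
  -- the real and imaginary counts.
  card-¬Splits : ∀ {k} → q ≡ suc (k ℕ.+ k) → HasCardinality HalfUnits k →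
    HasCardinality (Sub setoid (¬_ ∘ Splits)) (suc k)
  card-¬Splits {k} q≡1+k+k H =
    let i , j , i+j≡q , I , J = card-split cardinality Splits-resp splits?
        j≡1+k = ℕ.+-cancelˡ-≡ k j (suc k) (≡.trans (≡.cong (ℕ._+ j) (≡.sym (card-unique I (card-Splits H))))
          (≡.trans i+j≡q (≡.trans q≡1+k+k (≡.sym (ℕ.+-suc k k)))))
    in ≡.subst (HasCardinality (Sub setoid (¬_ ∘ Splits))) j≡1+k J

  standardise : ∀ {v} → IsStandard v → ¬ (v 5F ≈ 0#) → let i = inv (v 5F) in
    v ∼ form (i * v 0F) (i * v 2F) 1# (i * v 4F)
  standardise {v} std v₅≉0 = ∼-sym (scale-∼ (inv-≉0 v₅≉0) λ j → sym (trans (*-congˡ (standard⇒form {v} std j))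
    (trans (form-scale _ _ _ _ _ j) (form-cong refl refl (trans (*-comm _ _) (*-inv v₅≉0)) refl j))))

  -- The X₁² condition on a double line reads l₁² = δ l₂². As δ is a nonsquare, l₂ = 0 and then l₁ =
  -- 0.
  card-𝓗₁ : HasCardinality (StandardHyperplanes 𝓗₁) 1
  card-𝓗₁ = card-bijection (card-Fin 1) (λ _ → X₀² , (X₀ , ≋⇒∼ X₀²≋) , form-standard 1# 0# 0# 0#)
    (λ _ → ∼-refl) (λ { {0F} {0F} _ → ≡.refl }) λ { (H , (l , H∼ll) , std) → 0F , unique H l H∼ll std }
    where
    X₀ : Point 2
    X₀ = record { coords = 1# ∷ 0# ∷ 0# ∷ [] ; nonzero = nonzero-at 0F (≈1⇒≉0 refl) }
    X₀² : Point 5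
    X₀² = record { coords = form 1# 0# 0# 0# ; nonzero = nonzero-at 0F (≈1⇒≉0 refl) }
    X₀²≋ : coords X₀² ≋ (coords X₀ ·ₗ coords X₀)
    X₀²≋ = ≋6 (s1 refl) (s2 refl) (s2 refl) (solve 1 (λ δ → δ :* con (+ 0) := con (+ 0) :* con (+ 0)) refl δ) (s3 refl) (s4 refl)
      where
      I O : Polynomial 0
      I = con (+ 1)
      O = con (+ 0)
      s1 = solve 0 (I := I :* I)
      s2 = solve 0 (O := I :* O :+ O :* I)
      s3 = solve 0 (O := O :* O :+ O :* O)
      s4 = solve 0 (O := O :* O)
    unique : ∀ H l → coords H ∼ (coords l ·ₗ coords l) → IsStandard (coords H) → coords X₀² ∼ coords H
    unique H l H∼ll std = ∼-sym (∼-trans H∼ll (scale-∼ (*-≉0 l₀≉0 l₀≉0)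
        (≋6 (sym (*-identityʳ _)) (trans (proj₁ ll-std) (sym (zeroʳ _)))
          (lc₁ (l₀ + l₀) l₂≈0 (solve 2 (λ x z → x :* z :+ z :* x :- x :* x :* con (+ 0) := (x :+ x) :* (z :- con (+ 0))) refl l₀ l₂))
          (lc₁ l₁ l₁≈0 (solve 3 (λ x y δ → y :* y :- x :* x :* (δ :* con (+ 0)) := y :* (y :- con (+ 0))) refl l₀ l₁ δ))
          (lc₁ (l₁ + l₁) l₂≈0 (solve 3 (λ x y z → y :* z :+ z :* y :- x :* x :* con (+ 0) := (y :+ y) :* (z :- con (+ 0))) refl l₀ l₁ l₂))
          (lc₁ l₂ l₂≈0 (solve 2 (λ x z → z :* z :- x :* x :* con (+ 0) := z :* (z :- con (+ 0))) refl l₀ l₂)))))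
      where
      l₀ = coords l 0F
      l₁ = coords l 1F
      l₂ = coords l 2F
      ll-std = standard-resp-∼ H∼ll std
      l₂≈0 : l₂ ≈ 0#
      l₂≈0 = x*x≈Δ*y*y⇒y≈0 δ-nonsquare (proj₂ ll-std)
      l₁≈0 : l₁ ≈ 0#
      l₁≈0 = x*x≈0⇒x≈0 (trans (proj₂ ll-std) (trans (*-congˡ (trans (*-congʳ l₂≈0) (zeroˡ l₂))) (zeroʳ δ)))
      l₀≉0 : ¬ (l₀ ≈ 0#)
      l₀≉0 l₀≈0 = nonzero l (≋3 l₀≈0 l₁≈0 l₂≈0)

  -- The value of a for which form a b 1 d is singular.
  a₀ : Carrier → Carrier → Carrier
  a₀ b d = δ * (b * b) * inv (Δ d)

  a₀-cong : ∀ {b b′ d d′} → b ≈ b′ → d ≈ d′ → a₀ b d ≈ a₀ b′ d′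
  a₀-cong b≈ d≈ = *-cong (*-congˡ (*-cong b≈ b≈)) (inv-cong (+-congˡ (-‿cong (*-cong d≈ d≈))))

  a₀*Δ : ∀ b d → a₀ b d * Δ d ≈ δ * (b * b)
  a₀*Δ b d = lc₁ (δ * (b * b)) (*-inv (Δ≉0 d))
    (solve 3 (λ x D i → x :* i :* D :- x := x :* (D :* i :- con (+ 1))) refl (δ * (b * b)) (Δ d) (inv (Δ d)))

  disc-form : ∀ a b c d → disc (form a b c d) ≈ a * ((1# + 1#) * (1# + 1#) * δ * (c * c) - d * d) - δ * c * (b * b)
  disc-form a b c d = solve 5 (λ a b c d δ →
    let e = a :* (δ :* c) :* c; O = con (+ 0); two = con (+ 1) :+ con (+ 1) in
    (e :+ (e :+ (e :+ (e :+ O)))) :+ O :* b :* d :- a :* (d :* d) :- δ :* c :* (b :* b) :- c :* (O :* O)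
    := a :* (two :* two :* δ :* (c :* c) :- d :* d) :- δ :* c :* (b :* b)) refl a b c d δ

  disc-form₀ : ∀ a b d → disc (form a b 0# d) ≈ - (a * (d * d))
  disc-form₀ a b d = trans (disc-form a b 0# d) (solve 4 (λ a b d δ →
    let O = con (+ 0); two = con (+ 1) :+ con (+ 1) in
    a :* (two :* two :* δ :* (O :* O) :- d :* d) :- δ :* O :* (b :* b) := :- (a :* (d :* d))) refl a b d δ)

  disc-form₁ : ∀ a b d → disc (form a b 1# d) ≈ a * Δ d - δ * (b * b)
  disc-form₁ a b d = trans (disc-form a b 1# d) (solve 4 (λ a b d δ →
    let I = con (+ 1); two = con (+ 1) :+ con (+ 1) in
    a :* (two :* two :* δ :* (I :* I) :- d :* d) :- δ :* I :* (b :* b)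
    := a :* (two :* two :* δ :- d :* d) :- δ :* (b :* b)) refl a b d δ)

  disc-resp-∼ : ∀ {v w} → v ∼ w → ¬ (disc v ≈ 0#) → ¬ (disc w ≈ 0#)
  disc-resp-∼ {w = w} (k , _ , v≋kw) disc-v≉0 disc-w≈0 = disc-v≉0
    (trans (discriminant-cong v≋kw) (trans (discriminant-scale k w) (trans (*-congˡ disc-w≈0) (zeroʳ _))))

  disc-form₁≈0⇒≈a₀ : ∀ {a b d} → disc (form a b 1# d) ≈ 0# → a ≈ a₀ b d
  disc-form₁≈0⇒≈a₀ {a} {b} {d} disc≈0 = *-cancelˡ (Δ≉0 d)
    (trans (*-comm _ _) (trans (x-y≈0⇒x≈y (trans (sym (disc-form₁ a b d)) disc≈0))
      (trans (sym (a₀*Δ b d)) (*-comm _ _))))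

  -- For c = 0 the discriminant is - a d²: scale d to 1, leaving a nonzero and b free. For c = 1 it
  -- vanishes only at a = `a₀ b d`, so the parameters are b, d and the nonzero offset e = a -
  -- `a₀ b d`.
  card-𝓗₃ : ∀ {n} → HasCardinality Units n → HasCardinality (StandardHyperplanes 𝓗₃) (n ℕ.* q ℕ.+ q ℕ.* (q ℕ.* n))
  card-𝓗₃ U = card-bijection (card-⊎ (card-× U cardinality) (card-× cardinality (card-× cardinality U)))
    f (λ {x} {y} → f-cong {x} {y}) (λ {x} {y} → f-inj {x} {y}) f-surj
    where
    Parameters : Setoid _ _
    Parameters = (Units ×ₛ setoid) ⊎ₛ (setoid ×ₛ (setoid ×ₛ Units))
    module P = Setoid Parameters

    vec : P.Carrier → Vector Carrier 6
    vec (inj₁ ((a , _) , b))     = form a b 0# 1#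
    vec (inj₂ (b , d , (e , _))) = form (a₀ b d + e) b 1# d

    vec-nonzero : ∀ p → ¬ (vec p ≋ replicate 6 0#)
    vec-nonzero (inj₁ _) = nonzero-at 4F (≈1⇒≉0 refl)
    vec-nonzero (inj₂ _) = nonzero-at 5F (≈1⇒≉0 refl)

    disc-vec : ∀ p → ¬ (disc (vec p) ≈ 0#)
    disc-vec (inj₁ ((a , a≉0) , b)) disc≈0 = a≉0 (lc₁ (- 1#) (trans (sym (disc-form₀ a b 1#)) disc≈0)
      (solve 1 (λ a → let I = con (+ 1) in a :- con (+ 0) := :- I :* (:- (a :* (I :* I)) :- con (+ 0))) refl a))
    disc-vec (inj₂ (b , d , (e , e≉0))) disc≈0 = e≉0 (lc₁ 1# (disc-form₁≈0⇒≈a₀ disc≈0)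
      (solve 2 (λ a e → e :- con (+ 0) := con (+ 1) :* (a :+ e :- a)) refl (a₀ b d) e))

    vec-standard : ∀ p → IsStandard (vec p)
    vec-standard (inj₁ _) = refl , refl
    vec-standard (inj₂ _) = refl , refl

    f : P.Carrier → Setoid.Carrier (StandardHyperplanes 𝓗₃)
    f p = record { coords = vec p ; nonzero = vec-nonzero p } , disc-vec p , vec-standard p

    f-cong : ∀ {x y} → x P.≈ y → vec x ∼ vec y
    f-cong {inj₁ _} {inj₁ _} (inj₁ (a≈ , b≈))      = ≋⇒∼ (form-cong a≈ b≈ refl refl)
    f-cong {inj₂ _} {inj₂ _} (inj₂ (b≈ , d≈ , e≈)) = ≋⇒∼ (form-cong (+-cong (a₀-cong b≈ d≈) e≈) b≈ refl d≈)

    f-inj : ∀ {x y} → vec x ∼ vec y → x P.≈ y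
    f-inj {inj₁ _} {inj₁ _} v∼w = inj₁ (v≋w 0F , v≋w 2F) where v≋w = ∼⇒≋ 4F v∼w refl refl
    f-inj {inj₁ _} {inj₂ _} v∼w = contradiction (∼-≈0 5F (∼-sym v∼w) refl) (0≉1 ∘ sym)
    f-inj {inj₂ _} {inj₁ _} v∼w = contradiction (∼-≈0 5F v∼w refl) (0≉1 ∘ sym)
    f-inj {inj₂ (b , d , (e , _))} {inj₂ (b′ , d′ , (e′ , _))} v∼w = inj₂ (v≋w 2F , v≋w 4F ,
      lc₂ 1# (- 1#) (v≋w 0F) (a₀-cong (v≋w 2F) (v≋w 4F))
        (solve 4 (λ a e a′ e′ → e :- e′ := con (+ 1) :* (a :+ e :- (a′ :+ e′)) :+ :- con (+ 1) :* (a :- a′)) refl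
          (a₀ b d) e (a₀ b′ d′) e′))
      where v≋w = ∼⇒≋ 5F v∼w refl refl

    f-surj : ∀ y → ∃ λ x → vec x ∼ coords (proj₁ y)
    f-surj (H , disc≉0 , std) with coords H 5F ≟ 0#
    ... | yes h₅≈0 = inj₁ ((i * h₀ , *-≉0 (inv-≉0 h₄≉0) h₀≉0) , i * h₂) , scale-∼ (inv-≉0 h₄≉0) (λ j → sym
            (trans (*-congˡ (H≋ j)) (trans (form-scale i h₀ h₂ 0# h₄ j)
              (form-cong refl refl (zeroʳ i) (trans (*-comm i h₄) (*-inv h₄≉0)) j))))
      where
      h₀ = coords H 0F
      h₂ = coords H 2F
      h₄ = coords H 4F
      i  = inv h₄
      H≋ : coords H ≋ form h₀ h₂ 0# h₄
      H≋ j = trans (standard⇒form {coords H} std j) (form-cong refl refl h₅≈0 refl j)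
      disc-H : disc (coords H) ≈ - (h₀ * (h₄ * h₄))
      disc-H = trans (discriminant-cong H≋) (disc-form₀ h₀ h₂ h₄)
      h₀≉0 : ¬ (h₀ ≈ 0#)
      h₀≉0 h₀≈0 = disc≉0 (trans disc-H (lc₁ (- (h₄ * h₄)) h₀≈0
        (solve 2 (λ x y → :- (x :* (y :* y)) :- con (+ 0) := :- (y :* y) :* (x :- con (+ 0))) refl h₀ h₄)))
      h₄≉0 : ¬ (h₄ ≈ 0#)
      h₄≉0 h₄≈0 = disc≉0 (trans disc-H (lc₁ (- (h₀ * h₄)) h₄≈0
        (solve 2 (λ x y → :- (x :* (y :* y)) :- con (+ 0) := :- (x :* y) :* (y :- con (+ 0))) refl h₀ h₄)))
    ... | no h₅≉0 = inj₂ (b , d , (a - a₀ b d , e≉0)) , ∼-trans (≋⇒∼ (form-cong a₀+e≈a refl refl refl)) (∼-sym H∼)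
      where
      i = inv (coords H 5F)
      a = i * coords H 0F
      b = i * coords H 2F
      d = i * coords H 4F
      H∼ : coords H ∼ form a b 1# d
      H∼ = standardise std h₅≉0
      a₀+e≈a : a₀ b d + (a - a₀ b d) ≈ a
      a₀+e≈a = solve 2 (λ x a → x :+ (a :- x) := a) refl (a₀ b d) a
      e≉0 : ¬ (a - a₀ b d ≈ 0#)
      e≉0 e≈0 = disc-resp-∼ H∼ disc≉0 (trans (disc-form₁ a b d)
        (x≈y⇒x-y≈0 (trans (*-congʳ (x-y≈0⇒x≈y e≈0)) (a₀*Δ b d))))

-- Pairs of distinct real lines

module RealPairs {c ℓ q} (F : FiniteField c ℓ q) (2∤q : ¬ (2 ∣ q))
  (δ : FiniteField.Carrier F) (δ-nonsquare : Geometry.NonSquare F δ) where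

  open FiniteField F
  open Geometry F
  open QuadraticForms commutativeRing using (≋6; ≋3)
  open IntegerSolver commutativeRing
  open LinearCombination commutativeRing
  open FieldProperties F
  open StandardLine F 2∤q δ δ-nonsquare

  -- The first two summands are the families with c = 0. In the third, restricting u to `HalfUnits`
  -- counts each unordered pair of lines once, while t runs freely.
  Parameters : Setoid (c ⊔ ℓ) (c ⊔ ℓ)
  Parameters = setoid ⊎ₛ (setoid ⊎ₛ (HalfUnits ×ₛ setoid))
  private module P = Setoid Parameters

  vec : P.Carrier → Vector Carrier 6
  vec (inj₁ a)              = form a 1# 0# 0#
  vec (inj₂ (inj₁ b))       = form 0# b 0# 1#
  vec (inj₂ (inj₂ (h , t))) = splitForm (half h) (mate (half h)) t

  vec-nonzero : ∀ p → ¬ (vec p ≋ replicate 6 0#)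
  vec-nonzero (inj₁ _)        = nonzero-at 2F (≈1⇒≉0 refl)
  vec-nonzero (inj₂ (inj₁ _)) = nonzero-at 4F (≈1⇒≉0 refl)
  vec-nonzero (inj₂ (inj₂ _)) = nonzero-at 5F (≈1⇒≉0 refl)

  vec-standard : ∀ p → IsStandard (vec p)
  vec-standard (inj₁ _)        = refl , refl
  vec-standard (inj₂ (inj₁ _)) = refl , refl
  vec-standard (inj₂ (inj₂ _)) = refl , refl

  point : P.Carrier → Point 5
  point p = record { coords = vec p ; nonzero = vec-nonzero p }

  vec-real : ∀ p → 𝓗₂,ᵣ (point p)
  vec-real (inj₁ a) =
      record { coords = 1# ∷ 0# ∷ 0# ∷ [] ; nonzero = nonzero-at 0F (≈1⇒≉0 refl) }
    , record { coords = a ∷ 0# ∷ 1# ∷ [] ; nonzero = nonzero-at 2F (≈1⇒≉0 refl) }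
    , (λ l∼m → 0≉1 (sym (∼-≈0 2F (∼-sym l∼m) refl)))
    , ≋⇒∼ (≋6
        (solve 1 (λ a → a := con (+ 1) :* a) refl a)
        (solve 1 (λ a → con (+ 0) := con (+ 1) :* con (+ 0) :+ con (+ 0) :* a) refl a)
        (solve 1 (λ a → con (+ 1) := con (+ 1) :* con (+ 1) :+ con (+ 0) :* a) refl a)
        (solve 1 (λ δ → δ :* con (+ 0) := con (+ 0) :* con (+ 0)) refl δ)
        (solve 1 (λ a → con (+ 0) := con (+ 0) :* con (+ 1) :+ con (+ 0) :* con (+ 0)) refl a)
        (solve 1 (λ a → con (+ 0) := con (+ 0) :* con (+ 1)) refl a))
  vec-real (inj₂ (inj₁ b)) =
      record { coords = 0# ∷ 0# ∷ 1# ∷ [] ; nonzero = nonzero-at 2F (≈1⇒≉0 refl) }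
    , record { coords = b ∷ 1# ∷ 0# ∷ [] ; nonzero = nonzero-at 1F (≈1⇒≉0 refl) }
    , (λ l∼m → 0≉1 (sym (∼-≈0 2F l∼m refl)))
    , ≋⇒∼ (≋6
        (solve 1 (λ b → con (+ 0) := con (+ 0) :* b) refl b)
        (solve 1 (λ b → con (+ 0) := con (+ 0) :* con (+ 1) :+ con (+ 0) :* b) refl b)
        (solve 1 (λ b → b := con (+ 0) :* con (+ 0) :+ con (+ 1) :* b) refl b)
        (solve 1 (λ δ → δ :* con (+ 0) := con (+ 0) :* con (+ 1)) refl δ)
        (solve 1 (λ b → con (+ 1) := con (+ 0) :* con (+ 0) :+ con (+ 1) :* con (+ 1)) refl b)
        (solve 1 (λ b → con (+ 0) := con (+ 1) :* con (+ 0)) refl b))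
  vec-real (inj₂ (inj₂ (h , t))) =
      record { coords = l ; nonzero = nonzero-at 2F (≈1⇒≉0 refl) }
    , record { coords = m ; nonzero = nonzero-at 2F (≈1⇒≉0 refl) }
    -- Both last coordinates are 1, so proportional lines would have u = δ/u.
    , (λ l∼m → mate-≉ u≉0 (sym (∼⇒≋ {v = l} {m} 2F l∼m refl refl 1F)))
    , ∼-sym (scale-∼ {k = 1# * 1#} {l ·ₗ m} (≈1⇒≉0 (*-identityˡ 1#)) (lines⇒splitForm {l} {m} (*-mate u≉0)
        (≋3 (sym (*-identityˡ _)) (sym (*-identityˡ _)) refl)
        (≋3 (-‿cong (sym (*-identityˡ _))) (sym (*-identityˡ _)) refl)))
    where
    u = half h
    v = mate u
    u≉0 = half≉0 h
    l m : Vector Carrier 3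
    l = u * t ∷ u ∷ 1# ∷ []
    m = - (v * t) ∷ v ∷ 1# ∷ []

  vec-cong : ∀ {x y} → x P.≈ y → vec x ∼ vec y
  vec-cong {inj₁ _} {inj₁ _} (inj₁ a≈) = ≋⇒∼ (form-cong a≈ refl refl refl)
  vec-cong {inj₂ (inj₁ _)} {inj₂ (inj₁ _)} (inj₂ (inj₁ b≈)) = ≋⇒∼ (form-cong refl b≈ refl refl)
  vec-cong {inj₂ (inj₂ _)} {inj₂ (inj₂ _)} (inj₂ (inj₂ (u≈ , t≈))) = ≋⇒∼ (splitForm-cong u≈ (mate-cong u≈) t≈)

  -- The coefficient u + v determines the representative u, and (u - v) t then determines t because
  -- u and v differ.
  splitForm-injective : ∀ g h {s t} →
    splitForm (half g) (mate (half g)) s ≋ splitForm (half h) (mate (half h)) t → half g ≈ half h × s ≈ t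
  splitForm-injective g h {s} {t} v≋w = u≈ , *-cancelˡ (mate-≉ (half≉0 g) ∘ sym ∘ x-y≈0⇒x≈y)
    (trans (v≋w 2F) (*-congʳ (+-cong (sym u≈) (-‿cong (mate-cong (sym u≈))))))
    where
    u≈ : half g ≈ half h
    u≈ = half+mate-injective g h (v≋w 4F)

  vec-injective : ∀ {x y} → vec x ∼ vec y → x P.≈ y
  vec-injective {inj₁ _} {inj₁ _} v∼w = inj₁ (∼⇒≋ 2F v∼w refl refl 0F)
  vec-injective {inj₁ _} {inj₂ (inj₁ _)} v∼w = contradiction (∼-≈0 4F (∼-sym v∼w) refl) (0≉1 ∘ sym)
  vec-injective {inj₁ _} {inj₂ (inj₂ _)} v∼w = contradiction (∼-≈0 5F (∼-sym v∼w) refl) (0≉1 ∘ sym)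
  vec-injective {inj₂ (inj₁ _)} {inj₁ _} v∼w = contradiction (∼-≈0 4F v∼w refl) (0≉1 ∘ sym)
  vec-injective {inj₂ (inj₁ _)} {inj₂ (inj₁ _)} v∼w = inj₂ (inj₁ (∼⇒≋ 4F v∼w refl refl 2F))
  vec-injective {inj₂ (inj₁ _)} {inj₂ (inj₂ _)} v∼w = contradiction (∼-≈0 5F (∼-sym v∼w) refl) (0≉1 ∘ sym)
  vec-injective {inj₂ (inj₂ _)} {inj₁ _} v∼w = contradiction (∼-≈0 5F v∼w refl) (0≉1 ∘ sym)
  vec-injective {inj₂ (inj₂ _)} {inj₂ (inj₁ _)} v∼w = contradiction (∼-≈0 5F v∼w refl) (0≉1 ∘ sym)
  vec-injective {inj₂ (inj₂ (g , s))} {inj₂ (inj₂ (h , t))} v∼w =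
    inj₂ (inj₂ (splitForm-injective g h (∼⇒≋ 5F v∼w refl refl)))

  ·ₗ-comm : ∀ l m → (l ·ₗ m) ≋ (m ·ₗ l)
  ·ₗ-comm l m = ≋6 (*-comm _ _) (s 0F 1F) (s 0F 2F) (*-comm _ _) (s 1F 2F) (*-comm _ _)
    where
    s = λ i j → solve 4 (λ a b c d → a :* b :+ c :* d := d :* c :+ b :* a) refl (l i) (m j) (l j) (m i)

  Covered : Vector Carrier 6 → Set (c ⊔ ℓ)
  Covered w = ∃ λ p → vec p ∼ w

  cover-split : ∀ {u v} t → u * v ≈ δ → Covered (splitForm u v t)
  cover-split {u} {v} t uv≈δ = let h , cases = halve uv≈δ in
    [ (λ { (u≈ , v≈) → inj₂ (inj₂ (h , t)) , ≋⇒∼ (splitForm-cong (sym u≈) (sym v≈) refl) })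
    -- The representative is v, so the lines are exchanged and t changes sign.
    , (λ { (v≈ , u≈) → inj₂ (inj₂ (h , - t)) , ∼-sym
         (∼-trans (≋⇒∼ (splitForm-swap u v t)) (≋⇒∼ (splitForm-cong v≈ u≈ refl))) })
    ]′ cases

  cover-nonzero : ∀ (l m : Vector Carrier 3) → IsStandard (l ·ₗ m) → ¬ (l 2F ≈ 0#) → ¬ (m 2F ≈ 0#) → Covered (l ·ₗ m)
  cover-nonzero l m std x≉0 y≉0 =
    let t , uv≈δ , lm∼ = factor δ≉0 l m std x≉0 y≉0
        p , p∼ = cover-split t uv≈δ
    in p , ∼-trans p∼ (∼-sym lm∼)

  module _ (l m : Point 2) (l≁m : ¬ (coords l ∼ coords m)) (std : IsStandard (coords l ·ₗ coords m))
           (l₂≈0 : coords l 2F ≈ 0#) where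
    private
      l₀ = coords l 0F
      l₁ = coords l 1F
      l₂ = coords l 2F
      m₀ = coords m 0F
      m₁ = coords m 1F
      m₂ = coords m 2F

      l₁m₁≈0 : l₁ * m₁ ≈ 0#
      l₁m₁≈0 = trans (proj₂ std) (trans (*-congˡ (trans (*-congʳ l₂≈0) (zeroˡ m₂))) (zeroʳ δ))

    -- Here `l` is X₀ up to a scalar. The missing X₀X₁ term gives m₁ = 0, and m₂ = 0 would make the
    -- lines proportional.
    cover-X₀ : l₁ ≈ 0# → Covered (coords l ·ₗ coords m)
    cover-X₀ l₁≈0 = inj₁ (m₀ * inv m₂) , ∼-sym (scale-∼ (*-≉0 l₀≉0 m₂≉0) (≋6
        (lc₁ (- (l₀ * m₀)) (*-inv m₂≉0)
          (solve 4 (λ x n y i → x :* n :- x :* y :* (n :* i) := :- (x :* n) :* (y :* i :- con (+ 1))) refl l₀ m₀ m₂ (inv m₂)))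
        (trans (proj₁ std) (sym (zeroʳ _)))
        (lc₁ m₀ l₂≈0 (solve 4 (λ x z n y → x :* y :+ z :* n :- x :* y :* con (+ 1) := n :* (z :- con (+ 0))) refl l₀ l₂ m₀ m₂))
        (trans l₁m₁≈0 (solve 3 (λ x y δ → con (+ 0) := x :* y :* (δ :* con (+ 0))) refl l₀ m₂ δ))
        (lc₂ m₂ m₁ l₁≈0 l₂≈0 (solve 5 (λ x w z n y → w :* y :+ z :* n :- x :* y :* con (+ 0)
          := y :* (w :- con (+ 0)) :+ n :* (z :- con (+ 0))) refl l₀ l₁ l₂ m₁ m₂))
        (lc₁ m₂ l₂≈0 (solve 3 (λ x z y → z :* y :- x :* y :* con (+ 0) := y :* (z :- con (+ 0))) refl l₀ l₂ m₂))))
      where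
      l₀≉0 : ¬ (l₀ ≈ 0#)
      l₀≉0 l₀≈0 = nonzero l (≋3 l₀≈0 l₁≈0 l₂≈0)
      m₁≈0 : m₁ ≈ 0#
      m₁≈0 = x*y≈0⇒y≈0 l₀≉0 (lc₂ 1# (- m₀) (proj₁ std) l₁≈0
        (solve 4 (λ x w n p → x :* n :- con (+ 0) := con (+ 1) :* (x :* n :+ w :* p :- con (+ 0)) :+ :- p :* (w :- con (+ 0)))
          refl l₀ l₁ m₁ m₀))
      m₂≉0 : ¬ (m₂ ≈ 0#)
      m₂≉0 m₂≈0 = l≁m (scale-∼ (*-≉0 l₀≉0 (inv-≉0 m₀≉0)) (≋3
        (lc₁ (- l₀) (*-inv m₀≉0) (solve 3 (λ x n i → x :- x :* i :* n := :- x :* (n :* i :- con (+ 1))) refl l₀ m₀ (inv m₀)))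
        (trans l₁≈0 (sym (trans (*-congˡ m₁≈0) (zeroʳ _))))
        (trans l₂≈0 (sym (trans (*-congˡ m₂≈0) (zeroʳ _))))))
        where
        m₀≉0 : ¬ (m₀ ≈ 0#)
        m₀≉0 m₀≈0 = nonzero m (≋3 m₀≈0 m₁≈0 m₂≈0)

    -- Here `m` is X₂ up to a scalar: the X₁² coefficient gives m₁ = 0, and then the X₀X₁
    -- coefficient gives m₀ = 0.
    cover-X₂ : ¬ (l₁ ≈ 0#) → Covered (coords l ·ₗ coords m)
    cover-X₂ l₁≉0 = inj₂ (inj₁ (l₀ * inv l₁)) , ∼-sym (scale-∼ (*-≉0 l₁≉0 m₂≉0) (≋6
        (trans (*-congˡ m₀≈0) (solve 3 (λ x w y → x :* con (+ 0) := w :* y :* con (+ 0)) refl l₀ l₁ m₂))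
        (trans (proj₁ std) (sym (zeroʳ _)))
        (lc₂ m₀ (- (l₀ * m₂)) l₂≈0 (*-inv l₁≉0) (solve 6 (λ x w z n y i → x :* y :+ z :* n :- w :* y :* (x :* i)
          := n :* (z :- con (+ 0)) :+ :- (x :* y) :* (w :* i :- con (+ 1))) refl l₀ l₁ l₂ m₀ m₂ (inv l₁)))
        (trans l₁m₁≈0 (solve 3 (λ x y δ → con (+ 0) := x :* y :* (δ :* con (+ 0))) refl l₁ m₂ δ))
        (lc₁ m₁ l₂≈0 (solve 4 (λ w z n y → w :* y :+ z :* n :- w :* y :* con (+ 1) := n :* (z :- con (+ 0))) refl l₁ l₂ m₁ m₂))
        (lc₁ m₂ l₂≈0 (solve 3 (λ x z y → z :* y :- x :* y :* con (+ 0) := y :* (z :- con (+ 0))) refl l₁ l₂ m₂))))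
      where
      m₁≈0 : m₁ ≈ 0#
      m₁≈0 = x*y≈0⇒y≈0 l₁≉0 l₁m₁≈0
      m₀≈0 : m₀ ≈ 0#
      m₀≈0 = x*y≈0⇒y≈0 l₁≉0 (lc₂ 1# (- l₀) (proj₁ std) m₁≈0
        (solve 4 (λ x w n p → w :* p :- con (+ 0) := con (+ 1) :* (x :* n :+ w :* p :- con (+ 0)) :+ :- x :* (n :- con (+ 0)))
          refl l₀ l₁ m₁ m₀))
      m₂≉0 : ¬ (m₂ ≈ 0#)
      m₂≉0 m₂≈0 = nonzero m (≋3 m₀≈0 m₁≈0 m₂≈0)

    cover-degenerate : Covered (coords l ·ₗ coords m)
    cover-degenerate = cases (l₁ ≟ 0#)
      where
      cases : Dec (l₁ ≈ 0#) → Covered (coords l ·ₗ coords m)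
      cases (yes l₁≈0) = cover-X₀ l₁≈0
      cases (no  l₁≉0) = cover-X₂ l₁≉0

  cover : ∀ (l m : Point 2) → ¬ (coords l ∼ coords m) → IsStandard (coords l ·ₗ coords m) → Covered (coords l ·ₗ coords m)
  cover l m l≁m std = cases (coords l 2F ≟ 0#) (coords m 2F ≟ 0#)
    where
    lm∼ml : (coords l ·ₗ coords m) ∼ (coords m ·ₗ coords l)
    lm∼ml = ≋⇒∼ (·ₗ-comm (coords l) (coords m))
    cases : Dec (coords l 2F ≈ 0#) → Dec (coords m 2F ≈ 0#) → Covered (coords l ·ₗ coords m)
    cases (yes l₂≈0) _          = cover-degenerate l m l≁m std l₂≈0
    cases (no  l₂≉0) (no  m₂≉0) = cover-nonzero (coords l) (coords m) std l₂≉0 m₂≉0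
    cases (no  l₂≉0) (yes m₂≈0) =
      let p , p∼ = cover-degenerate m l (l≁m ∘ ∼-sym) (standard-resp-∼ lm∼ml std) m₂≈0
      in p , ∼-trans p∼ (∼-sym lm∼ml)

  card-𝓗₂,ᵣ : ∀ {k} → HasCardinality HalfUnits k →
    HasCardinality (StandardHyperplanes 𝓗₂,ᵣ) (q ℕ.+ (q ℕ.+ k ℕ.* q))
  card-𝓗₂,ᵣ K = card-bijection (card-⊎ cardinality (card-⊎ cardinality (card-× K cardinality)))
    (λ p → point p , vec-real p , vec-standard p)
    (λ {x} {y} → vec-cong {x} {y}) (λ {x} {y} → vec-injective {x} {y})
    λ { (H , (l , m , l≁m , H∼lm) , std) →
        let p , p∼ = cover l m l≁m (standard-resp-∼ H∼lm std) in p , ∼-trans p∼ (∼-sym H∼lm) }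

-- Pairs of conjugate imaginary lines

module ImaginaryPairs {c ℓ q c′ ℓ′} (F : FiniteField c ℓ q) (2∤q : ¬ (2 ∣ q))
  (δ : FiniteField.Carrier F) (δ-nonsquare : Geometry.NonSquare F δ)
  (X : QuadraticExtension F c′ ℓ′) where

  open FiniteField F
  open Geometry F
  open IntegerSolver commutativeRing
  open LinearCombination commutativeRing
  open FieldProperties F
  open StandardLine F 2∤q δ δ-nonsquare

  open QuadraticExtension X using (ι; σ; ι-mono; σ-iso; σ-fixes; σ-nontrivial)
  private
    module K = FiniteField (QuadraticExtension.E X)
    module GK = Geometry (QuadraticExtension.E X)
    open GK using () renaming (_≋_ to _≋ᴷ_; _∼_ to _∼ᴷ_; _·ₗ_ to _·ₗᴷ_)
    module SK = IntegerSolver K.commutativeRing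
    module LK = LinearCombination K.commutativeRing
    module PK = FieldProperties (QuadraticExtension.E X)
    module FK = StandardForms (QuadraticExtension.E X) (ι δ)
    module QK = QuadraticForms K.commutativeRing
    module ι = RingMorphisms.IsRingMonomorphism ι-mono
    module σ = RingMorphisms.IsRingIsomorphism σ-iso
  open SK using () renaming (_:+_ to _⊕_; _:*_ to _⊛_; _:-_ to _⊝_; :-_ to ⊝_; con to con′; _:=_ to _≔_)

  ι-homo-- : ∀ x y → ι (x - y) K.≈ ι x K.- ι y
  ι-homo-- x y = K.trans (ι.+-homo x (- y)) (K.+-congˡ (ι.-‿homo y))

  σ-homo-- : ∀ x y → σ (x K.- y) K.≈ σ x K.- σ y
  σ-homo-- x y = K.trans (σ.+-homo x (K.- y)) (K.+-congˡ (σ.-‿homo y))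

  ι≈0⇒≈0 : ∀ {x} → ι x K.≈ K.0# → x ≈ 0#
  ι≈0⇒≈0 ιx≈0 = ι.injective (K.trans ιx≈0 (K.sym ι.0#-homo))

  ι-2 : ι (1# + 1#) K.≈ K.1# K.+ K.1#
  ι-2 = K.trans (ι.+-homo 1# 1#) (K.+-cong ι.1#-homo ι.1#-homo)

  2≉0ᴷ : ¬ (K.1# K.+ K.1# K.≈ K.0#)
  2≉0ᴷ 2≈0 = 2≉0 (ι≈0⇒≈0 (K.trans ι-2 2≈0))

  σ≈0⇒≈0 : ∀ {x} → σ x K.≈ K.0# → x K.≈ K.0#
  σ≈0⇒≈0 σx≈0 = σ.injective (K.trans σx≈0 (K.sym σ.0#-homo))

  θ : K.Carrier
  θ = proj₁ σ-nontrivial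

  θ-σθ≉0 : ¬ (θ K.- σ θ K.≈ K.0#)
  θ-σθ≉0 eq = proj₂ σ-nontrivial (K.sym (LK.x-y≈0⇒x≈y eq))

  span : Carrier × Carrier → K.Carrier
  span (x , y) = ι x K.+ ι y K.* θ

  σ-span : ∀ x y → σ (span (x , y)) K.≈ ι x K.+ ι y K.* σ θ
  σ-span x y = K.trans (σ.+-homo _ _) (K.+-cong (σ-fixes x) (K.trans (σ.*-homo _ _) (K.*-congʳ (σ-fixes y))))

  -- Applying σ yields a second equation, and the difference of the two is (y - y′)(θ - σ θ) = 0.
  span-injective : ∀ {x y x′ y′} → span (x , y) K.≈ span (x′ , y′) → x ≈ x′ × y ≈ y′
  span-injective {x} {y} {x′} {y′} eq = ι.injective ιx≈ , ι.injective ιy≈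
    where
    eqσ : ι x K.+ ι y K.* σ θ K.≈ ι x′ K.+ ι y′ K.* σ θ
    eqσ = K.trans (K.sym (σ-span x y)) (K.trans (σ.⟦⟧-cong eq) (σ-span x′ y′))
    ιy≈ : ι y K.≈ ι y′
    ιy≈ = LK.x-y≈0⇒x≈y (PK.x*y≈0⇒x≈0 θ-σθ≉0 (LK.lc₂ K.1# (K.- K.1#) eq eqσ
      (SK.solve 6 (λ x y x′ y′ θ τ → (y ⊝ y′) ⊛ (θ ⊝ τ) ⊝ con′ (+ 0) ≔
        con′ (+ 1) ⊛ (x ⊕ y ⊛ θ ⊝ (x′ ⊕ y′ ⊛ θ)) ⊕ ⊝ con′ (+ 1) ⊛ (x ⊕ y ⊛ τ ⊝ (x′ ⊕ y′ ⊛ τ))) K.refl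
        (ι x) (ι y) (ι x′) (ι y′) θ (σ θ))))
    ιx≈ : ι x K.≈ ι x′
    ιx≈ = LK.lc₂ K.1# (K.- θ) eq ιy≈ (SK.solve 5 (λ x y x′ y′ θ → x ⊝ x′ ≔
        con′ (+ 1) ⊛ (x ⊕ y ⊛ θ ⊝ (x′ ⊕ y′ ⊛ θ)) ⊕ ⊝ θ ⊛ (y ⊝ y′)) K.refl (ι x) (ι y) (ι x′) (ι y′) θ)

  abstract
    -- A dimension count by cardinality: an injection from q · q pairs into a field of q² elements
    -- is onto.
    span-surjective : ∀ z → ∃ λ xy → span xy K.≈ z
    span-surjective = injective⇒surjective
      (≡.subst (HasCardinality K.setoid) (≡.cong (q ℕ.*_) (ℕ.*-identityʳ q)) K.cardinality)
      {T = setoid ×ₛ setoid} (card-× cardinality cardinality) span span-injective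

  module _ (s t : Carrier) (θ²≈ : span (s , t) K.≈ θ K.* θ) where

    private
      -- θ and σ θ are the roots of X² - t X - s; `ν` is its discriminant and `Θ` the difference of
      -- the roots.
      ν : Carrier
      ν = t * t + (1# + 1#) * (1# + 1#) * s

      Θ : K.Carrier
      Θ = θ K.- σ θ

      σθ²≈ : ι s K.+ ι t K.* σ θ K.≈ σ θ K.* σ θ
      σθ²≈ = K.trans (K.sym (σ-span s t)) (K.trans (σ.⟦⟧-cong θ²≈) (σ.*-homo θ θ))

      -- Subtracting the quadratic relations of θ and σ θ leaves (θ - σ θ)(θ + σ θ - t) = 0.
      trace : θ K.+ σ θ K.≈ ι t
      trace = LK.x-y≈0⇒x≈y (PK.x*y≈0⇒y≈0 θ-σθ≉0 (LK.lc₂ (K.- K.1#) K.1# θ²≈ σθ²≈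
        (SK.solve 4 (λ s t θ τ → (θ ⊝ τ) ⊛ (θ ⊕ τ ⊝ t) ⊝ con′ (+ 0) ≔
          ⊝ con′ (+ 1) ⊛ (s ⊕ t ⊛ θ ⊝ θ ⊛ θ) ⊕ con′ (+ 1) ⊛ (s ⊕ t ⊛ τ ⊝ τ ⊛ τ)) K.refl (ι s) (ι t) θ (σ θ))))

      σtrace : σ θ K.+ σ (σ θ) K.≈ ι t
      σtrace = K.trans (K.sym (σ.+-homo θ (σ θ))) (K.trans (σ.⟦⟧-cong trace) (σ-fixes t))

      -- Both θ + σ θ and its conjugate equal t, whence σ (σ θ) = θ: conjugation exchanges the two
      -- roots.
      σΘ≈-Θ : σ Θ K.≈ K.- Θ
      σΘ≈-Θ = K.trans (σ-homo-- θ (σ θ)) (LK.lc₂ K.1# (K.- K.1#) trace σtrace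
        (SK.solve 4 (λ θ τ υ t → τ ⊝ υ ⊝ ⊝ (θ ⊝ τ) ≔
          con′ (+ 1) ⊛ (θ ⊕ τ ⊝ t) ⊕ ⊝ con′ (+ 1) ⊛ (τ ⊕ υ ⊝ t)) K.refl θ (σ θ) (σ (σ θ)) (ι t)))

      ιν≈ : ι ν K.≈ ι t K.* ι t K.+ (K.1# K.+ K.1#) K.* (K.1# K.+ K.1#) K.* ι s
      ιν≈ = K.trans (ι.+-homo _ _) (K.+-cong (ι.*-homo t t) (K.trans (ι.*-homo _ s)
        (K.*-congʳ (K.trans (ι.*-homo _ _) (K.*-cong ι-2 ι-2)))))

      Θ²≈ : Θ K.* Θ K.≈ ι ν
      Θ²≈ = K.trans (LK.lc₂ (ι t K.+ σ θ K.- (θ K.+ (θ K.+ θ))) (K.- (K.1# K.+ K.1#) K.* (K.1# K.+ K.1#)) trace θ²≈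
        (SK.solve 4 (λ s t θ τ → let I = con′ (+ 1); two = I ⊕ I in
          (θ ⊝ τ) ⊛ (θ ⊝ τ) ⊝ (t ⊛ t ⊕ two ⊛ two ⊛ s) ≔
            (t ⊕ τ ⊝ (θ ⊕ (θ ⊕ θ))) ⊛ (θ ⊕ τ ⊝ t) ⊕ ⊝ two ⊛ two ⊛ (s ⊕ t ⊛ θ ⊝ θ ⊛ θ)) K.refl
          (ι s) (ι t) θ (σ θ))) (K.sym ιν≈)

      -- A square root r of `ν` in F would give Θ = ± r, fixed by σ; being also negated by σ, Θ
      -- would satisfy 2Θ = 0.
      ν-nonsquare : NonSquare ν
      ν-nonsquare (r , r²≈ν) = 2≉0ᴷ (PK.x*y≈0⇒x≈0 θ-σθ≉0 2Θ≈0)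
        where
        fixed : σ Θ K.≈ Θ
        fixed = [ (λ Θ≈ιr → K.trans (σ.⟦⟧-cong Θ≈ιr) (K.trans (σ-fixes r) (K.sym Θ≈ιr)))
                , (λ Θ≈-ιr → let Θ≈ι-r = K.trans Θ≈-ιr (K.sym (ι.-‿homo r)) in
                    K.trans (σ.⟦⟧-cong Θ≈ι-r) (K.trans (σ-fixes (- r)) (K.sym Θ≈ι-r)))
                ]′ (PK.x*x≈y*y⇒x≈±y (K.trans Θ²≈ (K.trans (ι.⟦⟧-cong (sym r²≈ν)) (ι.*-homo r r))))
        2Θ≈0 : (K.1# K.+ K.1#) K.* Θ K.≈ K.0#
        2Θ≈0 = LK.lc₂ (K.- K.1#) K.1# fixed σΘ≈-Θ (SK.solve 2 (λ Θ Ψ → let I = con′ (+ 1) in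
          (I ⊕ I) ⊛ Θ ⊝ con′ (+ 0) ≔ ⊝ I ⊛ (Ψ ⊝ Θ) ⊕ I ⊛ (Ψ ⊝ ⊝ Θ)) K.refl Θ (σ Θ))

    imaginary-sqrt-from : ∀ {D} → NonSquare D → ∃ λ Ψ → Ψ K.* Ψ K.≈ ι D × σ Ψ K.≈ K.- Ψ
    imaginary-sqrt-from {D} D-nonsquare =
      let x , νx²≈D = nonSquare*nonSquare 2≉0 ν D ν-nonsquare D-nonsquare in
        Θ K.* ι x
      , K.trans (SK.solve 2 (λ Θ x → Θ ⊛ x ⊛ (Θ ⊛ x) ≔ Θ ⊛ Θ ⊛ (x ⊛ x)) K.refl Θ (ι x))
          (K.trans (K.*-cong Θ²≈ (K.sym (ι.*-homo x x))) (K.trans (K.sym (ι.*-homo ν (x * x))) (ι.⟦⟧-cong νx²≈D)))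
      , K.trans (σ.*-homo Θ (ι x)) (K.trans (K.*-cong σΘ≈-Θ (σ-fixes x))
          (SK.solve 2 (λ Θ x → ⊝ Θ ⊛ x ≔ ⊝ (Θ ⊛ x)) K.refl Θ (ι x)))

  -- K has an element Θ = θ − σ θ with σ Θ = − Θ, and ν = Θ² is a nonsquare of F;
  -- every other nonsquare is ν times a square.
  imaginary-sqrt : ∀ {D} → NonSquare D → ∃ λ Ψ → Ψ K.* Ψ K.≈ ι D × σ Ψ K.≈ K.- Ψ
  imaginary-sqrt = let (s , t) , θ²≈ = span-surjective (θ K.* θ) in imaginary-sqrt-from s t θ²≈

  ι-form : ∀ a b c d → map ι (form a b c d) ≋ᴷ FK.form (ι a) (ι b) (ι c) (ι d)
  ι-form a b c d = QK.≋6 K.refl ι.0#-homo K.refl (ι.*-homo δ c) K.refl K.refl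

  -- If r² = d² - 4δ, then (d + r)/2 is a root of X² - dX + δ.
  ¬Splits⇒nonsquare : ∀ {d} → ¬ Splits d → NonSquare (- Δ d)
  ¬Splits⇒nonsquare {d} ¬splits (r , r²≈) = ¬splits ((d + r) * ½ ,
    lc₂ (- (½ * ½)) (δ * ((1# + 1#) * ½ + 1#) - ½ * (d * (d + r))) r²≈ (*-inv 2≉0)
      (solve 4 (λ d r h δ → let I = con (+ 1); two = I :+ I in
        (d :+ r) :* h :* (d :- (d :+ r) :* h) :- δ :=
        :- (h :* h) :* (r :* r :- :- (two :* two :* δ :- d :* d))
        :+ (δ :* (two :* h :+ I) :- h :* (d :* (d :+ r))) :* (two :* h :- I)) refl d r ½ δ))
    where ½ = inv (1# + 1#)

  ι-Δ : ∀ d → ι (Δ d) K.≈ (K.1# K.+ K.1#) K.* (K.1# K.+ K.1#) K.* ι δ K.- ι d K.* ι d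
  ι-Δ d = K.trans (ι-homo-- _ _) (K.+-cong
    (K.trans (ι.*-homo _ _) (K.*-congʳ (K.trans (ι.*-homo _ _) (K.*-cong ι-2 ι-2))))
    (K.-‿cong (ι.*-homo d d)))

  -- The conic form (a₀ b d) b 1 d is the product of the line (u τ, u, 1) and its
  -- conjugate (− v τ, v, 1).
  module Factors {b d : Carrier} {Ψ : K.Carrier}
    (Ψ²≈ : Ψ K.* Ψ K.≈ ι (- Δ d)) (σΨ≈ : σ Ψ K.≈ K.- Ψ) where

    private
      -- The X₀X₂ coefficient demands Ψ τ = b; as Ψ² = - `Δ d`, this means τ = g Ψ with g in F.
      g = - (b * inv (Δ d))
      h = ι (inv (1# + 1#))
      δ′ = ι δ
      D = ι d
      G = ι g
      N = ι (- Δ d)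
      two = K.1# K.+ K.1#

      2h≈1 : two K.* h K.≈ K.1#
      2h≈1 = K.trans (K.*-congʳ (K.sym ι-2)) (K.trans (K.sym (ι.*-homo _ _)) (K.trans (ι.⟦⟧-cong (*-inv 2≉0)) ι.1#-homo))

      GN≈ : G K.* N K.≈ ι b
      GN≈ = K.trans (K.sym (ι.*-homo g (- Δ d))) (ι.⟦⟧-cong (lc₁ b (*-inv (Δ≉0 d))
        (solve 3 (λ b D i → :- (b :* i) :* :- D :- b := b :* (D :* i :- con (+ 1))) refl b (Δ d) (inv (Δ d)))))

      N≈ : N K.≈ K.- (two K.* two K.* δ′ K.- D K.* D)
      N≈ = K.trans (ι.-‿homo (Δ d)) (K.-‿cong (ι-Δ d))

    -- u and v are the roots (d ± Ψ)/2 of X² - dX + δ, exchanged by σ; τ is negated by σ.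
    u v τ : K.Carrier
    u = h K.* (D K.+ Ψ)
    v = h K.* (D K.- Ψ)
    τ = G K.* Ψ

    uv≈δ : u K.* v K.≈ δ′
    uv≈δ = LK.lc₂ (K.- (h K.* h)) (δ′ K.* (two K.* h K.+ K.1#)) (K.trans Ψ²≈ N≈) 2h≈1
      (SK.solve 4 (λ D Ψ h δ → let I = con′ (+ 1); two = I ⊕ I in
        h ⊛ (D ⊕ Ψ) ⊛ (h ⊛ (D ⊝ Ψ)) ⊝ δ ≔
        ⊝ (h ⊛ h) ⊛ (Ψ ⊛ Ψ ⊝ ⊝ (two ⊛ two ⊛ δ ⊝ D ⊛ D)) ⊕ δ ⊛ (two ⊛ h ⊕ I) ⊛ (two ⊛ h ⊝ I)) K.refl D Ψ h δ′)

    σu≈v : σ u K.≈ v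
    σu≈v = K.trans (σ.*-homo _ _) (K.*-cong (σ-fixes _) (K.trans (σ.+-homo _ _) (K.+-cong (σ-fixes d) σΨ≈)))

    στ≈-τ : σ τ K.≈ K.- τ
    στ≈-τ = K.trans (σ.*-homo _ _) (K.trans (K.*-cong (σ-fixes g) σΨ≈)
      (SK.solve 2 (λ G Ψ → G ⊛ ⊝ Ψ ≔ ⊝ (G ⊛ Ψ)) K.refl G Ψ))

    u-v≈Ψ : u K.- v K.≈ Ψ
    u-v≈Ψ = LK.lc₁ Ψ 2h≈1 (SK.solve 3 (λ D Ψ h → let I = con′ (+ 1) in
      h ⊛ (D ⊕ Ψ) ⊝ h ⊛ (D ⊝ Ψ) ⊝ Ψ ≔ Ψ ⊛ ((I ⊕ I) ⊛ h ⊝ I)) K.refl D Ψ h)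

    Ψ≉0 : ¬ (Ψ K.≈ K.0#)
    Ψ≉0 Ψ≈0 = Δ≉0 d (lc₁ (- 1#) (ι≈0⇒≈0 (K.trans (K.sym Ψ²≈) (K.trans (K.*-congʳ Ψ≈0) (K.zeroˡ Ψ))))
      (solve 1 (λ D → D :- con (+ 0) := :- con (+ 1) :* (:- D :- con (+ 0))) refl (Δ d)))

    splitForm≋ : FK.splitForm u v τ ≋ᴷ map ι (form (a₀ b d) b 1# d)
    splitForm≋ i = K.trans (FK.form-cong
        -- The X₀² coefficient is - δ τ² = - δ g² Ψ² = - δ g b, the image of `a₀ b d`.
        (K.trans (LK.lc₂ (K.- (δ′ K.* (G K.* G))) (K.- (δ′ K.* G)) Ψ²≈ GN≈
          (SK.solve 5 (λ G Ψ N B δ → ⊝ (δ ⊛ (G ⊛ Ψ ⊛ (G ⊛ Ψ))) ⊝ ⊝ (δ ⊛ (G ⊛ B)) ≔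
            ⊝ (δ ⊛ (G ⊛ G)) ⊛ (Ψ ⊛ Ψ ⊝ N) ⊕ ⊝ (δ ⊛ G) ⊛ (G ⊛ N ⊝ B)) K.refl G Ψ N (ι b) δ′))
          (K.sym ιa₀≈))
        (LK.lc₃ (two K.* h K.* G) (two K.* h) (ι b) Ψ²≈ GN≈ 2h≈1
          (SK.solve 6 (λ G Ψ N B D h → let I = con′ (+ 1); two = I ⊕ I in
            (h ⊛ (D ⊕ Ψ) ⊝ h ⊛ (D ⊝ Ψ)) ⊛ (G ⊛ Ψ) ⊝ B ≔
            two ⊛ h ⊛ G ⊛ (Ψ ⊛ Ψ ⊝ N) ⊕ two ⊛ h ⊛ (G ⊛ N ⊝ B) ⊕ B ⊛ (two ⊛ h ⊝ I)) K.refl G Ψ N (ι b) D h))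
        (K.sym ι.1#-homo)
        (LK.lc₁ D 2h≈1 (SK.solve 3 (λ D Ψ h → let I = con′ (+ 1) in
          h ⊛ (D ⊕ Ψ) ⊕ h ⊛ (D ⊝ Ψ) ⊝ D ≔ D ⊛ ((I ⊕ I) ⊛ h ⊝ I)) K.refl D Ψ h)) i)
      (K.sym (ι-form (a₀ b d) b 1# d i))
      where
      ιa₀≈ : ι (a₀ b d) K.≈ K.- (δ′ K.* (G K.* ι b))
      ιa₀≈ = K.trans
        (ι.⟦⟧-cong (solve 3 (λ δ b i → δ :* (b :* b) :* i := :- (δ :* (:- (b :* i) :* b))) refl δ b (inv (Δ d))))
        (K.trans (ι.-‿homo _) (K.-‿cong (K.trans (ι.*-homo _ _) (K.*-congˡ (ι.*-homo _ _)))))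

    line : GK.Point 2
    line = record { coords = u K.* τ ∷ u ∷ K.1# ∷ [] ; nonzero = FK.nonzero-at 2F (FK.≈1⇒≉0 K.refl) }

    conjugate : Vector K.Carrier 3
    conjugate = map σ (GK.coords line)

    conjugate≋ : conjugate ≋ᴷ (K.- (v K.* τ) ∷ v ∷ K.1# ∷ [])
    conjugate≋ = QK.≋3
      (K.trans (σ.*-homo _ _) (K.trans (K.*-cong σu≈v στ≈-τ) (SK.solve 2 (λ v τ → v ⊛ ⊝ τ ≔ ⊝ (v ⊛ τ)) K.refl v τ)))
      σu≈v σ.1#-homo

    line≁conjugate : ¬ (GK.coords line ∼ᴷ conjugate)
    line≁conjugate l∼l̄ = Ψ≉0 (K.trans (K.sym u-v≈Ψ) (LK.x≈y⇒x-y≈0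
      (K.trans (FK.∼⇒≋ 2F l∼l̄ K.refl σ.1#-homo 1F) σu≈v)))

    form∼ : map ι (form (a₀ b d) b 1# d) ∼ᴷ (GK.coords line ·ₗᴷ conjugate)
    form∼ = GK.∼-sym (GK.∼-trans
      (FK.scale-∼ {k = K.1# K.* K.1#} {GK.coords line ·ₗᴷ conjugate} (FK.≈1⇒≉0 (K.*-identityˡ K.1#))
        (FK.lines⇒splitForm {GK.coords line} {conjugate} uv≈δ
          (QK.≋3 (K.sym (K.*-identityˡ _)) (K.sym (K.*-identityˡ _)) K.refl)
          (QK.≋3 (K.trans (conjugate≋ 0F) (K.-‿cong (K.sym (K.*-identityˡ _))))
            (K.trans (conjugate≋ 1F) (K.sym (K.*-identityˡ _))) (conjugate≋ 2F))))
      (FK.≋⇒∼ splitForm≋))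

  -- The sum d stands for the conjugate pair of roots, so no root is singled out, and b replaces the
  -- multiplier τ, which in general is not in F.
  Parameters : Setoid _ _
  Parameters = Sub setoid (¬_ ∘ Splits) ×ₛ setoid
  private module P = Setoid Parameters

  point : P.Carrier → Point 5
  point ((d , _) , b) = record { coords = form (a₀ b d) b 1# d ; nonzero = nonzero-at 5F (≈1⇒≉0 refl) }

  point-imaginary : ∀ p → 𝓗₂,ᵢ X (point p)
  point-imaginary ((d , ¬splits) , b) =
    let Ψ , Ψ²≈ , σΨ≈ = imaginary-sqrt (¬Splits⇒nonsquare ¬splits)
        open Factors {b} {d} Ψ²≈ σΨ≈
    in line , line≁conjugate , form∼

  ι-∼ : ∀ {v w : Vector Carrier 6} → v ∼ w → map ι v ∼ᴷ map ι w
  ι-∼ (k , k≉0 , v≋kw) = ι k , (k≉0 ∘ ι≈0⇒≈0) , λ i → K.trans (ι.⟦⟧-cong (v≋kw i)) (ι.*-homo k _)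

  ι-standard : ∀ {v} → IsStandard v → FK.IsStandard (map ι v)
  ι-standard (v₁≈0 , v₃≈) = K.trans (ι.⟦⟧-cong v₁≈0) ι.0#-homo , K.trans (ι.⟦⟧-cong v₃≈) (ι.*-homo δ _)

  δ′≉0 : ¬ (ι δ K.≈ K.0#)
  δ′≉0 = δ≉0 ∘ ι≈0⇒≈0

  module _ (l : GK.Point 2) where
    private
      l̄ = map σ (GK.coords l)
      l₀ = GK.coords l 0F
      l₁ = GK.coords l 1F
      l₂ = GK.coords l 2F

    module _ (l≁l̄ : ¬ (GK.coords l ∼ᴷ l̄)) (std : FK.IsStandard (GK.coords l ·ₗᴷ l̄)) where

      -- If l₂ = 0, the X₁² coefficient gives l₁ σ(l₁) = 0, so l₁ = 0 and the line is X₀ up to a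
      -- scalar, proportional to its conjugate. Hence no imaginary pair has c = 0.
      l₂≉0 : ¬ (l₂ K.≈ K.0#)
      l₂≉0 l₂≈0 = l≁l̄ (FK.scale-∼ (PK.*-≉0 l₀≉0 (PK.inv-≉0 σl₀≉0)) (QK.≋3
          (LK.lc₁ (K.- l₀) (PK.*-inv σl₀≉0) (SK.solve 3 (λ x y i → x ⊝ x ⊛ i ⊛ y ≔ ⊝ x ⊛ (y ⊛ i ⊝ con′ (+ 1))) K.refl l₀ (σ l₀) (PK.inv (σ l₀))))
          (vanishing l₁≈0) (vanishing l₂≈0)))
        where
        l₁≈0 : l₁ K.≈ K.0#
        l₁≈0 = cases (l₁ PK.≟ K.0#)
          where
          cases : Dec (l₁ K.≈ K.0#) → l₁ K.≈ K.0#
          cases (yes l₁≈0) = l₁≈0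
          cases (no  l₁≉0) = σ≈0⇒≈0 (PK.x*y≈0⇒y≈0 l₁≉0 (K.trans (proj₂ std)
            (K.trans (K.*-congˡ (K.trans (K.*-congʳ l₂≈0) (K.zeroˡ _))) (K.zeroʳ _))))
        l₀≉0 : ¬ (l₀ K.≈ K.0#)
        l₀≉0 l₀≈0 = GK.nonzero l (QK.≋3 l₀≈0 l₁≈0 l₂≈0)
        σl₀≉0 : ¬ (σ l₀ K.≈ K.0#)
        σl₀≉0 = l₀≉0 ∘ σ≈0⇒≈0
        vanishing : ∀ {x k} → x K.≈ K.0# → x K.≈ k K.* σ x
        vanishing x≈0 = K.trans x≈0 (K.sym (K.trans (K.*-congˡ (K.trans (σ.⟦⟧-cong x≈0) σ.0#-homo)) (K.zeroʳ _)))

      private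
        σl₂≉0 : ¬ (σ l₂ K.≈ K.0#)
        σl₂≉0 = l₂≉0 ∘ σ≈0⇒≈0
        u = l₁ K.* PK.inv l₂
        v = σ l₁ K.* PK.inv (σ l₂)

        σu≈v : σ u K.≈ v
        σu≈v = K.trans (σ.*-homo _ _) (K.*-congˡ (PK.inv-unique
          (K.trans (K.sym (σ.*-homo _ _)) (K.trans (σ.⟦⟧-cong (PK.*-inv l₂≉0)) σ.1#-homo))))

      imaginary-factor : ∃₂ λ u v → ∃ λ t → σ u K.≈ v × u K.* v K.≈ ι δ × (GK.coords l ·ₗᴷ l̄) ∼ᴷ FK.splitForm u v t
      imaginary-factor = let t , uv≈δ , ll̄∼ = FK.factor δ′≉0 (GK.coords l) l̄ std l₂≉0 σl₂≉0 in u , v , t , σu≈v , uv≈δ , ll̄∼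

  module _ {a b d : Carrier} {u v t : K.Carrier} (σu≈v : σ u K.≈ v) (uv≈δ : u K.* v K.≈ ι δ)
           (form≋ : map ι (form a b 1# d) ≋ᴷ FK.splitForm u v t) where

    -- With u v = δ one has 4δ - (u + v)² = - (u - v)², so a · `Δ d` = δ t² (u - v)² = δ b².
    imaginary⇒≈a₀ : a ≈ a₀ b d
    imaginary⇒≈a₀ = *-cancelˡ (Δ≉0 d) (trans (*-comm _ _) (trans (ι.injective ιaΔ≈) (trans (sym (a₀*Δ b d)) (*-comm _ _))))
      where
      ιaΔ≈ : ι (a * Δ d) K.≈ ι (δ * (b * b))
      ιaΔ≈ = K.trans (K.trans (ι.*-homo _ _) (K.*-cong (form≋ 0F) (K.trans (ι-Δ d) (K.+-congˡ (K.-‿cong (K.*-cong (form≋ 4F) (form≋ 4F)))))))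
        (K.trans (LK.lc₁ (ι δ K.* (t K.* t) K.* (K.1# K.+ K.1#) K.* (K.1# K.+ K.1#)) uv≈δ
          (SK.solve 4 (λ u v t δ → let two = con′ (+ 1) ⊕ con′ (+ 1) in
            ⊝ (δ ⊛ (t ⊛ t)) ⊛ (two ⊛ two ⊛ δ ⊝ (u ⊕ v) ⊛ (u ⊕ v)) ⊝ δ ⊛ ((u ⊝ v) ⊛ t ⊛ ((u ⊝ v) ⊛ t))
            ≔ δ ⊛ (t ⊛ t) ⊛ two ⊛ two ⊛ (u ⊛ v ⊝ δ)) K.refl u v t (ι δ)))
        (K.sym (K.trans (ι.*-homo _ _) (K.*-congˡ (K.trans (ι.*-homo _ _) (K.*-cong (form≋ 2F) (form≋ 2F)))))))

    -- u is a root of X² - dX + δ. If F contained a root, both roots and hence u would lie in F;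
    -- then v = σ u = u and u² = δ.
    imaginary⇒¬Splits : ¬ Splits d
    imaginary⇒¬Splits (w , w[d-w]≈δ) = [ rational , rational ]′ (root (u PK.≟ ι w))
      where
      rational : ∀ {z} → ¬ (u K.≈ ι z)
      rational {z} u≈ιz = δ-nonsquare (z , ι.injective (K.trans (ι.*-homo z z)
        (K.trans (K.*-cong (K.sym u≈ιz) (K.trans (K.sym (σ-fixes z)) (K.trans (σ.⟦⟧-cong (K.sym u≈ιz)) σu≈v))) uv≈δ)))
      ιw[d-w]≈ : ι w K.* (ι d K.- ι w) K.≈ ι δ
      ιw[d-w]≈ = K.trans (K.*-congˡ (K.sym (ι-homo-- d w))) (K.trans (K.sym (ι.*-homo _ _)) (ι.⟦⟧-cong w[d-w]≈δ))
      root : Dec (u K.≈ ι w) → u K.≈ ι w ⊎ u K.≈ ι (d - w)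
      root (yes u≈w) = inj₁ u≈w
      root (no  u≉w) = inj₂ (K.trans (LK.x-y≈0⇒x≈y (PK.x*y≈0⇒y≈0 (u≉w ∘ LK.x-y≈0⇒x≈y)
        (LK.lc₃ (K.- u) (K.- K.1#) K.1# (form≋ 4F) uv≈δ ιw[d-w]≈
          (SK.solve 5 (λ u v w D δ → (u ⊝ w) ⊛ (u ⊝ (D ⊝ w)) ⊝ con′ (+ 0) ≔
            ⊝ u ⊛ (D ⊝ (u ⊕ v)) ⊕ ⊝ con′ (+ 1) ⊛ (u ⊛ v ⊝ δ) ⊕ con′ (+ 1) ⊛ (w ⊛ (D ⊝ w) ⊝ δ)) K.refl u v (ι w) (ι d) (ι δ)))))
        (K.sym (ι-homo-- d w)))

  cover : ∀ H → 𝓗₂,ᵢ X H → IsStandard (coords H) → ∃ λ p → coords (point p) ∼ coords H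
  cover H (l , l≁l̄ , ιH∼) std =
    let u , v , t , σu≈v , uv≈δ , ll̄∼ = imaginary-factor l l≁l̄ (FK.standard-resp-∼ ιH∼ (ι-standard {coords H} std))
        ιH∼split = GK.∼-trans ιH∼ ll̄∼
        h₅≉0 = λ h₅≈0 → K.0≉1 (K.sym (FK.∼-≈0 5F (GK.∼-sym ιH∼split) (K.trans (ι.⟦⟧-cong h₅≈0) ι.0#-homo)))
        H∼ = standardise std h₅≉0
        form≋ = FK.∼⇒≋ 5F (GK.∼-trans (GK.∼-sym (ι-∼ H∼)) ιH∼split) ι.1#-homo K.refl
    in ((_ , imaginary⇒¬Splits σu≈v uv≈δ form≋) , _) ,
       ∼-trans (≋⇒∼ (form-cong (sym (imaginary⇒≈a₀ σu≈v uv≈δ form≋)) refl refl refl)) (∼-sym H∼)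

  card-𝓗₂,ᵢ : ∀ {n} → HasCardinality (Sub setoid (¬_ ∘ Splits)) n →
    HasCardinality (StandardHyperplanes (𝓗₂,ᵢ X)) (n ℕ.* q)
  card-𝓗₂,ᵢ N = card-bijection (card-× N cardinality)
    (λ p → point p , point-imaginary p , refl , refl)
    (λ { (d≈ , b≈) → ≋⇒∼ (form-cong (a₀-cong b≈ d≈) b≈ refl d≈) })
    (λ v∼w → let v≋w = ∼⇒≋ 5F v∼w refl refl in v≋w 4F , v≋w 2F)
    λ { (H , imag , std) → cover H imag std }

-- Invariance of the conic types under substitution

module PullBack {c ℓ q} (F : FiniteField c ℓ q) where
  open FiniteField F
  open Geometry F using (Point; coords; nonzero; _≋_; _∼_; _·ₗ_; 𝓗₁; 𝓗₂,ᵣ; 𝓗₃; Hyperplane)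
  open QuadraticForms commutativeRing

  module _ {A B : Matrix} (AB≈1 : A *ₘ B ≈ₘ 1ₘ) where

    pullPoint : Point 5 → Point 5
    pullPoint H = record
      { coords  = pull A (coords H)
      ; nonzero = nonzero H ∘ pull-reflects-≋0 {A} {B} AB≈1
      }

    lineImage : Point 2 → Point 2
    lineImage l = record
      { coords  = coords l ᵥ* A
      ; nonzero = nonzero l ∘ ᵥ*-reflects-≋0 {A} {B} AB≈1
      }

    ᵥ*-∼-cancel : ∀ {l m} → (l ᵥ* A) ∼ (m ᵥ* A) → l ∼ m
    ᵥ*-∼-cancel {l} {m} (k , k≉0 , lA≋kmA) = k , k≉0 , λ i →
      trans (sym (ᵥ*-inverse {A} {B} AB≈1 l i)) (trans (ᵥ*-cong {l ᵥ* A} {map (k *_) (m ᵥ* A)} {B} {B} lA≋kmA (λ _ _ → refl) i)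
        (trans (ᵥ*-scale k (m ᵥ* A) B i) (*-congˡ (ᵥ*-inverse {A} {B} AB≈1 m i))))

  pull-∼ : ∀ A {v w} → v ∼ w → pull A v ∼ pull A w
  pull-∼ A {v} {w} (k , k≉0 , v≋kw) = k , k≉0 , λ i →
    trans (pull-cong {A} {A} {v} {map (k *_) w} (λ _ _ → refl) v≋kw i) (pull-scale A k w i)

  pull-∼-·ₗ : ∀ A {v} l m → v ∼ (l ·ₗ m) → pull A v ∼ ((l ᵥ* A) ·ₗ (m ᵥ* A))
  pull-∼-·ₗ A {v} l m v∼ = let k , k≉0 , eq = pull-∼ A {v} {l ·ₗ m} v∼ in
    k , k≉0 , λ i → trans (eq i) (*-congˡ (pull-·ₗ A l m i))

  -- One implication suffices: the converse is the same statement for the inverse matrix.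
  PullInvariant : ∀ {p} → (Hyperplane → Set p) → Set (c ⊔ ℓ ⊔ p)
  PullInvariant 𝓗 = ∀ A B (AB≈1 : A *ₘ B ≈ₘ 1ₘ) H → 𝓗 H → 𝓗 (pullPoint {A} {B} AB≈1 H)

  𝓗₁-invariant : PullInvariant 𝓗₁
  𝓗₁-invariant A B AB≈1 H (l , H∼) =
    lineImage {A} {B} AB≈1 l , pull-∼-·ₗ A {coords H} (coords l) (coords l) H∼

  𝓗₂,ᵣ-invariant : PullInvariant 𝓗₂,ᵣ
  𝓗₂,ᵣ-invariant A B AB≈1 H (l , m , l≁m , H∼) =
      lineImage {A} {B} AB≈1 l , lineImage {A} {B} AB≈1 m
    , l≁m ∘ ᵥ*-∼-cancel {A} {B} AB≈1 {coords l} {coords m}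
    , pull-∼-·ₗ A {coords H} (coords l) (coords m) H∼

  -- The multiplication rule is applied to `B`: the discriminant of H is det(B)² times that of its
  -- pull-back, so its vanishing carries over without dividing by det(A).
  𝓗₃-invariant : PullInvariant 𝓗₃
  𝓗₃-invariant A B AB≈1 H disc≉0 disc-pull≈0 = disc≉0
    (trans (discriminant-cong {coords H} {pull B (pull A (coords H))} (λ i → sym (pull-inverse {A} {B} AB≈1 (coords H) i)))
      (trans (discriminant-pull B (pull A (coords H))) (trans (*-congˡ disc-pull≈0) (zeroʳ _))))

-- Invariance of conjugate imaginary pairs

module ImaginaryPullBack {c ℓ q c′ ℓ′} (F : FiniteField c ℓ q) (X : QuadraticExtension F c′ ℓ′) where
  open FiniteField F
  open Geometry F using (coords; 𝓗₂,ᵢ)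
  open QuadraticForms commutativeRing
  open PullBack F
  open QuadraticExtension X using (E; ι; σ; ι-mono; σ-iso; σ-fixes)
  private
    module K = FiniteField E
    module GK = Geometry E
    module QK = QuadraticForms K.commutativeRing
    module PK = PullBack E
    module ι = RingMorphisms.IsRingMonomorphism ι-mono
    module σ = RingMorphisms.IsRingIsomorphism σ-iso

  infix 8 _ᶥ
  _ᶥ : Matrix → QK.Matrix
  (A ᶥ) i j = ι (A i j)

  private
    +-homo₂ : ∀ {x y x′ y′} → ι x K.≈ x′ → ι y K.≈ y′ → ι (x + y) K.≈ x′ K.+ y′
    +-homo₂ x≈ y≈ = K.trans (ι.+-homo _ _) (K.+-cong x≈ y≈)

  ι-quad : ∀ a v → ι (quad a v) K.≈ QK.quad (map ι a) (map ι v)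
  ι-quad a v = +-homo₂ (+-homo₂ (+-homo₂ (+-homo₂ (+-homo₂ (term _ _ _) (term _ _ _)) (term _ _ _)) (term _ _ _))
      (term _ _ _)) (term _ _ _)
    where
    term : ∀ a x y → ι (a * (x * y)) K.≈ ι a K.* (ι x K.* ι y)
    term a x y = K.trans (ι.*-homo a _) (K.*-congˡ (ι.*-homo x y))

  ι-polar : ∀ a v w → ι (polar a v w) K.≈ QK.polar (map ι a) (map ι v) (map ι w)
  ι-polar a v w = +-homo₂ (+-homo₂ (+-homo₂ (+-homo₂ (+-homo₂ (term _ _ _ _ _) (term _ _ _ _ _)) (term _ _ _ _ _))
      (term _ _ _ _ _)) (term _ _ _ _ _)) (term _ _ _ _ _)
    where
    term : ∀ a x y z w → ι (a * (x * y + z * w)) K.≈ ι a K.* (ι x K.* ι y K.+ ι z K.* ι w)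
    term a x y z w = K.trans (ι.*-homo a _) (K.*-congˡ (+-homo₂ (ι.*-homo x y) (ι.*-homo z w)))

  ι-pull : ∀ A a i → ι (pull A a i) K.≈ QK.pull (A ᶥ) (map ι a) i
  ι-pull A a = QK.≋6 (ι-quad a (col A 0F)) (ι-polar a (col A 0F) (col A 1F)) (ι-polar a (col A 0F) (col A 2F))
    (ι-quad a (col A 1F)) (ι-polar a (col A 1F) (col A 2F)) (ι-quad a (col A 2F))

  ι-*ₘ : ∀ A B → (A ᶥ) QK.*ₘ (B ᶥ) QK.≈ₘ ((A *ₘ B) ᶥ)
  ι-*ₘ A B i j = K.sym (K.trans (ι.+-homo _ _) (K.+-cong (ι.*-homo _ _)
    (K.trans (ι.+-homo _ _) (K.+-cong (ι.*-homo _ _)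
      (K.trans (ι.+-homo _ _) (K.+-cong (ι.*-homo _ _) ι.0#-homo))))))

  ι-1ₘ : ∀ i j → ι (1ₘ i j) K.≈ QK.1ₘ i j
  ι-1ₘ i j = cases (does (i Fin.≟ j))
    where
    cases : ∀ b → ι (if b then 1# else 0#) K.≈ (if b then K.1# else K.0#)
    cases true  = ι.1#-homo
    cases false = ι.0#-homo

  ι-inverse : ∀ {A B} → A *ₘ B ≈ₘ 1ₘ → (A ᶥ) QK.*ₘ (B ᶥ) QK.≈ₘ QK.1ₘ
  ι-inverse {A} {B} AB≈1 i j = K.trans (ι-*ₘ A B i j) (K.trans (ι.⟦⟧-cong (AB≈1 i j)) (ι-1ₘ i j))

  σ-ᵥ* : ∀ l A i → σ ((l QK.ᵥ* (A ᶥ)) i) K.≈ (map σ l QK.ᵥ* (A ᶥ)) i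
  σ-ᵥ* l A j = K.trans (σ.+-homo _ _) (K.+-cong (term 0F)
    (K.trans (σ.+-homo _ _) (K.+-cong (term 1F) (K.trans (σ.+-homo _ _) (K.+-cong (term 2F) σ.0#-homo)))))
    where
    term : ∀ k → σ (l k K.* ι (A k j)) K.≈ σ (l k) K.* ι (A k j)
    term k = K.trans (σ.*-homo _ _) (K.*-congˡ (σ-fixes _))

  -- The entries of `A` lie in F, so σ commutes with its action on lines: the image of the conjugate
  -- is the conjugate of the image.
  𝓗₂,ᵢ-invariant : PullInvariant (𝓗₂,ᵢ X)
  𝓗₂,ᵢ-invariant A B AB≈1 H (l , l≁l̄ , ιH∼) =
      PK.lineImage {A ᶥ} {B ᶥ} (ι-inverse {A} {B} AB≈1) l
    , (λ { (m , m≉0 , eq) → l≁l̄ (PK.ᵥ*-∼-cancel {A ᶥ} {B ᶥ} (ι-inverse {A} {B} AB≈1) {GK.coords l} {map σ (GK.coords l)}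
          (m , m≉0 , λ i → K.trans (eq i) (K.*-congˡ (σ-ᵥ* (GK.coords l) A i)))) })
    , (let k , k≉0 , eq = PK.pull-∼-·ₗ (A ᶥ) {map ι (coords H)} (GK.coords l) (map σ (GK.coords l)) ιH∼ in
       k , k≉0 , λ i → K.trans (ι-pull A (coords H) i) (K.trans (eq i) (K.*-congˡ
         (QK.·ₗ-congˡ (GK.coords l QK.ᵥ* A ᶥ) {map σ (GK.coords l) QK.ᵥ* A ᶥ} {map σ (GK.coords l QK.ᵥ* A ᶥ)}
           (λ j → K.sym (σ-ᵥ* (GK.coords l) A j)) i))))

-- Transport between L and the standard line

module Transport {c ℓ q} (F : FiniteField c ℓ q) (δ : FiniteField.Carrier F)
  (L : Geometry.Line F) (L∈o₁₃,₂ : Geometry._∈o₁₃,₂[_] F L δ) where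
  open FiniteField F
  open Geometry F using (Point; coords; nonzero; _≋_; ∼-sym; ∼-trans; Hyperplane; _⊆ₕ_; hyperplanesThrough)
  open QuadraticForms commutativeRing
  open IntegerSolver commutativeRing
  open LinearCombination commutativeRing
  open StandardForms F δ
  open PullBack F

  private
    A B : Matrix
    A = proj₁ L∈o₁₃,₂
    B = proj₁ (proj₁ (proj₂ L∈o₁₃,₂))

    AB≈1 : A *ₘ B ≈ₘ 1ₘ
    AB≈1 = proj₁ (proj₂ (proj₁ (proj₂ L∈o₁₃,₂)))

    BA≈1 : B *ₘ A ≈ₘ 1ₘ
    BA≈1 = proj₂ (proj₂ (proj₁ (proj₂ L∈o₁₃,₂)))

    pull-inverseᴬ : ∀ a → pull B (pull A a) ≋ a
    pull-inverseᴬ = pull-inverse {A} {B} AB≈1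

    pull-inverseᴮ : ∀ a → pull A (pull B a) ≋ a
    pull-inverseᴮ = pull-inverse {B} {A} BA≈1

  ⟨⟩-standard : ∀ {a} → IsStandard a → ∀ x y → ⟨ a , 0# ∷ x ∷ 0# ∷ y ∷ 0# ∷ - (δ * y) ∷ [] ⟩ ≈ 0#
  ⟨⟩-standard {a} (a₁≈0 , a₃≈δa₅) x y = lc₂ x y a₁≈0 a₃≈δa₅
    (solve 9 (λ a₀ a₁ a₂ a₃ a₄ a₅ x y δ → let O = con (+ 0) in
      a₀ :* O :+ (a₁ :* x :+ (a₂ :* O :+ (a₃ :* y :+ (a₄ :* O :+ (a₅ :* :- (δ :* y) :+ O))))) :- O
      := x :* (a₁ :- O) :+ y :* (a₃ :- δ :* a₅)) refl (a 0F) (a 1F) (a 2F) (a 3F) (a 4F) (a 5F) x y δ)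

  -- By adjointness, H pairs with A M Aᵀ as its pull-back pairs with M, and M runs over the standard
  -- line.
  standard⇒contains : ∀ H → IsStandard (pull A (coords H)) → L ⊆ₕ H
  standard⇒contains H std Q Q∈L =
    let P , (t , m , _ , P≋) , k , _ , Q≈ = Equivalence.to (proj₂ (proj₂ L∈o₁₃,₂) Q) Q∈L
        x = coords t 0F
        y = coords t 1F
        w = 0# ∷ x ∷ 0# ∷ y ∷ 0# ∷ - (δ * y) ∷ []
        h = coords H
    in trans (⟨⟩-cong h {coords Q} {map (k *_) (upperTriangle (transform A (coords P)))}
               (≋6 (Q≈ 0F 0F) (Q≈ 0F 1F) (Q≈ 0F 2F) (Q≈ 1F 1F) (Q≈ 1F 2F) (Q≈ 2F 2F)))
         (trans (⟨⟩-transform A h k (coords P))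
         (trans (*-congˡ (trans (⟨⟩-cong (pull A h) {coords P} {map (m *_) w} P≋)
           (trans (⟨⟩-scale (pull A h) m w) (trans (*-congˡ (⟨⟩-standard {pull A h} std x y)) (zeroʳ m)))))
         (zeroʳ k)))

  ⟨⟩-transform₁ : ∀ a y → ⟨ a , upperTriangle (transform A y) ⟩ ≈ ⟨ pull A a , y ⟩
  ⟨⟩-transform₁ a y = trans (sym (*-identityˡ _)) (trans (sym (⟨⟩-scale a 1# (upperTriangle (transform A y))))
    (trans (⟨⟩-transform A a 1# y) (*-identityˡ _)))

  -- Every `a` is the pull-back of `pull B a`, so if A M Aᵀ vanished, M would pair to 0 with every
  -- `a`.
  transform-nonzero : ∀ {y} → ¬ (y ≋ replicate 6 0#) → ¬ (upperTriangle (transform A y) ≋ replicate 6 0#)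
  transform-nonzero {y} y≉0 M≋0 = y≉0 (⟨⟩-nondegenerate λ a →
    trans (⟨⟩-congʳ {a} {pull A (pull B a)} y (λ i → sym (pull-inverseᴮ a i)))
    (trans (sym (⟨⟩-transform₁ (pull B a) y))
    (trans (⟨⟩-cong (pull B a) {M} {map (0# *_) M} (λ i → trans (M≋0 i) (sym (zeroˡ (M i)))))
    (trans (⟨⟩-scale (pull B a) 0# M) (zeroˡ _)))))
    where M = upperTriangle (transform A y)

  -- The images of the points (x, y) = (1, 0) and (0, 1) of the standard line already yield the two
  -- equations.
  contains⇒standard : ∀ H → L ⊆ₕ H → IsStandard (pull A (coords H))
  contains⇒standard H L⊆H =
      lc₁ 1# (trans (sym (row 1# 0#)) (vanishing (record { coords = 1# ∷ 0# ∷ [] ; nonzero = nonzero-at 0F (≈1⇒≉0 refl) })))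
        (solve 4 (λ a₁ a₃ a₅ δ → let I = con (+ 1); O = con (+ 0) in
          a₁ :- O := I :* (a₁ :* I :+ a₃ :* O :- a₅ :* (δ :* O) :- O)) refl (h 1F) (h 3F) (h 5F) δ)
    , lc₁ 1# (trans (sym (row 0# 1#)) (vanishing (record { coords = 0# ∷ 1# ∷ [] ; nonzero = nonzero-at 1F (≈1⇒≉0 refl) })))
        (solve 4 (λ a₁ a₃ a₅ δ → let I = con (+ 1); O = con (+ 0) in
          a₃ :- δ :* a₅ := I :* (a₁ :* O :+ a₃ :* I :- a₅ :* (δ :* I) :- O)) refl (h 1F) (h 3F) (h 5F) δ)
    where
    h = pull A (coords H)

    row : ∀ x y → ⟨ h , 0# ∷ x ∷ 0# ∷ y ∷ 0# ∷ - (δ * y) ∷ [] ⟩ ≈ h 1F * x + h 3F * y - h 5F * (δ * y)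
    row x y = solve 9 (λ a₀ a₁ a₂ a₃ a₄ a₅ x y δ → let O = con (+ 0) in
      a₀ :* O :+ (a₁ :* x :+ (a₂ :* O :+ (a₃ :* y :+ (a₄ :* O :+ (a₅ :* :- (δ :* y) :+ O)))))
      := a₁ :* x :+ a₃ :* y :- a₅ :* (δ :* y)) refl (h 0F) (h 1F) (h 2F) (h 3F) (h 4F) (h 5F) x y δ

    vanishing : (t : Point 1) → ⟨ h , 0# ∷ coords t 0F ∷ 0# ∷ coords t 1F ∷ 0# ∷ - (δ * coords t 1F) ∷ [] ⟩ ≈ 0#
    vanishing t = trans (sym (⟨⟩-transform₁ (coords H) w)) (L⊆H Q (Equivalence.from (proj₂ (proj₂ L∈o₁₃,₂) Q)
        (P , (t , ≋⇒∼ (λ _ → refl)) , 1# , ≈1⇒≉0 refl , λ i j → trans (symmetric i j) (sym (*-identityˡ _)))))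
      where
      w = 0# ∷ coords t 0F ∷ 0# ∷ coords t 1F ∷ 0# ∷ - (δ * coords t 1F) ∷ []
      P : Point 5
      P = record { coords = w ; nonzero = λ w≋0 → nonzero t λ { 0F → w≋0 1F ; 1F → w≋0 3F } }
      Q : Point 5
      Q = record { coords = upperTriangle (transform A w) ; nonzero = transform-nonzero {w} (nonzero P) }
      symmetric : ∀ i j → Geometry.symMatrix F (coords Q) i j ≈ transform A w i j
      symmetric 0F 0F = refl
      symmetric 0F 1F = refl
      symmetric 0F 2F = refl
      symmetric 1F 0F = transform-symmetric A w 0F 1F
      symmetric 1F 1F = refl
      symmetric 1F 2F = refl
      symmetric 2F 0F = transform-symmetric A w 0F 2F
      symmetric 2F 1F = transform-symmetric A w 1F 2F
      symmetric 2F 2F = refl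

  -- Pulling back by `B` carries standard hyperplanes to hyperplanes through L, and pulling back by
  -- `A` undoes it; invariance keeps the type in both directions.
  card-transport : ∀ {p n} {𝓗 : Hyperplane → Set p} → PullInvariant 𝓗 →
    HasCardinality (StandardHyperplanes 𝓗) n → HasCardinality (hyperplanesThrough L 𝓗) n
  card-transport {𝓗 = 𝓗} invariant N = card-bijection N
    (λ { (H , H∈𝓗 , std) → pullPoint {B} {A} BA≈1 H , invariant B A BA≈1 H H∈𝓗 ,
         standard⇒contains (pullPoint {B} {A} BA≈1 H)
           (standard-resp-∼ {coords H} {pull A (pull B (coords H))} (∼-sym (≋⇒∼ (pull-inverseᴮ (coords H)))) std) })
    (λ {H} {H′} → pull-∼ B {coords (proj₁ H)} {coords (proj₁ H′)})
    (λ {H} {H′} eq → ∼-trans (∼-sym (≋⇒∼ (pull-inverseᴮ (coords (proj₁ H)))))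
       (∼-trans (pull-∼ A {pull B (coords (proj₁ H))} {pull B (coords (proj₁ H′))} eq) (≋⇒∼ (pull-inverseᴮ (coords (proj₁ H′))))))
    λ { (H , H∈𝓗 , L⊆H) → (pullPoint {A} {B} AB≈1 H , invariant A B AB≈1 H H∈𝓗 , contains⇒standard H L⊆H)
         , ≋⇒∼ (pull-inverseᴬ (coords H)) }

private
  -- The floor division is exact: with q = 2k + 1, doubling the left side gives q² + 3q as
  -- polynomials in k.
  square-half : ∀ {q k} → q ≡ suc (k ℕ.+ k) → q ℕ.+ (q ℕ.+ k ℕ.* q) ≡ (q ℕ.^ 2 ℕ.+ 3 ℕ.* q) ℕ./ 2
  square-half {q} {k} ≡.refl = ≡.trans (≡.sym (ℕ.m*n/n≡m (q ℕ.+ (q ℕ.+ k ℕ.* q)) 2)) (≡.cong (ℕ._/ 2) (expand k))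
    where
    expand : ∀ k → let q = suc (k ℕ.+ k) in (q ℕ.+ (q ℕ.+ k ℕ.* q)) ℕ.* 2 ≡ q ℕ.* (q ℕ.* 1) ℕ.+ 3 ℕ.* q
    expand = solve-∀

  triangular : ∀ {q k} → q ≡ suc (k ℕ.+ k) → suc k ℕ.* q ≡ (q ℕ.^ 2 ℕ.+ q) ℕ./ 2
  triangular {q} {k} ≡.refl = ≡.trans (≡.sym (ℕ.m*n/n≡m (suc k ℕ.* q) 2)) (≡.cong (ℕ._/ 2) (expand k))
    where
    expand : ∀ k → let q = suc (k ℕ.+ k) in suc k ℕ.* q ℕ.* 2 ≡ q ℕ.* (q ℕ.* 1) ℕ.+ q
    expand = solve-∀

  -- Adding q to the left side gives q³, which takes care of the truncated subtraction.
  cube-minus : ∀ {q n} → suc n ≡ q → n ℕ.* q ℕ.+ q ℕ.* (q ℕ.* n) ≡ q ℕ.^ 3 ℕ.∸ q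
  cube-minus {q} {n} ≡.refl = ≡.trans (≡.sym (ℕ.m+n∸n≡m (n ℕ.* q ℕ.+ q ℕ.* (q ℕ.* n)) q)) (≡.cong (ℕ._∸ q) (expand n))
    where
    expand : ∀ n → let q = suc n in n ℕ.* q ℕ.+ q ℕ.* (q ℕ.* n) ℕ.+ q ≡ q ℕ.* (q ℕ.* (q ℕ.* 1))
    expand = solve-∀

open import Data.Nat.Base using (_+_; _*_; _∸_; _^_; _/_)

lemma4p12 : {c ℓ c′ ℓ′ : Level} (q : ℕ) → IsOddPrimePower q →
    (F : FiniteField c ℓ q) (X : QuadraticExtension F c′ ℓ′) →
    (δ : FiniteField.Carrier F) → Geometry.NonSquare F δ →
    (L : Geometry.Line F) → Geometry._∈o₁₃,₂[_] F L δ →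
    Geometry.OD₄[_,_]≡[_,_,_,_] F X L 1 ((q ^ 2 + 3 * q) / 2) ((q ^ 2 + q) / 2) (q ^ 3 ∸ q)
lemma4p12 q (_ , 2∤q) F X δ δ-nonsquare L L∈o₁₃,₂ =
  let n , 1+n≡q , U   = FieldProperties.card-Units F
      k , q≡1+k+k , K = StandardLine.card-HalfUnits F 2∤q δ δ-nonsquare
  in card-transport {𝓗 = 𝓗₁} (PullBack.𝓗₁-invariant F)
       (StandardLine.card-𝓗₁ F 2∤q δ δ-nonsquare)
   , card-transport {𝓗 = 𝓗₂,ᵣ} (PullBack.𝓗₂,ᵣ-invariant F)
       (≡.subst (HasCardinality (StandardHyperplanes 𝓗₂,ᵣ)) (square-half {q} {k} q≡1+k+k)
         (RealPairs.card-𝓗₂,ᵣ F 2∤q δ δ-nonsquare K))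
   , card-transport {𝓗 = 𝓗₂,ᵢ X} (ImaginaryPullBack.𝓗₂,ᵢ-invariant F X)
       (≡.subst (HasCardinality (StandardHyperplanes (𝓗₂,ᵢ X))) (triangular {q} {k} q≡1+k+k)
         (ImaginaryPairs.card-𝓗₂,ᵢ F 2∤q δ δ-nonsquare X (StandardLine.card-¬Splits F 2∤q δ δ-nonsquare q≡1+k+k K)))
   , card-transport {𝓗 = 𝓗₃} (PullBack.𝓗₃-invariant F)
       (≡.subst (HasCardinality (StandardHyperplanes 𝓗₃)) (cube-minus {q} {n} 1+n≡q)
         (StandardLine.card-𝓗₃ F 2∤q δ δ-nonsquare U))
  where
  open Geometry F using (𝓗₁; 𝓗₂,ᵣ; 𝓗₂,ᵢ; 𝓗₃)

  StandardHyperplanes : ∀ {p} → (Geometry.Hyperplane F → Set p) → Setoid _ _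
  StandardHyperplanes = StandardForms.StandardHyperplanes F δ

  card-transport : ∀ {p n} {𝓗 : Geometry.Hyperplane F → Set p} → PullBack.PullInvariant F 𝓗 →
    HasCardinality (StandardHyperplanes 𝓗) n → HasCardinality (Geometry.hyperplanesThrough F L 𝓗) n
  card-transport {𝓗 = 𝓗} = Transport.card-transport F δ L L∈o₁₃,₂ {𝓗 = 𝓗}
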